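{- Let $n\ge1$ and let $S$ be a subspace of $\mathbb{F}_q^{2n}$ of dimension $s$ with $1\le s\le n$. Define $v_S$ on the chambers of $\mathbb{F}_q^{2n}$ by $v_S(C)=q^{s(2n-s)-n}$ if $C_s=S$, $v_S(C)=1$ if $S\cap C_{2n-s}=\{0\}$, and $v_S(C)=0$ otherwise. Then $v_S$ is an antidesign of $\Gamma_{2n}(q)$ and $\mathds{1}^\top v_S=q^{s(2n-s)-n}(q^n+1)z_s(q)z_{2n-s}(q)$.
   Context: A chamber of $\mathbb{F}_q^{2n}$ is a set $C=\{C_1,\dots,C_{2n-1}\}$ of subspaces with $C_1\subset\cdots\subset C_{2n-1}$, $\dim C_i=i$; chambers $C,D$ are opposite if $C_i\cap D_{2n-i}=\{0\}$ for all $i$. $\Gamma_{2n}(q)$ is the graph on chambers with adjacency being oppositeness. Functions on chambers are vectors indexed by chambers, $\mathds{1}$ the all-ones vector. An antidesign is a function $v$ from chambers to $\mathbb{Q}$ with $e^\top v=0$ for all $e$ in the eigenspace of $\Gamma_{2n}(q)$ for its smallest eigenvalue. $z_m(q)=(q-1)^{ -m}\prod_{i=1}^m(q^i-1)$ is the number of chambers of $\mathbb{F}_q^m$. -}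

module Defs where

open import Level using (0ℓ)
open import Data.Nat as ℕ using (ℕ; zero; suc; _∸_)
open import Data.Fin using (Fin; zero; suc)
open import Data.Integer using (+_)
open import Data.Rational using (ℚ; 0ℚ; 1ℚ)
import Data.Rational as ℚ
open import Data.Product using (Σ; ∃; _×_; _,_)
open import Data.Empty using (⊥)
open import Relation.Nullary using (¬_)
open import Relation.Binary.PropositionalEquality using (_≡_)
open import Algebra.Structures using (IsCommutativeRing)
open import Function.Bundles using (_↔_)

record FiniteField : Set₁ where
  field
    Carrier : Set
    _+_ _*_ : Carrier → Carrier → Carrier
    -_      : Carrier → Carrier
    0# 1#   : Carrier
    isCommutativeRing : IsCommutativeRing _≡_ _+_ _*_ -_ 0# 1#
    0≢1     : ¬ (0# ≡ 1#)
    inverse : ∀ x → ¬ (x ≡ 0#) → Σ Carrier (λ y → x * y ≡ 1#)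
    order   : ℕ
    enumeration : Fin order ↔ Carrier

module _ (F : FiniteField) where
  open FiniteField F

  Vect : ℕ → Set
  Vect m = Fin m → Carrier

  zeroV : ∀ {m} → Vect m
  zeroV _ = 0#

  _≐_ : ∀ {m} → Vect m → Vect m → Set
  x ≐ y = ∀ k → x k ≡ y k

  sumF : ∀ {i} → (Fin i → Carrier) → Carrier
  sumF {zero}  f = 0#
  sumF {suc i} f = f zero + sumF (λ j → f (suc j))

  lincomb : ∀ {i m} → (Fin i → Carrier) → (Fin i → Vect m) → Vect m
  lincomb c b k = sumF (λ j → c j * b j k)

  LinIndep : ∀ {i m} → (Fin i → Vect m) → Set
  LinIndep b = ∀ c → lincomb c b ≐ zeroV → ∀ j → c j ≡ 0#

  record Subspace (m : ℕ) : Set₁ where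
    field
      mem      : Vect m → Set
      mem-resp : ∀ {x y} → x ≐ y → mem x → mem y
      mem-0    : mem zeroV
      mem-+    : ∀ {x y} → mem x → mem y → mem (λ k → x k + y k)
      mem-*    : ∀ a {x} → mem x → mem (λ k → a * x k)
  open Subspace public

  HasDim : ∀ {m} → Subspace m → ℕ → Set
  HasDim {m} S i =
    Σ (Fin i → Vect m) λ b →
      LinIndep b × (∀ j → mem S (b j)) ×
      (∀ x → mem S x → Σ (Fin i → Carrier) λ c → x ≐ lincomb c b)

  _⊆_ : ∀ {m} → Subspace m → Subspace m → Set
  U ⊆ W = ∀ x → mem U x → mem W x

  _≋_ : ∀ {m} → Subspace m → Subspace m → Set
  U ≋ W = (U ⊆ W) × (W ⊆ U)

  TrivInter : ∀ {m} → Subspace m → Subspace m → Set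
  TrivInter U W = ∀ x → mem U x → mem W x → x ≐ zeroV

  -- chambers of F_q^m: C i is C_i for 1 ≤ i ≤ m-1 (other indices ignored)
  record Chamber (m : ℕ) : Set₁ where
    field
      C      : ℕ → Subspace m
      C-dim  : ∀ i → 1 ℕ.≤ i → i ℕ.< m → HasDim (C i) i
      C-incl : ∀ i → 1 ℕ.≤ i → suc i ℕ.< m → C i ⊆ C (suc i)
  open Chamber public

  SameChamber : ∀ {m} → Chamber m → Chamber m → Set
  SameChamber {m} X Y = ∀ i → 1 ℕ.≤ i → i ℕ.< m → C X i ≋ C Y i

  Opposite : ∀ {m} → Chamber m → Chamber m → Set
  Opposite {m} X Y = ∀ i → 1 ℕ.≤ i → i ℕ.< m → TrivInter (C X i) (C Y (m ∸ i))

  record ChamberEnum (m : ℕ) : Set₁ where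
    field
      N        : ℕ
      ch       : Fin N → Chamber m
      complete : ∀ X → Σ (Fin N) λ j → SameChamber X (ch j)
      distinct : ∀ j k → SameChamber (ch j) (ch k) → j ≡ k
  open ChamberEnum public

  IsAdjacency : ∀ {m} (E : ChamberEnum m) → (Fin (N E) → Fin (N E) → ℚ) → Set
  IsAdjacency E A = ∀ j k →
    (Opposite (ch E j) (ch E k) → A j k ≡ 1ℚ) ×
    (¬ Opposite (ch E j) (ch E k) → A j k ≡ 0ℚ)

sumℚ : ∀ {N} → (Fin N → ℚ) → ℚ
sumℚ {zero}  f = 0ℚ
sumℚ {suc N} f = f zero ℚ.+ sumℚ (λ j → f (suc j))

dot : ∀ {N} → (Fin N → ℚ) → (Fin N → ℚ) → ℚ
dot x y = sumℚ (λ j → x j ℚ.* y j)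

matVec : ∀ {N} → (Fin N → Fin N → ℚ) → (Fin N → ℚ) → (Fin N → ℚ)
matVec A x j = sumℚ (λ k → A j k ℚ.* x k)

IsEigenvector : ∀ {N} → (Fin N → Fin N → ℚ) → ℚ → (Fin N → ℚ) → Set
IsEigenvector A λ' e = ∀ j → matVec A e j ≡ λ' ℚ.* e j

-- λ' is the smallest eigenvalue of the symmetric matrix A:
-- it is an eigenvalue, and every (real) eigenvalue is ≥ λ'
-- (Rayleigh: xᵀAx ≥ λ' xᵀx for all x; by density it suffices over ℚ).
IsSmallestEigenvalue : ∀ {N} → (Fin N → Fin N → ℚ) → ℚ → Set
IsSmallestEigenvalue A λ' =
  (Σ _ λ e → (Σ _ λ j → ¬ (e j ≡ 0ℚ)) × IsEigenvector A λ' e) ×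
  (∀ x → λ' ℚ.* dot x x ℚ.≤ dot x (matVec A x))

Antidesign : ∀ {N} → (Fin N → Fin N → ℚ) → (Fin N → ℚ) → Set
Antidesign A v =
  Σ ℚ λ λ' → IsSmallestEigenvalue A λ' ×
    (∀ e → IsEigenvector A λ' e → dot e v ≡ 0ℚ)

fromℕ : ℕ → ℚ
fromℕ n = + n ℚ./ 1

-- [i]_q = 1 + q + ... + q^(i-1) = (q^i - 1)/(q - 1)
qint : ℕ → ℕ → ℕ
qint zero    q = 0
qint (suc i) q = q ℕ.^ i ℕ.+ qint i q

-- z_m(q) = (q-1)^{-m} ∏_{i=1}^m (q^i - 1) = ∏_{i=1}^m [i]_q
z : ℕ → ℕ → ℕ
z zero    q = 1
z (suc m) q = qint (suc m) q ℕ.* z m q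

module _ (F : FiniteField) where
  open FiniteField F

  IsVS : ∀ (n s : ℕ) (S : Subspace F (2 ℕ.* n)) (E : ChamberEnum F (2 ℕ.* n)) →
         (Fin (N E) → ℚ) → Set
  IsVS n s S E v = ∀ j →
    (_≋_ F (C (ch E j) s) S → v j ≡ fromℕ (order ℕ.^ (s ℕ.* (2 ℕ.* n ∸ s) ∸ n))) ×
    (TrivInter F S (C (ch E j) (2 ℕ.* n ∸ s)) → v j ≡ 1ℚ) ×
    (¬ (_≋_ F (C (ch E j) s) S) → ¬ TrivInter F S (C (ch E j) (2 ℕ.* n ∸ s)) → v j ≡ 0ℚ)

{-# OPTIONS --safe #-}

{-
Write T_i for adjacency of chambers in position i, A for oppositeness, δ for the indicator of the chambers
C with C_s = S, and ρ = q^(N - n) with N = n (2n - 1). A chamber X has an opposite chamber through S only if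
S ∩ X_{2n-s} = 0; projecting X to the residue of S then splits oppositeness into oppositeness below and
above S, so the number of such chambers is the constant Q = q^(N - s(2n-s)). Hence (A + ρ) δ = Q v_S, which
makes v_S orthogonal to the kernel of A + ρ and gives its sum.

It remains to see that -ρ is the smallest eigenvalue. Let A_k denote oppositeness in the positions 1, …, k - 1
and c_k = T_1 ⋯ T_{k-1}. Then A_{k+1} = c_{k+1} A_k, and L_k = c_kᵀ c_k satisfies L_{k+1} = T_k L_k T_k. Let P_k
be the average over all choices of the positions 1, …, k - 1. Using the quadratic relation of T_k and
[k] P_k T_k P_k = [k+1] P_{k+1} - P_k, induction on k shows that L_{k+1} acts as q^(k-1) on the image of P_k
inside the kernel of P_{k+1}, and that L_{k+1} ≤ q^(2k-1) on the kernel of P_{k+1}. Since A_{k+1}² =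
A_k L_{k+1} A_k, these two facts bound ‖A x‖ by ρ ‖x‖ for every x orthogonal to the constants, with A² = ρ²
on functions of the hyperplane with sum zero.
-}
module Submission where

open import Defs
open import Data.Nat as ℕ using (ℕ; zero; suc; _≤_; _<_; z≤n; s≤s)
import Data.Nat.Properties as ℕ
open import Data.Fin as Fin using (Fin; zero; suc; _↑ˡ_; _↑ʳ_; splitAt; funToFin; finToFun)
import Data.Fin.Properties as Fin
import Data.Integer as ℤ
import Data.Integer.Properties as ℤ
open import Data.Rational as ℚ using (ℚ; 0ℚ; 1ℚ)
open import Data.Rational.Properties as ℚ
  using (+-*-commutativeRing; +-identityˡ; +-identityʳ; +-comm; *-comm; *-assoc;
         *-identityˡ; *-identityʳ; *-zeroˡ; *-zeroʳ; *-distribˡ-+; *-distribʳ-+)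
open import Data.Rational.Unnormalised as ℚᵘ using (mkℚᵘ)
import Data.Rational.Unnormalised.Properties as ℚᵘ
open import Data.Product using (Σ; _×_; _,_; proj₁; proj₂)
open import Data.Sum using (_⊎_; inj₁; inj₂; [_,_]′)
open import Data.Unit using (⊤; tt)
open import Data.Maybe using (Maybe; just; nothing)
open import Function using (_∘_; Inverse)
open import Relation.Nullary using (Dec; yes; no; ¬_; contradiction)
open import Relation.Nullary.Decidable using (_×-dec_; _⊎-dec_; _→-dec_; ¬?; map′)
open import Relation.Binary.PropositionalEquality hiding (resp)
open import Algebra.Bundles using (CommutativeRing)
import Algebra.Properties.Ring as RingProperties
import Algebra.Properties.CommutativeSemigroup as CommutativeSemigroupProperties
open import Tactic.RingSolver.Core.AlmostCommutativeRing using (AlmostCommutativeRing; fromCommutativeRing)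
open import Tactic.RingSolver using (solve-∀)

-- Being the smallest eigenvalue is expressed by a rational eigenvector and a rational quadratic
-- form, so every estimate splits a vector orthogonally into pieces on which the operator is a
-- scalar and a remainder left to the induction. The obstacle is that A itself is rarely a scalar on
-- such a piece: opposition turns a function of the hyperplane into a function of the point. Its
-- square is a scalar there, which is why the norm of A x is bounded before the form of A. The
-- square has the scalar q^(m-2) a² for dimension m, where a is the number of opposite chambers in
-- dimension m - 1. As m = 2n is even, this is the square of a power of q, so -ρ is rational. The
-- weight q^(s(2n-s)-n) in v_S is ρ / Q, the value that turns (A + ρ) δ into a multiple of v_S. On
-- the geometric side every matrix is the zero-one matrix of a relation between chambers. A product
-- of two of them is identified by showing that the intermediate chamber is forced by its
-- neighbours.

module Matrices where
  open import Data.Rational using (_+_; _*_; _-_; -_)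

  ℚ-ring : AlmostCommutativeRing _ _
  ℚ-ring = fromCommutativeRing +-*-commutativeRing (λ x → decToMaybe (0ℚ ℚ.≟ x))
    where
    decToMaybe : ∀ {P : Set} → Dec P → Maybe P
    decToMaybe (yes p) = just p
    decToMaybe (no _)  = nothing

  -- Rational arithmetic of natural numbers and powers.

  toℚᵘ-fromℕ : ∀ n → ℚ.toℚᵘ (fromℕ n) ℚᵘ.≃ mkℚᵘ (ℤ.+ n) 0
  toℚᵘ-fromℕ n = ℚ.toℚᵘ-fromℚᵘ (mkℚᵘ (ℤ.+ n) 0)

  fromℕ-+ : ∀ a b → fromℕ (a ℕ.+ b) ≡ fromℕ a + fromℕ b
  fromℕ-+ a b = ℚ.toℚᵘ-injective (begin
    ℚ.toℚᵘ (fromℕ (a ℕ.+ b)) ≈⟨ toℚᵘ-fromℕ (a ℕ.+ b) ⟩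
    mkℚᵘ (ℤ.+ (a ℕ.+ b)) 0 ≈⟨ ℚᵘ.*≡* (cong (ℤ._* ℤ.+ 1) (trans (ℤ.pos-+ a b)
        (sym (cong₂ ℤ._+_ (ℤ.*-identityʳ (ℤ.+ a)) (ℤ.*-identityʳ (ℤ.+ b)))))) ⟩
    mkℚᵘ (ℤ.+ a) 0 ℚᵘ.+ mkℚᵘ (ℤ.+ b) 0 ≈⟨ ℚᵘ.+-cong (ℚᵘ.≃-sym (toℚᵘ-fromℕ a)) (ℚᵘ.≃-sym (toℚᵘ-fromℕ b)) ⟩
    ℚ.toℚᵘ (fromℕ a) ℚᵘ.+ ℚ.toℚᵘ (fromℕ b) ≈⟨ ℚᵘ.≃-sym (ℚ.toℚᵘ-homo-+ (fromℕ a) (fromℕ b)) ⟩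
    ℚ.toℚᵘ (fromℕ a + fromℕ b) ∎)
    where open ℚᵘ.≃-Reasoning

  fromℕ-* : ∀ a b → fromℕ (a ℕ.* b) ≡ fromℕ a * fromℕ b
  fromℕ-* a b = ℚ.toℚᵘ-injective (begin
    ℚ.toℚᵘ (fromℕ (a ℕ.* b)) ≈⟨ toℚᵘ-fromℕ (a ℕ.* b) ⟩
    mkℚᵘ (ℤ.+ (a ℕ.* b)) 0 ≈⟨ ℚᵘ.*≡* (cong (ℤ._* ℤ.+ 1) (ℤ.pos-* a b)) ⟩
    mkℚᵘ (ℤ.+ a) 0 ℚᵘ.* mkℚᵘ (ℤ.+ b) 0 ≈⟨ ℚᵘ.*-cong (ℚᵘ.≃-sym (toℚᵘ-fromℕ a)) (ℚᵘ.≃-sym (toℚᵘ-fromℕ b)) ⟩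
    ℚ.toℚᵘ (fromℕ a) ℚᵘ.* ℚ.toℚᵘ (fromℕ b) ≈⟨ ℚᵘ.≃-sym (ℚ.toℚᵘ-homo-* (fromℕ a) (fromℕ b)) ⟩
    ℚ.toℚᵘ (fromℕ a * fromℕ b) ∎)
    where open ℚᵘ.≃-Reasoning

  fromℕ-mono : ∀ {a b} → a ℕ.≤ b → fromℕ a ℚ.≤ fromℕ b
  fromℕ-mono {a} {b} a≤b = ℚ.toℚᵘ-cancel-≤ (begin
    ℚ.toℚᵘ (fromℕ a) ≃⟨ toℚᵘ-fromℕ a ⟩
    mkℚᵘ (ℤ.+ a) 0 ≤⟨ ℚᵘ.*≤* (ℤ.*-monoʳ-≤-nonNeg (ℤ.+ 1) (ℤ.+≤+ a≤b)) ⟩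
    mkℚᵘ (ℤ.+ b) 0 ≃⟨ ℚᵘ.≃-sym (toℚᵘ-fromℕ b) ⟩
    ℚ.toℚᵘ (fromℕ b) ∎)
    where open ℚᵘ.≤-Reasoning

  infixr 8 _^ℚ_
  _^ℚ_ : ℚ → ℕ → ℚ
  x ^ℚ zero  = 1ℚ
  x ^ℚ suc n = x * x ^ℚ n

  ^-+ : ∀ x a b → x ^ℚ (a ℕ.+ b) ≡ x ^ℚ a * x ^ℚ b
  ^-+ x zero    b = sym (*-identityˡ _)
  ^-+ x (suc a) b = trans (cong (x *_) (^-+ x a b)) (sym (*-assoc x _ _))

  fromℕ-^ : ∀ a n → fromℕ (a ℕ.^ n) ≡ fromℕ a ^ℚ n
  fromℕ-^ a zero    = refl
  fromℕ-^ a (suc n) = trans (fromℕ-* a (a ℕ.^ n)) (cong (fromℕ a *_) (fromℕ-^ a n))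

  -- Finite sums, matrices and quadratic forms over ℚ.

  Mat : ℕ → ℕ → Set
  Mat M N = Fin M → Fin N → ℚ

  sum-cong : ∀ {N} {f g : Fin N → ℚ} → (∀ k → f k ≡ g k) → sumℚ f ≡ sumℚ g
  sum-cong {zero}  h = refl
  sum-cong {suc N} h = cong₂ _+_ (h zero) (sum-cong (h ∘ suc))

  sum-0 : ∀ {N} {f : Fin N → ℚ} → (∀ k → f k ≡ 0ℚ) → sumℚ f ≡ 0ℚ
  sum-0 {zero}  h = refl
  sum-0 {suc N} h = trans (cong₂ _+_ (h zero) (sum-0 (h ∘ suc))) (+-identityˡ 0ℚ)

  private
    interchange : ∀ (a b c d : ℚ) → (a + b) + (c + d) ≡ (a + c) + (b + d)
    interchange = solve-∀ ℚ-ring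

  sum-+ : ∀ {N} (f g : Fin N → ℚ) → sumℚ (λ k → f k + g k) ≡ sumℚ f + sumℚ g
  sum-+ {zero}  f g = refl
  sum-+ {suc N} f g = trans (cong ((f zero + g zero) +_) (sum-+ (f ∘ suc) (g ∘ suc))) (interchange (f zero) (g zero) (sumℚ (f ∘ suc)) (sumℚ (g ∘ suc)))

  sum-*ˡ : ∀ {N} a (f : Fin N → ℚ) → sumℚ (λ k → a * f k) ≡ a * sumℚ f
  sum-*ˡ {zero}  a f = sym (*-zeroʳ a)
  sum-*ˡ {suc N} a f = trans (cong (a * f zero +_) (sum-*ˡ a (f ∘ suc))) (sym (*-distribˡ-+ a _ _))

  sum-*ʳ : ∀ {N} a (f : Fin N → ℚ) → sumℚ (λ k → f k * a) ≡ sumℚ f * a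
  sum-*ʳ a f = trans (sum-cong (λ k → *-comm (f k) a)) (trans (sum-*ˡ a f) (*-comm a _))

  sum-swap : ∀ {M N} (f : Fin M → Fin N → ℚ) →
    sumℚ (λ j → sumℚ (λ k → f j k)) ≡ sumℚ (λ k → sumℚ (λ j → f j k))
  sum-swap {zero} {N} f = sym (sum-0 {N} {λ _ → 0ℚ} (λ _ → refl))
  sum-swap {suc M} f = trans (cong (sumℚ (f zero) +_) (sum-swap (f ∘ suc)))
                             (sym (sum-+ (f zero) (λ k → sumℚ (λ j → f (suc j) k))))

  sum-single : ∀ {N} (f : Fin N → ℚ) k → (∀ k′ → k′ ≢ k → f k′ ≡ 0ℚ) → sumℚ f ≡ f k
  sum-single f zero    h = trans (cong (f zero +_) (sum-0 (λ k → h (suc k) λ ()))) (+-identityʳ _)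
  sum-single f (suc k) h = trans (cong₂ _+_ (h zero λ ())
      (sum-single (f ∘ suc) k (λ k′ k′≢k → h (suc k′) (k′≢k ∘ Fin.suc-injective)))) (+-identityˡ _)

  sum-nonneg : ∀ {N} {f : Fin N → ℚ} → (∀ k → 0ℚ ℚ.≤ f k) → 0ℚ ℚ.≤ sumℚ f
  sum-nonneg {zero}  h = ℚ.≤-refl
  sum-nonneg {suc N} h = ℚ.+-mono-≤ (h zero) (sum-nonneg (h ∘ suc))

  sum-1 : ∀ N → sumℚ {N} (λ _ → 1ℚ) ≡ fromℕ N
  sum-1 zero    = refl
  sum-1 (suc N) = trans (cong (1ℚ +_) (sum-1 N)) (sym (fromℕ-+ 1 N))

  infixl 7 _⊡_
  _⊡_ : ∀ {L M N} → Mat L M → Mat M N → Mat L N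
  (A ⊡ B) j l = sumℚ (λ k → A j k * B k l)

  matVec-cong : ∀ {N} (A : Mat N N) {x y} → (∀ k → x k ≡ y k) → ∀ j → matVec A x j ≡ matVec A y j
  matVec-cong A h j = sum-cong (λ k → cong (A j k *_) (h k))

  matVec-congˡ : ∀ {N} {A B : Mat N N} → (∀ j k → A j k ≡ B j k) → ∀ x j → matVec A x j ≡ matVec B x j
  matVec-congˡ h x j = sum-cong (λ k → cong (_* x k) (h j k))

  matVec-+ : ∀ {N} (A : Mat N N) x y j → matVec A (λ k → x k + y k) j ≡ matVec A x j + matVec A y j
  matVec-+ A x y j = trans (sum-cong (λ k → *-distribˡ-+ (A j k) (x k) (y k)))
                           (sum-+ (λ k → A j k * x k) (λ k → A j k * y k))

  private
    pull : ∀ (a m x : ℚ) → m * (a * x) ≡ a * (m * x)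
    pull = solve-∀ ℚ-ring

  matVec-* : ∀ {N} (A : Mat N N) a x j → matVec A (λ k → a * x k) j ≡ a * matVec A x j
  matVec-* A a x j = trans (sum-cong (λ k → pull a (A j k) (x k))) (sum-*ˡ a (λ k → A j k * x k))

  matVec-⊡ : ∀ {N} (A B : Mat N N) x j → matVec (A ⊡ B) x j ≡ matVec A (matVec B x) j
  matVec-⊡ A B x j = begin
    sumℚ (λ l → sumℚ (λ k → A j k * B k l) * x l) ≡⟨ sum-cong (λ l → sym (sum-*ʳ (x l) (λ k → A j k * B k l))) ⟩
    sumℚ (λ l → sumℚ (λ k → A j k * B k l * x l)) ≡⟨ sum-swap (λ l k → A j k * B k l * x l) ⟩
    sumℚ (λ k → sumℚ (λ l → A j k * B k l * x l)) ≡⟨ sum-cong (λ k → trans (sum-cong (λ l → *-assoc (A j k) (B k l) (x l)))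
        (sum-*ˡ (A j k) (λ l → B k l * x l))) ⟩
    sumℚ (λ k → A j k * sumℚ (λ l → B k l * x l)) ∎
    where open ≡-Reasoning

  dot-comm : ∀ {N} (x y : Fin N → ℚ) → dot x y ≡ dot y x
  dot-comm x y = sum-cong (λ k → *-comm (x k) (y k))

  dot-cong : ∀ {N} {x x′ y y′ : Fin N → ℚ} → (∀ k → x k ≡ x′ k) → (∀ k → y k ≡ y′ k) → dot x y ≡ dot x′ y′
  dot-cong h h′ = sum-cong (λ k → cong₂ _*_ (h k) (h′ k))

  dot-+ʳ : ∀ {N} (x y z : Fin N → ℚ) → dot x (λ k → y k + z k) ≡ dot x y + dot x z
  dot-+ʳ x y z = trans (sum-cong (λ k → *-distribˡ-+ (x k) (y k) (z k))) (sum-+ (λ k → x k * y k) (λ k → x k * z k))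

  dot-*ʳ : ∀ {N} a (x y : Fin N → ℚ) → dot x (λ k → a * y k) ≡ a * dot x y
  dot-*ʳ a x y = trans (sum-cong (λ k → pull a (x k) (y k))) (sum-*ˡ a (λ k → x k * y k))

  dot-*ˡ : ∀ {N} a (y x : Fin N → ℚ) → dot (λ k → a * y k) x ≡ a * dot y x
  dot-*ˡ a y x = trans (dot-comm _ x) (trans (dot-*ʳ a x y) (cong (a *_) (dot-comm x y)))

  square-nonneg : ∀ x → 0ℚ ℚ.≤ x * x
  square-nonneg x with ℚ.≤-total 0ℚ x
  ... | inj₁ 0≤x = subst (ℚ._≤ x * x) (*-zeroʳ x) (ℚ.*-monoˡ-≤-nonNeg x {{ℚ.nonNegative 0≤x}} 0≤x)
  ... | inj₂ x≤0 = subst (ℚ._≤ x * x) (*-zeroʳ x) (ℚ.*-monoˡ-≤-nonPos x {{ℚ.nonPositive x≤0}} x≤0)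

  dot-nonneg : ∀ {N} (x : Fin N → ℚ) → 0ℚ ℚ.≤ dot x x
  dot-nonneg x = sum-nonneg (λ k → square-nonneg (x k))

  infix 9 _ᵀ
  _ᵀ : ∀ {M N} → Mat M N → Mat N M
  (A ᵀ) j k = A k j

  dot-ᵀ : ∀ {N} (A : Mat N N) x y → dot (matVec A x) y ≡ dot x (matVec (A ᵀ) y)
  dot-ᵀ A x y = begin
    sumℚ (λ j → sumℚ (λ k → A j k * x k) * y j) ≡⟨ sum-cong (λ j → sym (sum-*ʳ (y j) (λ k → A j k * x k))) ⟩
    sumℚ (λ j → sumℚ (λ k → A j k * x k * y j)) ≡⟨ sum-swap (λ j k → A j k * x k * y j) ⟩
    sumℚ (λ k → sumℚ (λ j → A j k * x k * y j)) ≡⟨ sum-cong (λ k → sum-cong (λ j → reorder (A j k) (x k) (y j))) ⟩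
    sumℚ (λ k → sumℚ (λ j → x k * (A j k * y j))) ≡⟨ sum-cong (λ k → sum-*ˡ (x k) (λ j → A j k * y j)) ⟩
    sumℚ (λ k → x k * sumℚ (λ j → A j k * y j)) ∎
    where
    open ≡-Reasoning
    reorder : ∀ (a x y : ℚ) → a * x * y ≡ x * (a * y)
    reorder = solve-∀ ℚ-ring

  Sym : ∀ {N} → Mat N N → Set
  Sym A = ∀ j k → A j k ≡ A k j

  dot-sym : ∀ {N} {A : Mat N N} → Sym A → ∀ x y → dot (matVec A x) y ≡ dot x (matVec A y)
  dot-sym {A = A} s x y = trans (dot-ᵀ A x y) (dot-cong {x = x} (λ _ → refl) (matVec-congˡ (λ j k → s k j) y))

  ⊡-ᵀ : ∀ {L M N} (A : Mat L M) (B : Mat M N) → ∀ j k → ((A ⊡ B) ᵀ) j k ≡ (B ᵀ ⊡ A ᵀ) j k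
  ⊡-ᵀ A B j k = sum-cong (λ l → *-comm (A k l) (B l j))

  -- Each entry carries a decision of the relation. The matrix thus doubles as a decision procedure,
  -- and an identity of matrices reduces to an equivalence of relations (`ind-unique`).
  Ind : ∀ {M N} → Mat M N → (Fin M → Fin N → Set) → Set
  Ind A R = ∀ j k → (R j k × A j k ≡ 1ℚ) ⊎ (¬ R j k × A j k ≡ 0ℚ)

  module _ {M N} {A : Mat M N} {R : Fin M → Fin N → Set} (ind : Ind A R) where

    ind-1 : ∀ {j k} → R j k → A j k ≡ 1ℚ
    ind-1 {j} {k} r with ind j k
    ... | inj₁ (_ , e) = e
    ... | inj₂ (n , _) = contradiction r n

    ind-0 : ∀ {j k} → ¬ R j k → A j k ≡ 0ℚ
    ind-0 {j} {k} n with ind j k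
    ... | inj₁ (r , _) = contradiction r n
    ... | inj₂ (_ , e) = e

    ind-dec : ∀ j k → Dec (R j k)
    ind-dec j k with ind j k
    ... | inj₁ (r , _) = yes r
    ... | inj₂ (n , _) = no n

    ind-nonneg : ∀ j k → 0ℚ ℚ.≤ A j k
    ind-nonneg j k with ind j k
    ... | inj₁ (_ , e) = subst (0ℚ ℚ.≤_) (sym e) (ℚ.*≤* (ℤ.+≤+ ℕ.z≤n))
    ... | inj₂ (_ , e) = ℚ.≤-reflexive (sym e)

    ind-unique : ∀ {B : Mat M N} {S : Fin M → Fin N → Set} → Ind B S →
      (∀ {j k} → R j k → S j k) → (∀ {j k} → S j k → R j k) → ∀ j k → A j k ≡ B j k
    ind-unique indB f g j k with ind j k | indB j k
    ... | inj₁ (_ , e) | inj₁ (_ , e′) = trans e (sym e′)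
    ... | inj₂ (_ , e) | inj₂ (_ , e′) = trans e (sym e′)
    ... | inj₁ (r , _) | inj₂ (n , _)  = contradiction (f r) n
    ... | inj₂ (n , _) | inj₁ (s , _)  = contradiction (g s) n

    ind-⇔ : ∀ {S : Fin M → Fin N → Set} → (∀ {j k} → R j k → S j k) → (∀ {j k} → S j k → R j k) → Ind A S
    ind-⇔ f g j k with ind j k
    ... | inj₁ (r , e) = inj₁ (f r , e)
    ... | inj₂ (n , e) = inj₂ (n ∘ g , e)

    ind-const : ∀ {j c} (x : Fin N → ℚ) → (∀ k → R j k → x k ≡ c) →
      sumℚ (λ k → A j k * x k) ≡ sumℚ (A j) * c
    ind-const {j} {c} x h = trans (sum-cong pointwise) (sum-*ʳ c (A j))
      where
      pointwise : ∀ k → A j k * x k ≡ A j k * c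
      pointwise k with ind j k
      ... | inj₁ (r , _) = cong (A j k *_) (h k r)
      ... | inj₂ (_ , e) = trans (cong (_* x k) e) (trans (*-zeroˡ (x k)) (sym (trans (cong (_* c) e) (*-zeroˡ c))))

  ind-mat : ∀ {M N} {R : Fin M → Fin N → Set} → (∀ j k → Dec (R j k)) → Σ (Mat M N) (λ A → Ind A R)
  ind-mat {M} {N} {R} d = (λ j k → val (d j k)) , λ j k → spec (d j k)
    where
    val : ∀ {P : Set} → Dec P → ℚ
    val (yes _) = 1ℚ
    val (no _)  = 0ℚ
    spec : ∀ {P : Set} (e : Dec P) → (P × val e ≡ 1ℚ) ⊎ (¬ P × val e ≡ 0ℚ)
    spec (yes p) = inj₁ (p , refl)
    spec (no n)  = inj₂ (n , refl)

  ind-sym : ∀ {N} {A : Mat N N} {R : Fin N → Fin N → Set} → Ind A R → (∀ {j k} → R j k → R k j) → Sym A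
  ind-sym {R = R} ind s j k = ind-unique ind {S = λ j k → R k j} (λ j k → ind k j) s s j k

  -- An entry of the product counts intermediate points. If related endpoints have exactly one and
  -- other endpoints have none, the product is again a zero-one matrix. The length-additive products
  -- T_u T_v = T_{uv} of the Hecke algebra are obtained in this form.
  ind-⊡ : ∀ {L M N} {A : Mat L M} {B : Mat M N} {R : Fin L → Fin M → Set} {S : Fin M → Fin N → Set}
    {T : Fin L → Fin N → Set} → Ind A R → Ind B S →
    (∀ {j k l} → R j k → S k l → T j l) →
    (∀ {j l} → T j l → Σ (Fin M) λ k → R j k × S k l × (∀ k′ → R j k′ → S k′ l → k′ ≡ k)) →
    Ind (A ⊡ B) T
  ind-⊡ {A = A} {B} {R} {S} {T} indA indB f g j l with Fin.any? (λ k → ind-dec indA j k ×-dec ind-dec indB k l)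
  ... | no none = inj₂ (nT , sum-0 zeroTerm)
    where
    nT : ¬ T j l
    nT t with k , r , s , _ ← g t = none (k , r , s)
    zeroTerm : ∀ k → A j k * B k l ≡ 0ℚ
    zeroTerm k with indA j k | indB k l
    ... | inj₂ (_ , e) | _            = trans (cong (_* B k l) e) (*-zeroˡ (B k l))
    ... | inj₁ _       | inj₂ (_ , e) = trans (cong (A j k *_) e) (*-zeroʳ (A j k))
    ... | inj₁ (r , _) | inj₁ (s , _) = contradiction (k , r , s) none
  ... | yes (k₁ , r₁ , s₁) with f r₁ s₁
  ... | t with k , r , s , unique ← g t =
    inj₁ (t , trans (sum-single (λ k → A j k * B k l) k zeroTerm) (cong₂ _*_ (ind-1 indA r) (ind-1 indB s)))
    where
    zeroTerm : ∀ k′ → k′ ≢ k → A j k′ * B k′ l ≡ 0ℚ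
    zeroTerm k′ k′≢k with indA j k′ | indB k′ l
    ... | inj₂ (_ , e) | _            = trans (cong (_* B k′ l) e) (*-zeroˡ (B k′ l))
    ... | inj₁ _       | inj₂ (_ , e) = trans (cong (A j k′ *_) e) (*-zeroʳ (A j k′))
    ... | inj₁ (r′ , _) | inj₁ (s′ , _) = contradiction (unique k′ r′ s′) k′≢k

  identity : ∀ {N} → Mat N N
  identity = proj₁ (ind-mat Fin._≟_)

  ind-identity : ∀ {N} → Ind (identity {N}) _≡_
  ind-identity = proj₂ (ind-mat Fin._≟_)

  matVec-identity : ∀ {N} (x : Fin N → ℚ) j → matVec identity x j ≡ x j
  matVec-identity x j = trans
    (sum-single (λ k → identity j k * x k) j (λ k k≢j → trans (cong (_* x k) (ind-0 ind-identity (k≢j ∘ sym))) (*-zeroˡ (x k))))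
    (trans (cong (_* x j) (ind-1 (ind-identity {_}) {j} {j} refl)) (*-identityˡ (x j)))

  -- Since f is a bijection onto the relatives of j, row j is the all-ones row over `Fin n` times
  -- the graph of f. Exchanging the two sums leaves n sums with a single 1 each.
  row-count : ∀ {M N} {A : Mat M N} {R : Fin M → Fin N → Set} → Ind A R → ∀ j {n} (f : Fin n → Fin N) →
    (∀ a b → f a ≡ f b → a ≡ b) → (∀ a → R j (f a)) → (∀ k → R j k → Σ (Fin n) λ a → f a ≡ k) →
    sumℚ (A j) ≡ fromℕ n
  row-count {A = A} {R} ind j {n} f inj into onto = begin
    sumℚ (A j) ≡⟨ sum-cong (λ k → ind-unique (λ _ → ind j) {B = λ (_ : Fin 1) k → (ones ⊡ G) zero k}
        (λ _ → indOG zero) (λ r → r) (λ r → r) zero k) ⟩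
    sumℚ (λ k → sumℚ (λ a → 1ℚ * G a k)) ≡⟨ sum-swap (λ k a → 1ℚ * G a k) ⟩
    sumℚ (λ a → sumℚ (λ k → 1ℚ * G a k)) ≡⟨ sum-cong (λ a → trans (sum-single (λ k → 1ℚ * G a k) (f a)
        (λ k k≢fa → cong (1ℚ *_) (ind-0 indG (k≢fa ∘ sym)))) (cong (1ℚ *_) (ind-1 indG refl))) ⟩
    sumℚ (λ (a : Fin n) → 1ℚ) ≡⟨ sum-1 n ⟩
    fromℕ n ∎
    where
    open ≡-Reasoning
    G : Mat n _
    G a k = identity (f a) k
    indG : Ind G (λ a k → f a ≡ k)
    indG a k = ind-identity (f a) k
    ones : Mat 1 n
    ones _ _ = 1ℚ
    indOG : Ind (ones ⊡ G) (λ _ k → R j k)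
    indOG = ind-⊡ {R = λ _ _ → Fin.zero {0} ≡ zero} {S = λ a k → f a ≡ k} (λ _ _ → inj₁ (refl , refl)) indG
      (λ { _ refl → into _ })
      (λ {_} {k} r → proj₁ (onto k r) , refl , proj₂ (onto k r) ,
         λ a′ _ e → inj a′ (proj₁ (onto k r)) (trans e (sym (proj₂ (onto k r)))))

  -- q ^ (d (d + 1) / 2), the number of chambers opposite to a given one in dimension d + 1.
  oppCount : ℚ → ℕ → ℚ
  oppCount q zero    = 1ℚ
  oppCount q (suc d) = q ^ℚ suc d * oppCount q d

  row-⊡ : ∀ {L M N} (A : Mat L M) (B : Mat M N) {r} → (∀ k → sumℚ (B k) ≡ r) → ∀ j → sumℚ ((A ⊡ B) j) ≡ sumℚ (A j) * r
  row-⊡ A B {r} h j = begin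
    sumℚ (λ l → sumℚ (λ k → A j k * B k l)) ≡⟨ sum-swap (λ l k → A j k * B k l) ⟩
    sumℚ (λ k → sumℚ (λ l → A j k * B k l)) ≡⟨ sum-cong (λ k → trans (sum-*ˡ (A j k) (B k)) (cong (A j k *_) (h k))) ⟩
    sumℚ (λ k → A j k * r) ≡⟨ sum-*ʳ r (A j) ⟩
    sumℚ (A j) * r ∎
    where open ≡-Reasoning

  row-identity : ∀ {N} (j : Fin N) → sumℚ (identity j) ≡ 1ℚ
  row-identity j = trans (sum-single (identity j) j (λ k k≢j → ind-0 ind-identity (k≢j ∘ sym))) (ind-1 ind-identity {j} {j} refl)

  ind-cong : ∀ {M N} {A : Mat M N} {R : Fin M → Fin N → Set} → Ind A R → ∀ {j k j′ k′} →
    (R j k → R j′ k′) → (R j′ k′ → R j k) → A j k ≡ A j′ k′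
  ind-cong ind {j} {k} {j′} {k′} f g with ind j k | ind j′ k′
  ... | inj₁ (_ , e) | inj₁ (_ , e′) = trans e (sym e′)
  ... | inj₂ (_ , e) | inj₂ (_ , e′) = trans e (sym e′)
  ... | inj₁ (r , _) | inj₂ (n , _)  = contradiction (f r) n
  ... | inj₂ (n , _) | inj₁ (s , _)  = contradiction (g s) n

  -- S does not distinguish points related by R, so all nonzero terms of the row of A meet the same
  -- entry of B.
  ind-absorb : ∀ {M N} {A : Mat M M} {B : Mat M N} {R : Fin M → Fin M → Set} {S : Fin M → Fin N → Set} →
    Ind A R → Ind B S → (∀ {j k l} → R j k → S j l → S k l) → (∀ {j k l} → R j k → S k l → S j l) →
    ∀ {r} → (∀ j → sumℚ (A j) ≡ r) → ∀ j l → (A ⊡ B) j l ≡ r * B j l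
  ind-absorb {B = B} indA indB f g row j l = trans (ind-const indA (λ k → B k l) (λ k r → ind-cong indB (g r) (f r)))
    (cong (_* B j l) (row j))

  matVec-absorb : ∀ {N} {A B : Mat N N} {r} → (∀ j l → (A ⊡ B) j l ≡ r * B j l) →
    ∀ x j → matVec A (matVec B x) j ≡ r * matVec B x j
  matVec-absorb {A = A} {B} {r} h x j = trans (sym (matVec-⊡ A B x j)) (trans (sum-cong (λ l → trans (cong (_* x l) (h j l)) (*-assoc r (B j l) (x l))))
    (sum-*ˡ r (λ l → B j l * x l)))

  ind-× : ∀ {P Q : Set} {x y : ℚ} → (P × x ≡ 1ℚ) ⊎ (¬ P × x ≡ 0ℚ) → (Q × y ≡ 1ℚ) ⊎ (¬ Q × y ≡ 0ℚ) →
    ((P × Q) × x * y ≡ 1ℚ) ⊎ (¬ (P × Q) × x * y ≡ 0ℚ)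
  ind-× {y = y} (inj₁ (p , refl)) (inj₁ (r , refl)) = inj₁ ((p , r) , refl)
  ind-× {x = x} (inj₁ (_ , _)) (inj₂ (n , refl)) = inj₂ (n ∘ proj₂ , *-zeroʳ x)
  ind-× {y = y} (inj₂ (n , refl)) _ = inj₂ (n ∘ proj₁ , *-zeroˡ y)

  matVec-lin : ∀ {N} (A : Mat N N) a x b y {z} → (∀ k → z k ≡ a * x k + b * y k) →
    ∀ j → matVec A z j ≡ a * matVec A x j + b * matVec A y j
  matVec-lin A a x b y h j = trans (matVec-cong A h j)
    (trans (matVec-+ A (λ k → a * x k) (λ k → b * y k) j) (cong₂ _+_ (matVec-* A a x j) (matVec-* A b y j)))

  matVec-scale : ∀ {N} (A : Mat N N) a x {z} → (∀ k → z k ≡ a * x k) → ∀ j → matVec A z j ≡ a * matVec A x j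
  matVec-scale A a x h j = trans (matVec-cong A h j) (matVec-* A a x j)

  dot-linʳ : ∀ {N} (w : Fin N → ℚ) a x b y {z} → (∀ k → z k ≡ a * x k + b * y k) → dot w z ≡ a * dot w x + b * dot w y
  dot-linʳ w a x b y h = trans (dot-cong {x = w} (λ _ → refl) h)
    (trans (dot-+ʳ w (λ k → a * x k) (λ k → b * y k)) (cong₂ _+_ (dot-*ʳ a w x) (dot-*ʳ b w y)))

  dot-linˡ : ∀ {N} (w : Fin N → ℚ) a x b y {z} → (∀ k → z k ≡ a * x k + b * y k) → dot z w ≡ a * dot x w + b * dot y w
  dot-linˡ w a x b y {z} h = trans (dot-comm z w)
    (trans (dot-linʳ w a x b y h) (cong₂ _+_ (cong (a *_) (dot-comm w x)) (cong (b *_) (dot-comm w y))))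

  dot-scaleʳ : ∀ {N} (w : Fin N → ℚ) a x {z} → (∀ k → z k ≡ a * x k) → dot w z ≡ a * dot w x
  dot-scaleʳ w a x h = trans (dot-cong {x = w} (λ _ → refl) h) (dot-*ʳ a w x)

  dot-zeroʳ : ∀ {N} (w : Fin N → ℚ) {z} → (∀ k → z k ≡ 0ℚ) → dot w z ≡ 0ℚ
  dot-zeroʳ w h = sum-0 (λ k → trans (cong (w k *_) (h k)) (*-zeroʳ (w k)))

  dot-ext : ∀ {N} {u w : Fin N → ℚ} → (∀ y → dot y u ≡ dot y w) → ∀ j → u j ≡ w j
  dot-ext {u = u} {w} h j = trans (sym (matVec-identity u j)) (trans (h (identity j)) (matVec-identity w j))

  -- The transpose of A P = a P. The hypothesis only speaks of the action on vectors, so the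
  -- transposition tests both sides against every y.
  sym-absorb : ∀ {N} {A P : Mat N N} → Sym A → Sym P → ∀ a → (∀ x j → matVec A (matVec P x) j ≡ a * matVec P x j) →
    ∀ x j → matVec P (matVec A x) j ≡ a * matVec P x j
  sym-absorb {A = A} {P} symA symP a h x = dot-ext λ y → begin
    dot y (matVec P (matVec A x)) ≡⟨ sym (dot-sym symP y (matVec A x)) ⟩
    dot (matVec P y) (matVec A x) ≡⟨ sym (dot-sym symA (matVec P y) x) ⟩
    dot (matVec A (matVec P y)) x ≡⟨ dot-cong {y = x} (h y) (λ _ → refl) ⟩
    dot (λ k → a * matVec P y k) x ≡⟨ dot-*ˡ a (matVec P y) x ⟩
    a * dot (matVec P y) x ≡⟨ cong (a *_) (dot-sym symP y x) ⟩
    a * dot y (matVec P x) ≡⟨ sym (dot-*ʳ a y (matVec P x)) ⟩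
    dot y (λ k → a * matVec P x k) ∎
    where open ≡-Reasoning

  0≤-cancel : ∀ {c z} → 0ℚ ℚ.< c → 0ℚ ℚ.≤ c * z → 0ℚ ℚ.≤ z
  0≤-cancel {c} {z} 0<c h = ℚ.*-cancelˡ-≤-pos c {{ℚ.positive 0<c}} (subst (ℚ._≤ c * z) (sym (*-zeroʳ c)) h)

  0≤-* : ∀ {x y} → 0ℚ ℚ.≤ x → 0ℚ ℚ.≤ y → 0ℚ ℚ.≤ x * y
  0≤-* {x} {y} hx hy = subst (ℚ._≤ x * y) (*-zeroʳ x) (ℚ.*-monoˡ-≤-nonNeg x {{ℚ.nonNegative hx}} hy)

  0<-* : ∀ {x y} → 0ℚ ℚ.< x → 0ℚ ℚ.< y → 0ℚ ℚ.< x * y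
  0<-* {x} {y} hx hy = subst (ℚ._< x * y) (*-zeroʳ x) (ℚ.*-monoʳ-<-pos x {{ℚ.positive hx}} hy)

  *-monoʳ : ∀ {c x y} → 0ℚ ℚ.≤ c → x ℚ.≤ y → c * x ℚ.≤ c * y
  *-monoʳ {c} hc = ℚ.*-monoˡ-≤-nonNeg c {{ℚ.nonNegative hc}}

  private
    sub-cancel : ∀ (p q : ℚ) → (q - p) + p ≡ q
    sub-cancel = solve-∀ ℚ-ring

  p≤q⇒0≤q-p : ∀ {p q} → p ℚ.≤ q → 0ℚ ℚ.≤ q - p
  p≤q⇒0≤q-p {p} {q} h = subst (ℚ._≤ q - p) (ℚ.+-inverseʳ p) (ℚ.+-monoˡ-≤ (- p) h)

  0≤q-p⇒p≤q : ∀ {p q} → 0ℚ ℚ.≤ q - p → p ℚ.≤ q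
  0≤q-p⇒p≤q {p} {q} h = subst₂ ℚ._≤_ (+-identityˡ p) (sub-cancel p q) (ℚ.+-monoˡ-≤ p h)

  inverseOf : ∀ {c} → 0ℚ ℚ.< c → Σ ℚ λ r → r * c ≡ 1ℚ
  inverseOf {c} 0<c = ℚ.1/ c , ℚ.*-inverseˡ c
    where instance _ = ℚ.>-nonZero 0<c

  0<1 : 0ℚ ℚ.< 1ℚ
  0<1 = ℚ.*<* (ℤ.+<+ (ℕ.s≤s ℕ.z≤n))

  -- A x₀ is a multiple of x₀ and A is symmetric, so both cross terms of the quadratic form vanish.
  -- Repeated splittings of this kind take the place of a diagonalisation.
  module Split {N} {A : Mat N N} (symA : Sym A) (μ : ℚ) {x x₀ x₁ : Fin N → ℚ}
    (split : ∀ k → x k ≡ 1ℚ * x₀ k + 1ℚ * x₁ k) (eig : ∀ k → matVec A x₀ k ≡ μ * x₀ k) (orth : dot x₀ x₁ ≡ 0ℚ) where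

    private
      expand : ∀ (p c c′ r : ℚ) → 1ℚ * (1ℚ * p + 1ℚ * c) + 1ℚ * (1ℚ * c′ + 1ℚ * r) ≡ (p + r) + (c + c′)
      expand = solve-∀ ℚ-ring
      drop : ∀ {c c′ : ℚ} p r → c ≡ 0ℚ → c′ ≡ 0ℚ → (p + r) + (c + c′) ≡ p + r
      drop p r refl refl = +-identityʳ (p + r)

    split-norm : dot x x ≡ dot x₀ x₀ + dot x₁ x₁
    split-norm = trans (dot-linʳ x 1ℚ x₀ 1ℚ x₁ split) (trans (cong₂ (λ u v → 1ℚ * u + 1ℚ * v) (dot-linˡ x₀ 1ℚ x₀ 1ℚ x₁ split) (dot-linˡ x₁ 1ℚ x₀ 1ℚ x₁ split))
      (trans (expand (dot x₀ x₀) (dot x₁ x₀) (dot x₀ x₁) (dot x₁ x₁))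
             (drop (dot x₀ x₀) (dot x₁ x₁) (trans (dot-comm x₁ x₀) orth) orth)))

    split-form : dot x (matVec A x) ≡ μ * dot x₀ x₀ + dot x₁ (matVec A x₁)
    split-form = trans (dot-linʳ x 1ℚ (matVec A x₀) 1ℚ (matVec A x₁) (matVec-lin A 1ℚ x₀ 1ℚ x₁ split))
      (trans (cong₂ (λ u v → 1ℚ * u + 1ℚ * v) (dot-linˡ (matVec A x₀) 1ℚ x₀ 1ℚ x₁ split) (dot-linˡ (matVec A x₁) 1ℚ x₀ 1ℚ x₁ split))
      (trans (expand (dot x₀ (matVec A x₀)) (dot x₁ (matVec A x₀)) (dot x₀ (matVec A x₁)) (dot x₁ (matVec A x₁)))
      (trans (drop (dot x₀ (matVec A x₀)) (dot x₁ (matVec A x₁)) c₁ c₂)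
             (cong (_+ dot x₁ (matVec A x₁)) (dot-scaleʳ x₀ μ x₀ eig)))))
      where
      c₁ : dot x₁ (matVec A x₀) ≡ 0ℚ
      c₁ = trans (dot-scaleʳ x₁ μ x₀ eig) (trans (cong (μ *_) (trans (dot-comm x₁ x₀) orth)) (*-zeroʳ μ))
      c₂ : dot x₀ (matVec A x₁) ≡ 0ℚ
      c₂ = trans (sym (dot-sym symA x₀ x₁)) (trans (dot-comm (matVec A x₀) x₁) c₁)

    split-bound : ∀ {β} → μ ℚ.≤ β → dot x₁ (matVec A x₁) ℚ.≤ β * dot x₁ x₁ → dot x (matVec A x) ℚ.≤ β * dot x x
    split-bound {β} μ≤β h = begin
      dot x (matVec A x) ≡⟨ split-form ⟩
      μ * dot x₀ x₀ + dot x₁ (matVec A x₁) ≤⟨ ℚ.+-mono-≤ (ℚ.*-monoʳ-≤-nonNeg (dot x₀ x₀) {{ℚ.nonNegative (dot-nonneg x₀)}} μ≤β) h ⟩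
      β * dot x₀ x₀ + β * dot x₁ x₁ ≡⟨ sym (*-distribˡ-+ β (dot x₀ x₀) (dot x₁ x₁)) ⟩
      β * (dot x₀ x₀ + dot x₁ x₁) ≡⟨ cong (β *_) (sym split-norm) ⟩
      β * dot x x ∎
      where open ℚ.≤-Reasoning

  module Projection {N} {P : Mat N N} (symP : Sym P) (idem : ∀ x j → matVec P (matVec P x) j ≡ matVec P x j) (x : Fin N → ℚ) where

    remainder : Fin N → ℚ
    remainder k = 1ℚ * x k + - 1ℚ * matVec P x k

    private
      sub-add : ∀ (a b : ℚ) → a ≡ 1ℚ * b + 1ℚ * (1ℚ * a + - 1ℚ * b)
      sub-add = solve-∀ ℚ-ring
      sub-self : ∀ (a : ℚ) → 1ℚ * a + - 1ℚ * a ≡ 0ℚ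
      sub-self = solve-∀ ℚ-ring

    splitting : ∀ k → x k ≡ 1ℚ * matVec P x k + 1ℚ * remainder k
    splitting k = sub-add (x k) (matVec P x k)

    remainder-0 : ∀ k → matVec P remainder k ≡ 0ℚ
    remainder-0 k = trans (matVec-lin P 1ℚ x (- 1ℚ) (matVec P x) (λ _ → refl) k)
      (trans (cong (λ u → 1ℚ * matVec P x k + - 1ℚ * u) (idem x k)) (sub-self (matVec P x k)))

    orthogonal : dot (matVec P x) remainder ≡ 0ℚ
    orthogonal = trans (dot-sym symP x remainder) (dot-zeroʳ x remainder-0)

  -- T l is adjacency in position l + 1, P l the average over all choices of the positions 1, …, l, A l
  -- opposition in those positions, c l = T 0 ⋯ T (l-1), and br l stands for the q-integer [l + 1].

  *-cancelˡ : ∀ {c x y} → 0ℚ ℚ.< c → c * x ≡ c * y → x ≡ y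
  *-cancelˡ {c} {x} {y} 0<c e with r , rc ← inverseOf 0<c = begin
    x ≡⟨ sym (*-identityˡ x) ⟩
    1ℚ * x ≡⟨ cong (_* x) (sym rc) ⟩
    r * c * x ≡⟨ *-assoc r c x ⟩
    r * (c * x) ≡⟨ cong (r *_) e ⟩
    r * (c * y) ≡⟨ sym (*-assoc r c y) ⟩
    r * c * y ≡⟨ cong (_* y) rc ⟩
    1ℚ * y ≡⟨ *-identityˡ y ⟩
    y ∎
    where open ≡-Reasoning

  -- In exponents this is C(s+d+2, 2) = C(s+1, 2) + C(d+1, 2) + (s+1)(d+1): pairs of indices, sorted
  -- by whether they lie on the same side of a cut into s + 1 and d + 1 of them.
  oppCount-split : ∀ q s d → oppCount q (suc s ℕ.+ d) ≡ oppCount q s * oppCount q d * q ^ℚ (suc s ℕ.* suc d)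
  oppCount-split q zero d = trans (*-comm (q ^ℚ suc d) (oppCount q d)) (cong₂ _*_ (sym (*-identityˡ (oppCount q d)))
    (cong (q ^ℚ_) (sym (ℕ.+-identityʳ (suc d)))))
  oppCount-split q (suc s) d = begin
    q ^ℚ suc (suc s ℕ.+ d) * oppCount q (suc s ℕ.+ d) ≡⟨ cong (q ^ℚ suc (suc s ℕ.+ d) *_) (oppCount-split q s d) ⟩
    q ^ℚ suc (suc s ℕ.+ d) * (oppCount q s * oppCount q d * q ^ℚ (suc s ℕ.* suc d)) ≡⟨ cong (_* (oppCount q s * oppCount q d * q ^ℚ (suc s ℕ.* suc d)))
        (trans (cong (q ^ℚ_) (sym (ℕ.+-suc (suc s) d))) (^-+ q (suc s) (suc d))) ⟩
    q ^ℚ suc s * q ^ℚ suc d * (oppCount q s * oppCount q d * q ^ℚ (suc s ℕ.* suc d)) ≡⟨ eq (q ^ℚ suc s) (q ^ℚ suc d) (oppCount q s) (oppCount q d) (q ^ℚ (suc s ℕ.* suc d)) ⟩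
    q ^ℚ suc s * oppCount q s * oppCount q d * (q ^ℚ suc d * q ^ℚ (suc s ℕ.* suc d)) ≡⟨ cong (q ^ℚ suc s * oppCount q s * oppCount q d *_) (sym (^-+ q (suc d) (suc s ℕ.* suc d))) ⟩
    q ^ℚ suc s * oppCount q s * oppCount q d * q ^ℚ (suc (suc s) ℕ.* suc d) ∎
    where
    open ≡-Reasoning
    eq : ∀ (x y a b z : ℚ) → x * y * (a * b * z) ≡ x * a * b * (y * z)
    eq = solve-∀ ℚ-ring

open Matrices

-- Spectral bounds from Hecke algebra relations.

module Spectra where
  open import Data.Rational using (_+_; _*_; _-_; -_)

  -- The relations that the geometry has to supply, stated for operators on functions on any finite
  -- set. The index k of the overview is l + 1 here: `P l`, `A l` and `c l` involve positions 1,
  -- ..., l, that is, T 0, ..., T (l-1).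
  module Spectral {N} (q : ℚ) (1≤q : 1ℚ ℚ.≤ q) (M : ℕ) (T P A : ℕ → Mat N N) (c : ℕ → Mat N N) (br : ℕ → ℚ)
    (br-0 : br 0 ≡ 1ℚ) (br-suc : ∀ l → br (suc l) ≡ q * br l + 1ℚ)
    (T-sym : ∀ {l} → l ℕ.< M → Sym (T l))
    (T-quad : ∀ {l} → l ℕ.< M → ∀ x j → matVec (T l) (matVec (T l) x) j ≡ (q - 1ℚ) * matVec (T l) x j + q * x j)
    (P-sym : ∀ {l} → l ℕ.≤ M → Sym (P l))
    (P-0 : ∀ x j → matVec (P 0) x j ≡ x j)
    (P-idem : ∀ {l} → l ℕ.≤ M → ∀ x j → matVec (P l) (matVec (P l) x) j ≡ matVec (P l) x j)
    (T-P : ∀ {i l} → i ℕ.< l → l ℕ.≤ M → ∀ x j → matVec (T i) (matVec (P l) x) j ≡ q * matVec (P l) x j)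
    (P-P : ∀ {l} → l ℕ.< M → ∀ x j → matVec (P l) (matVec (P (suc l)) x) j ≡ matVec (P (suc l)) x j)
    (P-T-P : ∀ {l} → l ℕ.< M → ∀ x j →
      br l * matVec (P l) (matVec (T l) (matVec (P l) x)) j ≡ br (suc l) * matVec (P (suc l)) x j - matVec (P l) x j)
    (P-T-P-suc : ∀ {l} → suc l ℕ.< M → ∀ x j →
      matVec (P l) (matVec (T (suc l)) (matVec (P (suc l)) x)) j ≡ matVec (T (suc l)) (matVec (P (suc l)) x) j)
    (c-0 : ∀ j k → c 0 j k ≡ identity j k)
    (c-suc : ∀ {l} → l ℕ.< M → ∀ j k → c (suc l) j k ≡ (c l ⊡ T l) j k)
    (A-0 : ∀ j k → A 0 j k ≡ identity j k)
    (A-suc : ∀ {l} → l ℕ.< M → ∀ j k → A (suc l) j k ≡ (c (suc l) ⊡ A l) j k)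
    (A-sym : ∀ {l} → l ℕ.≤ M → Sym (A l))
    where

    0<q : 0ℚ ℚ.< q
    0<q = ℚ.<-≤-trans 0<1 1≤q

    0<q^ : ∀ l → 0ℚ ℚ.< q ^ℚ l
    0<q^ zero    = 0<1
    0<q^ (suc l) = 0<-* 0<q (0<q^ l)

    0<br : ∀ l → 0ℚ ℚ.< br l
    0<br zero    = subst (0ℚ ℚ.<_) (sym br-0) 0<1
    0<br (suc l) = subst (0ℚ ℚ.<_) (sym (br-suc l)) (ℚ.+-mono-< (0<-* 0<q (0<br l)) 0<1)

    br-pow : ∀ l → q * q ^ℚ l ≡ (q - 1ℚ) * br l + 1ℚ
    br-pow zero    = trans (eq q) (cong (λ b → (q - 1ℚ) * b + 1ℚ) (sym br-0))
      where
      eq : ∀ (q : ℚ) → q * 1ℚ ≡ (q - 1ℚ) * 1ℚ + 1ℚ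
      eq = solve-∀ ℚ-ring
    br-pow (suc l) = trans (cong (q *_) (br-pow l)) (trans (eq q (br l)) (cong (λ b → (q - 1ℚ) * b + 1ℚ) (sym (br-suc l))))
      where
      eq : ∀ (q b : ℚ) → q * ((q - 1ℚ) * b + 1ℚ) ≡ (q - 1ℚ) * (q * b + 1ℚ) + 1ℚ
      eq = solve-∀ ℚ-ring

    -- By the quadratic relation T has only the eigenvalues q and -1, so q² - T² is a multiple of (q
    -- - T)², namely (q + 1)(q² - T²) = (q - 1)(q - T)². The vector `w` is (q - T) x.
    T-norm : ∀ {l} → l ℕ.< M → ∀ x → dot (matVec (T l) x) (matVec (T l) x) ℚ.≤ q * q * dot x x
    T-norm {l} l<M x = 0≤q-p⇒p≤q (0≤-cancel (ℚ.+-mono-< 0<q 0<1) (subst (0ℚ ℚ.≤_) (sym identity-q)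
        (0≤-* (p≤q⇒0≤q-p 1≤q) (dot-nonneg w))))
      where
      Tx w : Fin N → ℚ
      Tx = matVec (T l) x
      w k = q * x k + - 1ℚ * Tx k
      d t : ℚ
      d = dot x x
      t = dot x Tx
      TxTx : dot Tx Tx ≡ (q - 1ℚ) * t + q * d
      TxTx = trans (dot-sym (T-sym l<M) x Tx) (dot-linʳ x (q - 1ℚ) Tx q x (T-quad l<M x))
      ww : dot w w ≡ q * (q * d + - 1ℚ * t) + - 1ℚ * (q * t + - 1ℚ * dot Tx Tx)
      ww = trans (dot-linʳ w q x (- 1ℚ) Tx (λ _ → refl)) (cong₂ (λ u v → q * u + - 1ℚ * v)
             (trans (dot-linˡ x q x (- 1ℚ) Tx (λ _ → refl)) (cong (λ u → q * d + - 1ℚ * u) (dot-comm Tx x)))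
             (dot-linˡ Tx q x (- 1ℚ) Tx (λ _ → refl)))
      eq : ∀ (q d t : ℚ) → (q + 1ℚ) * (q * q * d - ((q - 1ℚ) * t + q * d)) ≡
             (q - 1ℚ) * (q * (q * d + - 1ℚ * t) + - 1ℚ * (q * t + - 1ℚ * ((q - 1ℚ) * t + q * d)))
      eq = solve-∀ ℚ-ring
      identity-q : (q + 1ℚ) * (q * q * d - dot Tx Tx) ≡ (q - 1ℚ) * dot w w
      identity-q = trans (cong (λ u → (q + 1ℚ) * (q * q * d - u)) TxTx) (trans (eq q d t) (cong ((q - 1ℚ) *_)
        (sym (trans ww (cong (λ u → q * (q * d + - 1ℚ * t) + - 1ℚ * (q * t + - 1ℚ * u)) TxTx)))))

    L : ℕ → Mat N N
    L l = c l ᵀ ⊡ c l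

    L-sym : ∀ l → Sym (L l)
    L-sym l j k = ⊡-ᵀ (c l ᵀ) (c l) k j

    L-form : ∀ l x → dot x (matVec (L l) x) ≡ dot (matVec (c l) x) (matVec (c l) x)
    L-form l x = trans (dot-cong {x = x} (λ _ → refl) (matVec-⊡ (c l ᵀ) (c l) x)) (sym (dot-ᵀ (c l) x (matVec (c l) x)))

    L-0 : ∀ x j → matVec (L 0) x j ≡ x j
    L-0 x j = trans (matVec-⊡ (c 0 ᵀ) (c 0) x j) (trans (matVec-congˡ c0ᵀ (matVec (c 0) x) j)
                (trans (matVec-identity (matVec (c 0) x) j) (trans (matVec-congˡ c-0 x j) (matVec-identity x j))))
      where
      c0ᵀ : ∀ j k → (c 0 ᵀ) j k ≡ identity j k
      c0ᵀ j k = trans (c-0 k j) (ind-sym (ind-identity {N}) sym k j)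

    c-suc′ : ∀ {l} → l ℕ.< M → ∀ x j → matVec (c (suc l)) x j ≡ matVec (c l) (matVec (T l) x) j
    c-suc′ {l} l<M x j = trans (matVec-congˡ (c-suc l<M) x j) (matVec-⊡ (c l) (T l) x j)

    cᵀ-suc : ∀ {l} → l ℕ.< M → ∀ x j → matVec (c (suc l) ᵀ) x j ≡ matVec (T l) (matVec (c l ᵀ) x) j
    cᵀ-suc {l} l<M x j = trans (matVec-congˡ entry x j) (matVec-⊡ (T l) (c l ᵀ) x j)
      where
      entry : ∀ j k → (c (suc l) ᵀ) j k ≡ (T l ⊡ c l ᵀ) j k
      entry j k = trans (c-suc l<M k j) (trans (⊡-ᵀ (c l) (T l) j k)
                    (sum-cong (λ i → cong (_* c l k i) (T-sym l<M i j))))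

    L-suc : ∀ {l} → l ℕ.< M → ∀ x j → matVec (L (suc l)) x j ≡ matVec (T l) (matVec (L l) (matVec (T l) x)) j
    L-suc {l} l<M x j = begin
      matVec (L (suc l)) x j ≡⟨ matVec-⊡ (c (suc l) ᵀ) (c (suc l)) x j ⟩
      matVec (c (suc l) ᵀ) (matVec (c (suc l)) x) j ≡⟨ matVec-cong (c (suc l) ᵀ) (c-suc′ l<M x) j ⟩
      matVec (c (suc l) ᵀ) (matVec (c l) (matVec (T l) x)) j ≡⟨ cᵀ-suc l<M _ j ⟩
      matVec (T l) (matVec (c l ᵀ) (matVec (c l) (matVec (T l) x))) j ≡⟨ matVec-cong (T l) (λ k → sym (matVec-⊡ (c l ᵀ) (c l) (matVec (T l) x) k)) j ⟩
      matVec (T l) (matVec (L l) (matVec (T l) x)) j ∎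
      where open ≡-Reasoning

    -- Such a y spans a copy of the index representation of the subalgebra generated by T 0, ..., T
    -- (l-1). Every product of these operators acts on it by a power of q.
    Invariant : ℕ → (Fin N → ℚ) → Set
    Invariant l y = ∀ {i} → i ℕ.< l → ∀ j → matVec (T i) y j ≡ q * y j

    P-fixed-invariant : ∀ {l y} → l ℕ.≤ M → (∀ k → matVec (P l) y k ≡ y k) → Invariant l y
    P-fixed-invariant {l} {y} l≤M fix {i} i<l j =
      trans (matVec-cong (T i) (λ k → sym (fix k)) j) (trans (T-P i<l l≤M y j) (cong (q *_) (fix j)))

    L-invariant : ∀ l {y} → l ℕ.≤ M → Invariant l y → ∀ j → matVec (L l) y j ≡ q ^ℚ l * q ^ℚ l * y j
    L-invariant zero    {y} _   inv j = trans (L-0 y j) (sym (trans (cong (_* y j) (*-identityˡ 1ℚ)) (*-identityˡ (y j))))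
    L-invariant (suc l) {y} l<M inv j = begin
      matVec (L (suc l)) y j ≡⟨ L-suc l<M y j ⟩
      matVec (T l) (matVec (L l) (matVec (T l) y)) j ≡⟨ matVec-scale (T l) (q * (q ^ℚ l * q ^ℚ l)) y (λ k → trans (matVec-scale (L l) q y (inv (ℕ.n<1+n l)) k)
          (trans (cong (q *_) (L-invariant l (ℕ.<⇒≤ l<M) (inv ∘ ℕ.m<n⇒m<1+n) k)) (sym (*-assoc q (q ^ℚ l * q ^ℚ l) (y k))))) j ⟩
      q * (q ^ℚ l * q ^ℚ l) * matVec (T l) y j ≡⟨ cong (q * (q ^ℚ l * q ^ℚ l) *_) (inv (ℕ.n<1+n l) j) ⟩
      q * (q ^ℚ l * q ^ℚ l) * (q * y j) ≡⟨ eq q (q ^ℚ l) (y j) ⟩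
      q ^ℚ suc l * q ^ℚ suc l * y j ∎
      where
      open ≡-Reasoning
      eq : ∀ (q p y : ℚ) → q * (p * p) * (q * y) ≡ q * p * (q * p) * y
      eq = solve-∀ ℚ-ring

    c-invariant : ∀ l {y} → l ℕ.≤ M → Invariant l y → ∀ j → matVec (c l) y j ≡ q ^ℚ l * y j
    c-invariant zero    {y} _   inv j = trans (trans (matVec-congˡ c-0 y j) (matVec-identity y j)) (sym (*-identityˡ (y j)))
    c-invariant (suc l) {y} l<M inv j = trans (c-suc′ l<M y j) (trans (matVec-scale (c l) q y (inv (ℕ.n<1+n l)) j)
      (trans (cong (q *_) (c-invariant l (ℕ.<⇒≤ l<M) (inv ∘ ℕ.m<n⇒m<1+n) j)) (sym (*-assoc q (q ^ℚ l) (y j)))))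

    a : ℕ → ℚ
    a = oppCount q

    0<a : ∀ l → 0ℚ ℚ.< a l
    0<a zero    = 0<1
    0<a (suc l) = 0<-* (0<q^ (suc l)) (0<a l)

    A-suc′ : ∀ {l} → l ℕ.< M → ∀ x j → matVec (A (suc l)) x j ≡ matVec (c (suc l)) (matVec (A l) x) j
    A-suc′ {l} l<M x j = trans (matVec-congˡ (A-suc l<M) x j) (matVec-⊡ (c (suc l)) (A l) x j)

    -- The transpose of `A-suc`, as A is symmetric. With one factorisation on each side, the square
    -- of A (l+1) becomes A l · L (l+1) · A l.
    A-sucᵀ : ∀ {l} → l ℕ.< M → ∀ x j → matVec (A (suc l)) x j ≡ matVec (A l) (matVec (c (suc l) ᵀ) x) j
    A-sucᵀ {l} l<M x j = trans (matVec-congˡ entry x j) (matVec-⊡ (A l) (c (suc l) ᵀ) x j)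
      where
      entry : ∀ j k → A (suc l) j k ≡ (A l ⊡ c (suc l) ᵀ) j k
      entry j k = trans (A-sym l<M j k) (trans (A-suc l<M k j) (trans (⊡-ᵀ (c (suc l)) (A l) j k)
                    (sum-cong (λ i → cong (_* c (suc l) k i) (A-sym (ℕ.<⇒≤ l<M) i j)))))

    A-invariant : ∀ l {y} → l ℕ.≤ M → Invariant l y → ∀ j → matVec (A l) y j ≡ a l * y j
    A-invariant zero    {y} _   inv j = trans (trans (matVec-congˡ A-0 y j) (matVec-identity y j)) (sym (*-identityˡ (y j)))
    A-invariant (suc l) {y} l<M inv j = trans (A-suc′ l<M y j)
      (trans (matVec-scale (c (suc l)) (a l) y (A-invariant l (ℕ.<⇒≤ l<M) (inv ∘ ℕ.m<n⇒m<1+n)) j)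
      (trans (cong (a l *_) (c-invariant (suc l) l<M inv j)) (eq (a l) (q ^ℚ suc l) (y j))))
      where
      eq : ∀ (a p y : ℚ) → a * (p * y) ≡ p * a * y
      eq = solve-∀ ℚ-ring

    module _ {l} (l<M : l ℕ.< M) where
      private
        l≤M = ℕ.<⇒≤ l<M

      P-suc-P : ∀ x j → matVec (P (suc l)) (matVec (P l) x) j ≡ matVec (P (suc l)) x j
      P-suc-P x j = trans (sym-absorb (P-sym l≤M) (P-sym l<M) 1ℚ
        (λ y k → trans (P-P l<M y k) (sym (*-identityˡ _))) x j) (*-identityˡ _)

      P-suc-T : ∀ x j → matVec (P (suc l)) (matVec (T l) x) j ≡ q * matVec (P (suc l)) x j
      P-suc-T = sym-absorb (T-sym l<M) (P-sym l<M) q (T-P (ℕ.n<1+n l) l<M)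

      -- On the image of P l the relation `P-T-P` reads [l+1] P T = [l+2] P (l+1) - 1, and its first
      -- term kills y. Hence T y + r y lies in the kernel of P l.
      P-T-0 : ∀ {y r} → r * br l ≡ 1ℚ → (∀ k → matVec (P l) y k ≡ y k) → (∀ k → matVec (P (suc l)) y k ≡ 0ℚ) →
        ∀ j → matVec (P l) (matVec (T l) y) j ≡ - r * y j
      P-T-0 {y} {r} rb fix null j = begin
        u ≡⟨ sym (*-identityˡ u) ⟩
        1ℚ * u ≡⟨ cong (_* u) (sym rb) ⟩
        r * br l * u ≡⟨ *-assoc r (br l) u ⟩
        r * (br l * u) ≡⟨ cong (r *_) (trans (cong (br l *_) (matVec-cong (P l) (matVec-cong (T l) (λ k → sym (fix k))) j)) (P-T-P l<M y j)) ⟩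
        r * (br (suc l) * matVec (P (suc l)) y j - matVec (P l) y j) ≡⟨ cong₂ (λ p p′ → r * (br (suc l) * p - p′)) (null j) (fix j) ⟩
        r * (br (suc l) * 0ℚ - y j) ≡⟨ eq r (br (suc l)) (y j) ⟩
        - r * y j ∎
        where
        open ≡-Reasoning
        u = matVec (P l) (matVec (T l) y) j
        eq : ∀ (r b y : ℚ) → r * (b * 0ℚ - y) ≡ - r * y
        eq = solve-∀ ℚ-ring

    -- T y + y / [l+1] is killed by P l and fixed by P (l-1), so the previous case applies to it.
    L-eig : ∀ l → l ℕ.< M → ∀ {y} → (∀ k → matVec (P l) y k ≡ y k) → (∀ k → matVec (P (suc l)) y k ≡ 0ℚ) →
      ∀ j → matVec (L (suc l)) y j ≡ q ^ℚ l * y j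
    L-eig zero l<M {y} fix null j = begin
      matVec (L 1) y j ≡⟨ L-suc l<M y j ⟩
      matVec (T 0) (matVec (L 0) (matVec (T 0) y)) j ≡⟨ matVec-cong (T 0) (L-0 (matVec (T 0) y)) j ⟩
      matVec (T 0) (matVec (T 0) y) j ≡⟨ matVec-scale (T 0) (- 1ℚ) y Ty j ⟩
      - 1ℚ * matVec (T 0) y j ≡⟨ cong (- 1ℚ *_) (Ty j) ⟩
      - 1ℚ * (- 1ℚ * y j) ≡⟨ eq (y j) ⟩
      1ℚ * y j ∎
      where
      open ≡-Reasoning
      Ty : ∀ k → matVec (T 0) y k ≡ - 1ℚ * y k
      Ty k = trans (sym (P-0 (matVec (T 0) y) k)) (P-T-0 l<M {r = 1ℚ} (cong (1ℚ *_) br-0) fix null k)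
      eq : ∀ (y : ℚ) → - 1ℚ * (- 1ℚ * y) ≡ 1ℚ * y
      eq = solve-∀ ℚ-ring
    L-eig (suc l) l<M {y} fix null j with r , rb ← inverseOf (0<br (suc l)) = begin
      matVec (L (suc (suc l))) y j ≡⟨ L-suc l<M y j ⟩
      matVec T′ (matVec (L (suc l)) Ty) j ≡⟨ matVec-lin T′ p u (- (r * (q * p * (q * p)))) y LTy j ⟩
      p * matVec T′ u j + - (r * (q * p * (q * p))) * Ty j ≡⟨ cong (λ z → p * z + - (r * (q * p * (q * p))) * Ty j) Tu ⟩
      p * ((q - 1ℚ) * Ty j + q * y j + r * Ty j) + - (r * (q * p * (q * p))) * Ty j
          ≡⟨ eq₁ p q r (Ty j) (y j) ⟩
      p * ((q - 1ℚ) * Ty j + q * y j + r * Ty j) - r * p * (q * (q * p)) * Ty j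
          -- Now the coefficient of `Ty` vanishes: as q^(l+2) = (q - 1)[l+2] + 1 and r = 1/[l+2],
          -- the product r q^(l+2) is (q - 1) + r.
          ≡⟨ cong (λ z → p * ((q - 1ℚ) * Ty j + q * y j + r * Ty j) - r * p * z * Ty j) (br-pow (suc l)) ⟩
      p * ((q - 1ℚ) * Ty j + q * y j + r * Ty j) - r * p * ((q - 1ℚ) * br (suc l) + 1ℚ) * Ty j
          ≡⟨ eq₂ p q r (br (suc l)) (Ty j) (y j) ⟩
      q * p * y j + p * (q - 1ℚ) * Ty j * (1ℚ - r * br (suc l))
          ≡⟨ cong (λ z → q * p * y j + p * (q - 1ℚ) * Ty j * (1ℚ - z)) rb ⟩
      q * p * y j + p * (q - 1ℚ) * Ty j * (1ℚ - 1ℚ) ≡⟨ eq₃ (q * p * y j) (p * (q - 1ℚ) * Ty j) ⟩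
      q * p * y j ∎
      where
      open ≡-Reasoning
      T′ = T (suc l)
      p = q ^ℚ l
      Ty u : Fin N → ℚ
      Ty = matVec T′ y
      u k = 1ℚ * Ty k + r * y k
      l′<M = ℕ.<⇒≤ l<M
      zero-sum : ∀ (r y : ℚ) → 1ℚ * (- r * y) + r * y ≡ 0ℚ
      zero-sum = solve-∀ ℚ-ring
      -- `T′` changes position l + 2 and P l averages over positions up to l. These do not touch, so
      -- `T′` keeps y in the image of P l; this is `P-T-P-suc`.
      P-u : ∀ k → matVec (P l) u k ≡ u k
      P-u k = trans (matVec-lin (P l) 1ℚ Ty r y (λ _ → refl) k) (cong₂ (λ s t → 1ℚ * s + r * t)
        (trans (matVec-cong (P l) (matVec-cong T′ (λ i → sym (fix i))) k) (trans (P-T-P-suc l<M y k) (matVec-cong T′ fix k)))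
        (trans (matVec-cong (P l) (λ i → sym (fix i)) k) (trans (P-P l′<M y k) (fix k))))
      P-u′ : ∀ k → matVec (P (suc l)) u k ≡ 0ℚ
      P-u′ k = trans (matVec-lin (P (suc l)) 1ℚ Ty r y (λ _ → refl) k)
        (trans (cong₂ (λ s t → 1ℚ * s + r * t) (P-T-0 l<M {r = r} rb fix null k) (fix k)) (zero-sum r (y k)))
      Ty-u : ∀ (t r y : ℚ) → t ≡ 1ℚ * (1ℚ * t + r * y) + - r * y
      Ty-u = solve-∀ ℚ-ring
      arrange : ∀ (p u r q y : ℚ) → 1ℚ * (p * u) + - r * (q * p * (q * p) * y) ≡ p * u + - (r * (q * p * (q * p))) * y
      arrange = solve-∀ ℚ-ring
      -- Write T y = u - r y. The induction hypothesis gives the scalar q^l on u, and invariance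
      -- under T 0, ..., T l gives q^(2(l+1)) on y.
      LTy : ∀ k → matVec (L (suc l)) Ty k ≡ p * u k + - (r * (q * p * (q * p))) * y k
      LTy k = trans (matVec-lin (L (suc l)) 1ℚ u (- r) y (λ i → Ty-u (Ty i) r (y i)) k)
        (trans (cong₂ (λ s t → 1ℚ * s + - r * t) (L-eig l l′<M P-u P-u′ k)
                  (L-invariant (suc l) l′<M (P-fixed-invariant l′<M fix) k))
               (arrange p (u k) r q (y k)))
      drop-1 : ∀ (x : ℚ) y → 1ℚ * x + y ≡ x + y
      drop-1 = solve-∀ ℚ-ring
      Tu : matVec T′ u j ≡ (q - 1ℚ) * Ty j + q * y j + r * Ty j
      Tu = trans (matVec-lin T′ 1ℚ Ty r y (λ _ → refl) j)
        (trans (cong (λ s → 1ℚ * s + r * Ty j) (T-quad l<M y j)) (drop-1 ((q - 1ℚ) * Ty j + q * y j) (r * Ty j)))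
      eq₁ : ∀ (p q r t y : ℚ) → p * ((q - 1ℚ) * t + q * y + r * t) + - (r * (q * p * (q * p))) * t ≡
                                p * ((q - 1ℚ) * t + q * y + r * t) - r * p * (q * (q * p)) * t
      eq₁ = solve-∀ ℚ-ring
      eq₂ : ∀ (p q r b t y : ℚ) → p * ((q - 1ℚ) * t + q * y + r * t) - r * p * ((q - 1ℚ) * b + 1ℚ) * t ≡
                                  q * p * y + p * (q - 1ℚ) * t * (1ℚ - r * b)
      eq₂ = solve-∀ ℚ-ring
      eq₃ : ∀ (x y : ℚ) → x + y * (1ℚ - 1ℚ) ≡ x
      eq₃ = solve-∀ ℚ-ring

    L-form-suc : ∀ {l} → l ℕ.< M → ∀ x → dot x (matVec (L (suc l)) x) ≡ dot (matVec (T l) x) (matVec (L l) (matVec (T l) x))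
    L-form-suc {l} l<M x = trans (dot-cong {x = x} (λ _ → refl) (L-suc l<M x)) (sym (dot-sym (T-sym l<M) x (matVec (L l) (matVec (T l) x))))

    -- Split off x₀ = P x, then the component x′ of x₁ in the image of (1 - P) T P: L acts on both by scalars.
    -- What remains satisfies P T x″ = 0, so the bound for T x″ and ‖T‖ ≤ q suffice.
    L-bound : ∀ l → l ℕ.< M → ∀ {x} → (∀ k → matVec (P (suc l)) x k ≡ 0ℚ) →
      dot x (matVec (L (suc l)) x) ℚ.≤ q * (q ^ℚ l * q ^ℚ l) * dot x x
    L-bound zero l<M {x} null = begin
      dot x (matVec (L 1) x) ≡⟨ dot-scaleʳ x 1ℚ x (L-eig 0 l<M (P-0 x) null) ⟩
      1ℚ * dot x x ≤⟨ ℚ.*-monoʳ-≤-nonNeg (dot x x) {{ℚ.nonNegative (dot-nonneg x)}} 1≤q ⟩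
      q * dot x x ≡⟨ cong (_* dot x x) (sym (*-identityʳ q)) ⟩
      q * (1ℚ * 1ℚ) * dot x x ∎
      where open ℚ.≤-Reasoning
    L-bound (suc l) l<M {x} null with r , rb ← inverseOf (0<br (suc l))
                                 with g , gb ← inverseOf (0<-* (ℚ.+-mono-< (0<-* 0<q (0<br (suc l))) 0<1) (0<-* 0<q (0<br l))) =
        Split.split-bound (L-sym (suc (suc l))) p splitting (L-eig (suc l) l<M P-x₀ P⁺-x₀) orthogonal μ≤β
      (Split.split-bound (L-sym (suc (suc l))) β split′ L-x′ orth′ ℚ.≤-refl bound″)
      where
      l′<M = ℕ.<⇒≤ l<M
      open Projection (P-sym l′<M) (P-idem l′<M) x renaming (remainder to x₁)
      T′ P′ P⁺ L⁺ : Mat N N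
      T′ = T (suc l)
      P′ = P (suc l)
      P⁺ = P (suc (suc l))
      L⁺ = L (suc (suc l))
      p b β κ : ℚ
      p = q ^ℚ suc l
      b = br (suc l)
      β = q * (p * p)
      -- Chosen so that P T x″ = 0. P T h is w times q - (q-1) r - r² with r = 1/b, that is, (q b +
      -- 1)(b - 1) / b², and b - 1 = q [l+1]; `g` inverts (q b + 1)(q [l+1]).
      κ = b * b * g
      P-x₀ : ∀ k → matVec P′ (matVec P′ x) k ≡ matVec P′ x k
      P-x₀ = P-idem l′<M x
      P⁺-x₀ : ∀ k → matVec P⁺ (matVec P′ x) k ≡ 0ℚ
      P⁺-x₀ k = trans (P-suc-P l<M x k) (null k)
      P⁺-x₁ : ∀ k → matVec P⁺ x₁ k ≡ 0ℚ
      P⁺-x₁ k = trans (matVec-lin P⁺ 1ℚ x (- 1ℚ) (matVec P′ x) (λ _ → refl) k)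
        (cong₂ (λ s t → 1ℚ * s + - 1ℚ * t) (null k) (P⁺-x₀ k))
      1≤q^ : ∀ l → 1ℚ ℚ.≤ q ^ℚ l
      1≤q^ zero = ℚ.≤-refl
      1≤q^ (suc l) = begin
        1ℚ ≤⟨ 1≤q ⟩
        q ≡⟨ sym (*-identityʳ q) ⟩
        q * 1ℚ ≤⟨ *-monoʳ (ℚ.<⇒≤ 0<q) (1≤q^ l) ⟩
        q * q ^ℚ l ∎
        where open ℚ.≤-Reasoning
      μ≤β : p ℚ.≤ β
      μ≤β = begin
        p ≡⟨ sym (*-identityʳ p) ⟩
        p * 1ℚ ≤⟨ *-monoʳ (ℚ.<⇒≤ (0<q^ (suc l))) (1≤q^ (suc (suc l))) ⟩
        p * (q * p) ≡⟨ eq p q ⟩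
        β ∎
        where
        open ℚ.≤-Reasoning
        eq : ∀ (p q : ℚ) → p * (q * p) ≡ q * (p * p)
        eq = solve-∀ ℚ-ring
      w Tw h x′ x″ : Fin N → ℚ
      -- w is the part of T x₁ in the image of P. As P T w = -r w, the vector h = T w + r w is (1 -
      -- P) T w.
      w = matVec P′ (matVec T′ x₁)
      Tw = matVec T′ w
      h k = 1ℚ * Tw k + r * w k
      x′ k = κ * h k
      x″ k = 1ℚ * x₁ k + - κ * h k
      split′ : ∀ k → x₁ k ≡ 1ℚ * x′ k + 1ℚ * x″ k
      split′ k = eq (x₁ k) κ (h k)
        where
        eq : ∀ (x κ h : ℚ) → x ≡ 1ℚ * (κ * h) + 1ℚ * (1ℚ * x + - κ * h)
        eq = solve-∀ ℚ-ring
      P-w : ∀ k → matVec P′ w k ≡ w k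
      P-w = P-idem l′<M (matVec T′ x₁)
      P⁺-w : ∀ k → matVec P⁺ w k ≡ 0ℚ
      P⁺-w k = trans (P-suc-P l<M (matVec T′ x₁) k) (trans (P-suc-T l<M x₁ k) (trans (cong (q *_) (P⁺-x₁ k)) (*-zeroʳ q)))
      P-Tw : ∀ k → matVec P′ Tw k ≡ - r * w k
      P-Tw = P-T-0 l<M {r = r} rb P-w P⁺-w
      P-h : ∀ k → matVec P′ h k ≡ 0ℚ
      P-h k = trans (matVec-lin P′ 1ℚ Tw r w (λ _ → refl) k) (trans (cong₂ (λ s t → 1ℚ * s + r * t) (P-Tw k) (P-w k)) (eq r (w k)))
        where
        eq : ∀ (r y : ℚ) → 1ℚ * (- r * y) + r * y ≡ 0ℚ
        eq = solve-∀ ℚ-ring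
      P-x″ : ∀ k → matVec P′ x″ k ≡ 0ℚ
      P-x″ k = trans (matVec-lin P′ 1ℚ x₁ (- κ) h (λ _ → refl) k) (trans (cong₂ (λ s t → 1ℚ * s + - κ * t) (remainder-0 k) (P-h k)) (eq κ))
        where
        eq : ∀ (κ : ℚ) → 1ℚ * 0ℚ + - κ * 0ℚ ≡ 0ℚ
        eq = solve-∀ ℚ-ring
      T-h : ∀ k → matVec T′ h k ≡ ((q - 1ℚ) + r) * Tw k + q * w k
      T-h k = trans (matVec-lin T′ 1ℚ Tw r w (λ _ → refl) k) (trans (cong (λ s → 1ℚ * s + r * Tw k) (T-quad l<M w k)) (eq q r (Tw k) (w k)))
        where
        eq : ∀ (q r t w : ℚ) → 1ℚ * ((q - 1ℚ) * t + q * w) + r * t ≡ ((q - 1ℚ) + r) * t + q * w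
        eq = solve-∀ ℚ-ring
      P-T-h : ∀ k → matVec P′ (matVec T′ h) k ≡ (q - (q - 1ℚ) * r - r * r) * w k
      P-T-h k = trans (matVec-lin P′ ((q - 1ℚ) + r) Tw q w T-h k)
        (trans (cong₂ (λ s t → ((q - 1ℚ) + r) * s + q * t) (P-Tw k) (P-w k)) (eq q r (w k)))
        where
        eq : ∀ (q r w : ℚ) → ((q - 1ℚ) + r) * (- r * w) + q * w ≡ (q - (q - 1ℚ) * r - r * r) * w
        eq = solve-∀ ℚ-ring
      κ-eq : κ * (q - (q - 1ℚ) * r - r * r) ≡ 1ℚ
      κ-eq = begin
        b * b * g * (q - (q - 1ℚ) * r - r * r) ≡⟨ eq₁ b g q r ⟩
        g * (b * b * q - (q - 1ℚ) * b * (r * b) - (r * b) * (r * b)) ≡⟨ cong (λ s → g * (b * b * q - (q - 1ℚ) * b * s - s * s)) rb ⟩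
        g * (b * b * q - (q - 1ℚ) * b * 1ℚ - 1ℚ * 1ℚ) ≡⟨ eq₂ b g q ⟩
        g * ((q * b + 1ℚ) * (b - 1ℚ)) ≡⟨ cong (λ s → g * ((q * b + 1ℚ) * (s - 1ℚ))) (br-suc l) ⟩
        g * ((q * b + 1ℚ) * (q * br l + 1ℚ - 1ℚ)) ≡⟨ eq₃ b g q (br l) ⟩
        g * ((q * b + 1ℚ) * (q * br l)) ≡⟨ gb ⟩
        1ℚ ∎
        where
        open ≡-Reasoning
        eq₁ : ∀ (b g q r : ℚ) → b * b * g * (q - (q - 1ℚ) * r - r * r) ≡ g * (b * b * q - (q - 1ℚ) * b * (r * b) - (r * b) * (r * b))
        eq₁ = solve-∀ ℚ-ring
        eq₂ : ∀ (b g q : ℚ) → g * (b * b * q - (q - 1ℚ) * b * 1ℚ - 1ℚ * 1ℚ) ≡ g * ((q * b + 1ℚ) * (b - 1ℚ))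
        eq₂ = solve-∀ ℚ-ring
        eq₃ : ∀ (b g q b′ : ℚ) → g * ((q * b + 1ℚ) * (q * b′ + 1ℚ - 1ℚ)) ≡ g * ((q * b + 1ℚ) * (q * b′))
        eq₃ = solve-∀ ℚ-ring
      P-T-x″ : ∀ k → matVec P′ (matVec T′ x″) k ≡ 0ℚ
      P-T-x″ k = trans (matVec-lin P′ 1ℚ (matVec T′ x₁) (- κ) (matVec T′ h) (matVec-lin T′ 1ℚ x₁ (- κ) h (λ _ → refl)) k)
        (trans (cong (λ s → 1ℚ * w k + - κ * s) (P-T-h k)) (trans (eq₁ (w k) κ (q - (q - 1ℚ) * r - r * r))
        (trans (cong (λ s → (1ℚ - s) * w k) κ-eq) (eq₂ (w k)))))
        where
        eq₁ : ∀ (w κ e : ℚ) → 1ℚ * w + - κ * (e * w) ≡ (1ℚ - κ * e) * w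
        eq₁ = solve-∀ ℚ-ring
        eq₂ : ∀ (w : ℚ) → (1ℚ - 1ℚ) * w ≡ 0ℚ
        eq₂ = solve-∀ ℚ-ring
      P-orth : ∀ {y} → (∀ k → matVec P′ y k ≡ 0ℚ) → dot w y ≡ 0ℚ
      P-orth {y} h = trans (dot-cong {y = y} (λ k → sym (P-w k)) (λ _ → refl)) (trans (dot-sym (P-sym l′<M) w y) (dot-zeroʳ w h))
      -- x′ is a combination of w and T w with w in the image of P, and both P x″ and P T x″ vanish.
      orth′ : dot x′ x″ ≡ 0ℚ
      orth′ = trans (dot-*ˡ κ h x″) (trans (cong (κ *_) (trans (dot-linˡ x″ 1ℚ Tw r w (λ _ → refl))
        (cong₂ (λ s t → 1ℚ * s + r * t) (trans (dot-sym (T-sym l<M) w x″) (P-orth P-T-x″)) (P-orth P-x″)))) (eq κ r))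
        where
        eq : ∀ (κ r : ℚ) → κ * (1ℚ * 0ℚ + r * 0ℚ) ≡ 0ℚ
        eq = solve-∀ ℚ-ring
      -- In L⁺ T w = T L T T w the quadratic relation for T T w leaves T L T w = L⁺ w, where `L-eig`
      -- applies, and T L w, where w is invariant.
      L-Tw : ∀ k → matVec L⁺ Tw k ≡ (q - 1ℚ) * (p * w k) + β * Tw k
      L-Tw k = begin
        matVec L⁺ Tw k ≡⟨ L-suc l<M Tw k ⟩
        matVec T′ (matVec (L (suc l)) (matVec T′ Tw)) k ≡⟨ matVec-lin T′ (q - 1ℚ) (matVec (L (suc l)) Tw) q (matVec (L (suc l)) w)
            (matVec-lin (L (suc l)) (q - 1ℚ) Tw q w (T-quad l<M w)) k ⟩
        (q - 1ℚ) * matVec T′ (matVec (L (suc l)) Tw) k + q * matVec T′ (matVec (L (suc l)) w) k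
            ≡⟨ cong₂ (λ s t → (q - 1ℚ) * s + q * t)
            (trans (sym (L-suc l<M w k)) (L-eig (suc l) l<M P-w P⁺-w k))
            (matVec-scale T′ (p * p) w (L-invariant (suc l) l′<M (P-fixed-invariant l′<M P-w)) k) ⟩
        (q - 1ℚ) * (p * w k) + q * (p * p * Tw k) ≡⟨ cong ((q - 1ℚ) * (p * w k) +_) (sym (*-assoc q (p * p) (Tw k))) ⟩
        (q - 1ℚ) * (p * w k) + β * Tw k ∎
        where open ≡-Reasoning
      L-h : ∀ k → matVec L⁺ h k ≡ β * h k
      L-h k = begin
        matVec L⁺ h k ≡⟨ matVec-lin L⁺ 1ℚ Tw r w (λ _ → refl) k ⟩
        1ℚ * matVec L⁺ Tw k + r * matVec L⁺ w k ≡⟨ cong₂ (λ s t → 1ℚ * s + r * t) (L-Tw k) (L-eig (suc l) l<M P-w P⁺-w k) ⟩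
        1ℚ * ((q - 1ℚ) * (p * w k) + β * Tw k) + r * (p * w k) ≡⟨ eq₁ p q r β (Tw k) (w k) ⟩
        -- The 1 is replaced by r b so that r factors out and `br-pow` applies.
        β * Tw k + ((q - 1ℚ) * 1ℚ + r) * p * w k ≡⟨ cong (λ s → β * Tw k + ((q - 1ℚ) * s + r) * p * w k) (sym rb) ⟩
        β * Tw k + ((q - 1ℚ) * (r * b) + r) * p * w k ≡⟨ eq₂ p q r b β (Tw k) (w k) ⟩
        β * Tw k + r * ((q - 1ℚ) * b + 1ℚ) * p * w k ≡⟨ cong (λ s → β * Tw k + r * s * p * w k) (sym (br-pow (suc l))) ⟩
        β * Tw k + r * (q * p) * p * w k ≡⟨ eq₃ p q r (Tw k) (w k) ⟩
        β * h k ∎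
        where
        open ≡-Reasoning
        eq₁ : ∀ (p q r β t w : ℚ) → 1ℚ * ((q - 1ℚ) * (p * w) + β * t) + r * (p * w) ≡ β * t + ((q - 1ℚ) * 1ℚ + r) * p * w
        eq₁ = solve-∀ ℚ-ring
        eq₂ : ∀ (p q r b β t w : ℚ) → β * t + ((q - 1ℚ) * (r * b) + r) * p * w ≡ β * t + r * ((q - 1ℚ) * b + 1ℚ) * p * w
        eq₂ = solve-∀ ℚ-ring
        eq₃ : ∀ (p q r t w : ℚ) → q * (p * p) * t + r * (q * p) * p * w ≡ q * (p * p) * (1ℚ * t + r * w)
        eq₃ = solve-∀ ℚ-ring
      L-x′ : ∀ k → matVec L⁺ x′ k ≡ β * x′ k
      L-x′ k = trans (matVec-* L⁺ κ h k) (trans (cong (κ *_) (L-h k)) (eq κ β (h k)))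
        where
        eq : ∀ (κ β h : ℚ) → κ * (β * h) ≡ β * (κ * h)
        eq = solve-∀ ℚ-ring
      Tx″ : Fin N → ℚ
      Tx″ = matVec T′ x″
      bound″ : dot x″ (matVec L⁺ x″) ℚ.≤ β * dot x″ x″
      bound″ = begin
        dot x″ (matVec L⁺ x″) ≡⟨ L-form-suc l<M x″ ⟩
        dot Tx″ (matVec (L (suc l)) Tx″) ≤⟨ L-bound l l′<M P-T-x″ ⟩
        q * (q ^ℚ l * q ^ℚ l) * dot Tx″ Tx″ ≤⟨ *-monoʳ (ℚ.<⇒≤ (0<-* 0<q (0<-* (0<q^ l) (0<q^ l)))) (T-norm l<M x″) ⟩
        q * (q ^ℚ l * q ^ℚ l) * (q * q * dot x″ x″) ≡⟨ eq q (q ^ℚ l) (dot x″ x″) ⟩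
        β * dot x″ x″ ∎
        where
        open ℚ.≤-Reasoning
        eq : ∀ (q p d : ℚ) → q * (p * p) * (q * q * d) ≡ q * (q * p * (q * p)) * d
        eq = solve-∀ ℚ-ring

    -- As y is invariant, A l acts on it by the scalar a l, on either side of L (l+1). The remaining
    -- factor q^l comes from `L-eig`.
    A²-eig : ∀ {l} → l ℕ.< M → ∀ {y} → (∀ k → matVec (P l) y k ≡ y k) → (∀ k → matVec (P (suc l)) y k ≡ 0ℚ) →
      ∀ j → matVec (A (suc l)) (matVec (A (suc l)) y) j ≡ q ^ℚ l * (a l * a l) * y j
    A²-eig {l} l<M {y} fix null j = begin
      matVec (A (suc l)) (matVec (A (suc l)) y) j ≡⟨ A-sucᵀ l<M (matVec (A (suc l)) y) j ⟩
      matVec (A l) (matVec (c (suc l) ᵀ) (matVec (A (suc l)) y)) j ≡⟨ matVec-cong (A l) (matVec-cong (c (suc l) ᵀ) (A-suc′ l<M y)) j ⟩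
      matVec (A l) (matVec (c (suc l) ᵀ) (matVec (c (suc l)) (matVec (A l) y))) j ≡⟨ matVec-cong (A l) (λ k → sym (matVec-⊡ (c (suc l) ᵀ) (c (suc l)) (matVec (A l) y) k)) j ⟩
      matVec (A l) (matVec (L (suc l)) (matVec (A l) y)) j ≡⟨ matVec-scale (A l) (a l * q ^ℚ l) y LAy j ⟩
      a l * q ^ℚ l * matVec (A l) y j ≡⟨ cong (a l * q ^ℚ l *_) (A-y j) ⟩
      a l * q ^ℚ l * (a l * y j) ≡⟨ eq (a l) (q ^ℚ l) (y j) ⟩
      q ^ℚ l * (a l * a l) * y j ∎
      where
      open ≡-Reasoning
      A-y : ∀ k → matVec (A l) y k ≡ a l * y k
      A-y = A-invariant l (ℕ.<⇒≤ l<M) (P-fixed-invariant (ℕ.<⇒≤ l<M) fix)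
      LAy : ∀ k → matVec (L (suc l)) (matVec (A l) y) k ≡ a l * q ^ℚ l * y k
      LAy k = trans (matVec-scale (L (suc l)) (a l) y A-y k) (trans (cong (a l *_) (L-eig l l<M fix null k)) (sym (*-assoc (a l) (q ^ℚ l) (y k))))
      eq : ∀ (a p y : ℚ) → a * p * (a * y) ≡ p * (a * a) * y
      eq = solve-∀ ℚ-ring

    -- On the P-fixed part A² is the scalar β. On the rest, A (l+1) stays in the kernel of P (l+1),
    -- so the bound for L (l+2) and the induction hypothesis multiply. Their product q · q^(2(l+1))
    -- · q^l a_l² is again β, because a_{l+1} = q^(l+1) a_l.
    A-norm : ∀ l → l ℕ.< M → ∀ {x} → (∀ k → matVec (P (suc l)) x k ≡ 0ℚ) →
      dot (matVec (A (suc l)) x) (matVec (A (suc l)) x) ℚ.≤ q ^ℚ l * (a l * a l) * dot x x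
    A-norm zero l<M {x} null = ℚ.≤-reflexive (trans (dot-sym (A-sym l<M) x (matVec (A 1) x))
      (dot-scaleʳ x (1ℚ * (1ℚ * 1ℚ)) x (A²-eig l<M (P-0 x) null)))
    A-norm (suc l) l<M {x} null = subst (ℚ._≤ β * dot x x) (sym (A²-form x))
      (Split.split-bound {A = A² } A²-sym β splitting (λ k → trans (matVec-⊡ A⁺ A⁺ (matVec P′ x) k) (A²-eig l<M P-x₀ P⁺-x₀ k))
        orthogonal ℚ.≤-refl bound₁)
      where
      l′<M = ℕ.<⇒≤ l<M
      open Projection (P-sym l′<M) (P-idem l′<M) x renaming (remainder to x₁)
      P′ P⁺ A′ A⁺ A² : Mat N N
      P′ = P (suc l)
      P⁺ = P (suc (suc l))
      A′ = A (suc l)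
      A⁺ = A (suc (suc l))
      A² = A⁺ ⊡ A⁺
      β : ℚ
      β = q ^ℚ suc l * (a (suc l) * a (suc l))
      A²-sym : Sym A²
      A²-sym j k = sum-cong (λ i → trans (*-comm (A⁺ j i) (A⁺ i k)) (cong₂ _*_ (A-sym l<M i k) (A-sym l<M j i)))
      A²-form : ∀ y → dot (matVec A⁺ y) (matVec A⁺ y) ≡ dot y (matVec A² y)
      A²-form y = trans (dot-sym (A-sym l<M) y (matVec A⁺ y)) (dot-cong {x = y} (λ _ → refl) (λ k → sym (matVec-⊡ A⁺ A⁺ y k)))
      P-x₀ : ∀ k → matVec P′ (matVec P′ x) k ≡ matVec P′ x k
      P-x₀ = P-idem l′<M x
      P⁺-x₀ : ∀ k → matVec P⁺ (matVec P′ x) k ≡ 0ℚ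
      P⁺-x₀ k = trans (P-suc-P l<M x k) (null k)
      y₁ : Fin N → ℚ
      y₁ = matVec A′ x₁
      P-y₁ : ∀ k → matVec P′ y₁ k ≡ 0ℚ
      P-y₁ k = trans (sym-absorb (A-sym l′<M) (P-sym l′<M) (a (suc l))
          (λ z → A-invariant (suc l) l′<M (P-fixed-invariant l′<M (P-idem l′<M z))) x₁ k)
        (trans (cong (a (suc l) *_) (remainder-0 k)) (*-zeroʳ (a (suc l))))
      P⁺-y₁ : ∀ k → matVec P⁺ y₁ k ≡ 0ℚ
      P⁺-y₁ k = trans (sym (P-suc-P l<M y₁ k)) (sum-0 (λ i → trans (cong (P⁺ k i *_) (P-y₁ i)) (*-zeroʳ (P⁺ k i))))
      bound₁ : dot x₁ (matVec A² x₁) ℚ.≤ β * dot x₁ x₁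
      bound₁ = begin
        dot x₁ (matVec A² x₁) ≡⟨ sym (A²-form x₁) ⟩
        dot (matVec A⁺ x₁) (matVec A⁺ x₁) ≡⟨ dot-cong (A-suc′ l<M x₁) (A-suc′ l<M x₁) ⟩
        dot (matVec (c (suc (suc l))) y₁) (matVec (c (suc (suc l))) y₁) ≡⟨ sym (L-form (suc (suc l)) y₁) ⟩
        dot y₁ (matVec (L (suc (suc l))) y₁) ≤⟨ L-bound (suc l) l<M P⁺-y₁ ⟩
        q * (q ^ℚ suc l * q ^ℚ suc l) * dot y₁ y₁ ≤⟨ *-monoʳ (ℚ.<⇒≤ (0<-* 0<q (0<-* (0<q^ (suc l)) (0<q^ (suc l))))) (A-norm l l′<M remainder-0) ⟩
        q * (q ^ℚ suc l * q ^ℚ suc l) * (q ^ℚ l * (a l * a l) * dot x₁ x₁) ≡⟨ eq q (q ^ℚ l) (a l) (dot x₁ x₁) ⟩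
        β * dot x₁ x₁ ∎
        where
        open ℚ.≤-Reasoning
        eq : ∀ (q p a d : ℚ) → q * (q * p * (q * p)) * (p * (a * a) * d) ≡ q * p * (q * p * a * (q * p * a)) * d
        eq = solve-∀ ℚ-ring

    -- From ‖A x₁‖ ≤ ρ ‖x₁‖ by expanding 0 ≤ ‖A x₁ + ρ x₁‖².
    A-form-bound : ∀ {l} → l ℕ.< M → ∀ {ρ} → 0ℚ ℚ.< ρ → ρ * ρ ≡ q ^ℚ l * (a l * a l) →
      ∀ x → - ρ * dot x x ℚ.≤ dot x (matVec (A (suc l)) x)
    A-form-bound {l} l<M {ρ} 0<ρ ρ² x = begin
      - ρ * dot x x ≡⟨ trans (cong (- ρ *_) S.split-norm) (*-distribˡ-+ (- ρ) (dot x₀ x₀) (dot x₁ x₁)) ⟩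
      - ρ * dot x₀ x₀ + - ρ * dot x₁ x₁ ≤⟨ ℚ.+-mono-≤ (ℚ.*-monoʳ-≤-nonNeg (dot x₀ x₀) {{ℚ.nonNegative (dot-nonneg x₀)}} -ρ≤a) bound₁ ⟩
      a (suc l) * dot x₀ x₀ + dot x₁ (matVec A′ x₁) ≡⟨ sym S.split-form ⟩
      dot x (matVec A′ x) ∎
      where
      open ℚ.≤-Reasoning
      open Projection (P-sym l<M) (P-idem l<M) x renaming (remainder to x₁)
      A′ : Mat N N
      A′ = A (suc l)
      x₀ Ax₁ w : Fin N → ℚ
      x₀ = matVec (P (suc l)) x
      Ax₁ = matVec A′ x₁
      w k = 1ℚ * Ax₁ k + ρ * x₁ k
      module S = Split (A-sym l<M) (a (suc l)) splitting (A-invariant (suc l) l<M (P-fixed-invariant l<M (P-idem l<M x))) orthogonal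
      -ρ≤a : - ρ ℚ.≤ a (suc l)
      -ρ≤a = ℚ.≤-trans (ℚ.neg-antimono-≤ (ℚ.<⇒≤ 0<ρ)) (ℚ.<⇒≤ (0<a (suc l)))
      ww : dot w w ≡ 1ℚ * (1ℚ * dot Ax₁ Ax₁ + ρ * dot x₁ Ax₁) + ρ * (1ℚ * dot x₁ Ax₁ + ρ * dot x₁ x₁)
      ww = trans (dot-linʳ w 1ℚ Ax₁ ρ x₁ (λ _ → refl)) (cong₂ (λ u v → 1ℚ * u + ρ * v)
             (dot-linˡ Ax₁ 1ℚ Ax₁ ρ x₁ (λ _ → refl))
             (trans (dot-linˡ x₁ 1ℚ Ax₁ ρ x₁ (λ _ → refl)) (cong (λ u → 1ℚ * u + ρ * dot x₁ x₁) (dot-comm Ax₁ x₁))))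
      eq₁ : ∀ (ρ s t d : ℚ) → (1ℚ * (1ℚ * s + ρ * t) + ρ * (1ℚ * t + ρ * d)) + (ρ * ρ * d - s) ≡ (ρ + ρ) * (t - - ρ * d)
      eq₁ = solve-∀ ℚ-ring
      bound₁ : - ρ * dot x₁ x₁ ℚ.≤ dot x₁ Ax₁
      bound₁ = 0≤q-p⇒p≤q (0≤-cancel (ℚ.+-mono-< 0<ρ 0<ρ) (subst (0ℚ ℚ.≤_)
        (trans (cong (_+ (ρ * ρ * dot x₁ x₁ - dot Ax₁ Ax₁)) ww) (eq₁ ρ (dot Ax₁ Ax₁) (dot x₁ Ax₁) (dot x₁ x₁)))
        (ℚ.+-mono-≤ (dot-nonneg w) (p≤q⇒0≤q-p (subst (λ e → dot Ax₁ Ax₁ ℚ.≤ e * dot x₁ x₁) (sym ρ²) (A-norm l l<M remainder-0))))))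

open Spectra

-- Decidable linear algebra over a finite field.

module LinearAlgebra (F : FiniteField) where
  open FiniteField F renaming (_+_ to infixl 6 _⊕_; _*_ to infixl 7 _⊗_; -_ to infix 8 ⊖_)

  F-ring : CommutativeRing _ _
  F-ring = record { isCommutativeRing = isCommutativeRing }

  module R = CommutativeRing F-ring
  module RP = RingProperties R.ring
  +-interchange : ∀ a b c d → (a ⊕ b) ⊕ (c ⊕ d) ≡ (a ⊕ c) ⊕ (b ⊕ d)
  +-interchange = CommutativeSemigroupProperties.interchange R.+-commutativeSemigroup

  open Inverse enumeration using (to; from; strictlyInverseˡ; strictlyInverseʳ)

  from-injective : ∀ {x y} → from x ≡ from y → x ≡ y
  from-injective {x} {y} e = trans (sym (strictlyInverseˡ x)) (trans (cong to e) (strictlyInverseˡ y))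

  to-injective : ∀ {x y} → to x ≡ to y → x ≡ y
  to-injective {x} {y} e = trans (sym (strictlyInverseʳ x)) (trans (cong from e) (strictlyInverseʳ y))


  _≟F_ : (x y : Carrier) → Dec (x ≡ y)
  x ≟F y = map′ from-injective (cong from) (from x Fin.≟ from y)

  2≤order : 2 ℕ.≤ order
  2≤order = twoPoints order (from 0#) (from 1#) (0≢1 ∘ from-injective)
    where
    twoPoints : ∀ n (a b : Fin n) → a ≢ b → 2 ℕ.≤ n
    twoPoints (suc zero) zero zero a≢b = contradiction refl a≢b
    twoPoints (suc (suc n)) _ _ _ = ℕ.s≤s (ℕ.s≤s ℕ.z≤n)

  decode : ∀ {n} → Fin (order ℕ.^ n) → Fin n → Carrier
  decode {n} t = to ∘ finToFun {order} {n} t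

  encode : ∀ {n} → (Fin n → Carrier) → Fin (order ℕ.^ n)
  encode c = funToFin (from ∘ c)

  decode-encode : ∀ {n} (c : Fin n → Carrier) j → decode {n} (encode c) j ≡ c j
  decode-encode c j = trans (cong to (Fin.finToFun-funToFin (from ∘ c) j)) (strictlyInverseˡ (c j))

  encode-injective : ∀ {n} (c d : Fin n → Carrier) → encode c ≡ encode d → ∀ j → c j ≡ d j
  encode-injective {n} c d e j = trans (sym (decode-encode c j)) (trans (cong (λ t → decode {n} t j) e) (decode-encode d j))

  decode-injective : ∀ {n} (s t : Fin (order ℕ.^ n)) → (∀ j → decode {n} s j ≡ decode {n} t j) → s ≡ t
  decode-injective {n} s t h = begin
    s ≡⟨ sym (Fin.funToFin-finToFin {n} {order} s) ⟩
    funToFin (finToFun {order} {n} s) ≡⟨ funToFin-cong (λ j → to-injective (h j)) ⟩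
    funToFin (finToFun {order} {n} t) ≡⟨ Fin.funToFin-finToFin {n} {order} t ⟩
    t ∎
    where
    open ≡-Reasoning
    funToFin-cong : ∀ {k l} {f g : Fin k → Fin l} → (∀ j → f j ≡ g j) → funToFin f ≡ funToFin g
    funToFin-cong {zero}  h = refl
    funToFin-cong {suc k} h = cong₂ Fin.combine (h zero) (funToFin-cong (h ∘ suc))

  abstract
    -- The enumeration of the field makes coefficient vectors a finite set. A vector is recovered
    -- from its code only pointwise, so P has to respect pointwise equality.
    search : ∀ {n} {P : (Fin n → Carrier) → Set} → (∀ c → Dec (P c)) → (∀ {c d} → (∀ j → c j ≡ d j) → P c → P d) →
      Dec (Σ (Fin n → Carrier) P)
    search {n} P? resp = map′ (λ (t , p) → decode {n} t , p)
      (λ (c , p) → encode c , resp (λ j → sym (decode-encode c j)) p) (Fin.any? (P? ∘ decode {n}))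

  sumF-cong : ∀ {n} {f g : Fin n → Carrier} → (∀ j → f j ≡ g j) → sumF F f ≡ sumF F g
  sumF-cong {zero}  h = refl
  sumF-cong {suc n} h = cong₂ _⊕_ (h zero) (sumF-cong (h ∘ suc))

  sumF-0 : ∀ {n} {f : Fin n → Carrier} → (∀ j → f j ≡ 0#) → sumF F f ≡ 0#
  sumF-0 {zero}  h = refl
  sumF-0 {suc n} h = trans (cong₂ _⊕_ (h zero) (sumF-0 (h ∘ suc))) (R.+-identityˡ 0#)

  sumF-+ : ∀ {n} (f g : Fin n → Carrier) → sumF F (λ j → f j ⊕ g j) ≡ sumF F f ⊕ sumF F g
  sumF-+ {zero}  f g = sym (R.+-identityˡ 0#)
  sumF-+ {suc n} f g = trans (cong (f zero ⊕ g zero ⊕_) (sumF-+ (f ∘ suc) (g ∘ suc))) (+-interchange _ _ _ _)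

  sumF-* : ∀ {n} a (f : Fin n → Carrier) → sumF F (λ j → a ⊗ f j) ≡ a ⊗ sumF F f
  sumF-* {zero}  a f = sym (R.zeroʳ a)
  sumF-* {suc n} a f = trans (cong (a ⊗ f zero ⊕_) (sumF-* a (f ∘ suc))) (sym (R.distribˡ a _ _))

  sumF-split : ∀ a {b} (f : Fin (a ℕ.+ b) → Carrier) → sumF F f ≡ sumF F (λ j → f (j ↑ˡ b)) ⊕ sumF F (λ j → f (a ↑ʳ j))
  sumF-split zero    f = sym (R.+-identityˡ _)
  sumF-split (suc a) f = trans (cong (f zero ⊕_) (sumF-split a (f ∘ suc))) (sym (R.+-assoc _ _ _))

  lincomb-+ : ∀ {n m} (c d : Fin n → Carrier) (b : Fin n → Vect F m) k →
    lincomb F (λ j → c j ⊕ d j) b k ≡ lincomb F c b k ⊕ lincomb F d b k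
  lincomb-+ c d b k = trans (sumF-cong (λ j → R.distribʳ (b j k) (c j) (d j))) (sumF-+ (λ j → c j ⊗ b j k) (λ j → d j ⊗ b j k))

  lincomb-* : ∀ {n m} a (c : Fin n → Carrier) (b : Fin n → Vect F m) k →
    lincomb F (λ j → a ⊗ c j) b k ≡ a ⊗ lincomb F c b k
  lincomb-* a c b k = trans (sumF-cong (λ j → R.*-assoc a (c j) (b j k))) (sumF-* a (λ j → c j ⊗ b j k))

  lincomb-cong : ∀ {n m} {c d : Fin n → Carrier} (b : Fin n → Vect F m) → (∀ j → c j ≡ d j) →
    ∀ k → lincomb F c b k ≡ lincomb F d b k
  lincomb-cong b h k = sumF-cong (λ j → cong (_⊗ b j k) (h j))

  private
    variable
      m i j : ℕ
      U W X : Subspace F m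

  abstract
    mem-lincomb : ∀ (U : Subspace F m) {n} (c : Fin n → Carrier) {b : Fin n → Vect F m} →
      (∀ j → mem U (b j)) → mem U (lincomb F c b)
    mem-lincomb U {zero}  c h = mem-resp U (λ _ → refl) (mem-0 U)
    mem-lincomb U {suc n} c h = mem-+ U (mem-* U (c zero) (h zero)) (mem-lincomb U (c ∘ suc) (h ∘ suc))

  abstract
    mem-neg : ∀ (U : Subspace F m) {x} → mem U x → mem U (λ k → ⊖ x k)
    mem-neg U {x} h = mem-resp U (λ k → RP.-1*x≈-x (x k)) (mem-* U (⊖ 1#) h)

  abstract
    mem-sub : ∀ (U : Subspace F m) {x u w} → _≐_ F x (λ k → u k ⊕ w k) → mem U x → mem U u → mem U w
    mem-sub U {x} {u} {w} e hx hu = mem-resp U (λ k → trans (cong (⊖ u k ⊕_) (e k)) (RP.\\-leftDividesʳ (u k) (w k)))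
      (mem-+ U (mem-neg U hu) hx)

  -- HasDim, containment and equality of subspaces unfold to function types from which the subspaces
  -- cannot be inferred; these records make them inferable.
  record Dim (U : Subspace F m) (i : ℕ) : Set where
    constructor dim
    field
      hasDim : HasDim F U i
  open Dim public

  infix 4 _≼_ _≃_
  record _≼_ (U W : Subspace F m) : Set where
    constructor incl
    field
      app : ∀ {x} → mem U x → mem W x
  open _≼_ public

  record _≃_ (U W : Subspace F m) : Set where
    constructor _⇄_
    field
      fwd : U ≼ W
      bwd : W ≼ U
  open _≃_ public

  ≼-refl : U ≼ U
  ≼-refl = incl λ h → h

  ≼-trans : U ≼ W → W ≼ X → U ≼ X
  ≼-trans f g = incl (app g ∘ app f)

  ≃-refl : U ≃ U
  ≃-refl = ≼-refl ⇄ ≼-refl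

  ≃-sym : U ≃ W → W ≃ U
  ≃-sym (f ⇄ g) = g ⇄ f

  ≃-trans : U ≃ W → W ≃ X → U ≃ X
  ≃-trans (f ⇄ g) (f′ ⇄ g′) = ≼-trans f f′ ⇄ ≼-trans g′ g

  abstract
    Dim-≃ : U ≃ W → Dim U i → Dim W i
    Dim-≃ (f ⇄ g) (dim (b , ind , h , span)) = dim (b , ind , (λ j → app f (h j)) , (λ x → span x ∘ app g))

  abstract
    mem? : Dim U i → ∀ x → Dec (mem U x)
    mem? {U = U} (dim (b , ind , h , span)) x = map′
      (λ (c , e) → mem-resp U (λ k → sym (e k)) (mem-lincomb U c h)) (span x)
      (search (λ c → Fin.all? (λ k → x k ≟F lincomb F c b k)) (λ e p k → trans (p k) (lincomb-cong b e k)))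

  abstract
    ∀mem? : Dim U i → {P : Vect F m → Set} → (∀ x → Dec (P x)) → (∀ {x y} → _≐_ F x y → P x → P y) →
      Dec (∀ x → mem U x → P x)
    ∀mem? {U = U} (dim (b , ind , h , span)) {P} P? resp with search (λ c → ¬? (P? (lincomb F c b))) (λ e n p → n (resp (λ k → sym (lincomb-cong b e k)) p))
    ... | yes (c , n) = no λ all → n (all _ (mem-lincomb U c h))
    ... | no none = yes λ x hx → let c , e = span x hx in resp (λ k → sym (e k)) (stable (P? (lincomb F c b)) (λ n → none (c , n)))
      where
      stable : ∀ {A : Set} → Dec A → ¬ ¬ A → A
      stable (yes a) _ = a
      stable (no n) nn = contradiction n nn

  abstract
    ≼? : Dim U i → Dim W j → Dec (U ≼ W)
    ≼? {W = W} dU dW = map′ (λ h → incl (h _)) (λ f _ → app f) (∀mem? dU (mem? dW) (mem-resp W))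

  abstract
    ≃? : Dim U i → Dim W j → Dec (U ≃ W)
    ≃? dU dW = map′ (λ (f , g) → f ⇄ g) (λ (f ⇄ g) → f , g) (≼? dU dW ×-dec ≼? dW dU)

  abstract
    TrivInter? : Dim U i → Dim W j → Dec (TrivInter F U W)
    TrivInter? {W = W} dU dW = ∀mem? dU {P = λ x → mem W x → _≐_ F x (zeroV F)} dec resp
      where
      dec : ∀ x → Dec (mem W x → _≐_ F x (zeroV F))
      dec x with mem? dW x | Fin.all? (λ k → x k ≟F 0#)
      ... | _      | yes z = yes λ _ → z
      ... | no n   | _     = yes λ h → contradiction h n
      ... | yes h  | no nz = no λ f → nz (f h)
      resp : ∀ {x y} → _≐_ F x y → (mem W x → _≐_ F x (zeroV F)) → mem W y → _≐_ F y (zeroV F)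
      resp e f hy k = trans (sym (e k)) (f (mem-resp W (λ k → sym (e k)) hy) k)

  abstract
    lincomb-injective : ∀ {n} {b : Fin n → Vect F m} → LinIndep F b → ∀ c d →
      _≐_ F (lincomb F c b) (lincomb F d b) → ∀ j → c j ≡ d j
    lincomb-injective {n = n} {b = b} ind c d e j = RP.x∙y⁻¹≈ε⇒x≈y (c j) (d j) (trans (cong (c j ⊕_) (sym (RP.-1*x≈-x (d j)))) (ind diff null j))
      where
      diff : Fin n → Carrier
      diff j = c j ⊕ ⊖ 1# ⊗ d j
      null : _≐_ F (lincomb F diff b) (zeroV F)
      null k = begin
        lincomb F diff b k ≡⟨ lincomb-+ c (λ j → ⊖ 1# ⊗ d j) b k ⟩
        lincomb F c b k ⊕ lincomb F (λ j → ⊖ 1# ⊗ d j) b k ≡⟨ cong₂ _⊕_ (e k) (trans (lincomb-* (⊖ 1#) d b k) (RP.-1*x≈-x _)) ⟩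
        lincomb F d b k ⊕ ⊖ lincomb F d b k ≡⟨ R.-‿inverseʳ _ ⟩
        0# ∎
        where open ≡-Reasoning

  -- Counting coefficient vectors: q^i ≤ q^j forces i ≤ j.
  abstract
    dim-≤ : U ≼ W → Dim U i → Dim W j → i ℕ.≤ j
    dim-≤ {U = U} {W} {i} {j} U⊆W (dim (b , ind , h , _)) (dim (b′ , _ , _ , span)) = ℕ.≮⇒≥ λ j<i →
      ℕ.<⇒≱ (ℕ.^-monoʳ-< order 2≤order j<i) (Fin.injective⇒≤ {f = f} f-injective)
      where
      coords : (c : Fin i → Carrier) → Σ (Fin j → Carrier) λ d → _≐_ F (lincomb F c b) (lincomb F d b′)
      coords c = span _ (app U⊆W (mem-lincomb U c h))
      f : Fin (order ℕ.^ i) → Fin (order ℕ.^ j)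
      f t = encode (proj₁ (coords (decode {i} t)))
      f-injective : ∀ {s t} → f s ≡ f t → s ≡ t
      f-injective {s} {t} e = decode-injective {i} s t (lincomb-injective ind _ _ (λ k →
        trans (proj₂ (coords (decode {i} s)) k)
          (trans (lincomb-cong b′ (encode-injective (proj₁ (coords (decode {i} s))) (proj₁ (coords (decode {i} t))) e) k)
                 (sym (proj₂ (coords (decode {i} t)) k)))))

  abstract
    dim-unique : Dim U i → Dim U j → i ≡ j
    dim-unique dU dU′ = ℕ.≤-antisym (dim-≤ ≼-refl dU dU′) (dim-≤ ≼-refl dU′ dU)

  zeroS : Subspace F m
  zeroS = record
    { mem = λ x → _≐_ F x (zeroV F)
    ; mem-resp = λ e h k → trans (sym (e k)) (h k)
    ; mem-0 = λ _ → refl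
    ; mem-+ = λ h h′ k → trans (cong₂ _⊕_ (h k) (h′ k)) (R.+-identityˡ 0#)
    ; mem-* = λ a h k → trans (cong (a ⊗_) (h k)) (R.zeroʳ a)
    }

  abstract
    zeroS-dim : Dim (zeroS {m}) 0
    zeroS-dim = dim ((λ ()) , (λ _ _ ()) , (λ ()) , λ x h → (λ ()) , h)

  abstract
    dim-0 : Dim U 0 → U ≼ zeroS
    dim-0 (dim (_ , _ , _ , span)) = incl λ {x} h → proj₂ (span x h)

  fullS : Subspace F m
  fullS = record { mem = λ _ → ⊤ ; mem-resp = λ _ _ → tt ; mem-0 = tt ; mem-+ = λ _ _ → tt ; mem-* = λ _ _ → tt }

  abstract
    fullS-dim : Dim (fullS {m}) m
    fullS-dim {m} = dim (unit , (λ c e j → trans (sym (lincomb-unit c j)) (e j)) , (λ _ → tt) , λ x _ → x , λ k → sym (lincomb-unit x k))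
      where
      unit : ∀ {m} → Fin m → Vect F m
      unit zero    zero    = 1#
      unit zero    (suc _) = 0#
      unit (suc _) zero    = 0#
      unit (suc j) (suc k) = unit j k
      lincomb-unit : ∀ {m} (c : Fin m → Carrier) k → lincomb F c unit k ≡ c k
      lincomb-unit c zero    = trans (cong₂ _⊕_ (R.*-identityʳ (c zero)) (sumF-0 (λ j → R.zeroʳ (c (suc j))))) (R.+-identityʳ _)
      lincomb-unit c (suc k) = trans (cong₂ _⊕_ (R.zeroʳ (c zero)) (lincomb-unit (c ∘ suc) k)) (R.+-identityˡ _)

  interS : Subspace F m → Subspace F m → Subspace F m
  interS U W = record
    { mem = λ x → mem U x × mem W x
    ; mem-resp = λ e (h , h′) → mem-resp U e h , mem-resp W e h′
    ; mem-0 = mem-0 U , mem-0 W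
    ; mem-+ = λ (h , h′) (g , g′) → mem-+ U h g , mem-+ W h′ g′
    ; mem-* = λ a (h , h′) → mem-* U a h , mem-* W a h′
    }

  sumS : Subspace F m → Subspace F m → Subspace F m
  sumS {m} U W = record
    { mem = λ x → Σ (Vect F m) λ u → Σ (Vect F m) λ w → mem U u × mem W w × _≐_ F x (λ k → u k ⊕ w k)
    ; mem-resp = λ e (u , w , hu , hw , d) → u , w , hu , hw , λ k → trans (sym (e k)) (d k)
    ; mem-0 = zeroV F , zeroV F , mem-0 U , mem-0 W , λ k → sym (R.+-identityˡ 0#)
    ; mem-+ = λ (u , w , hu , hw , d) (u′ , w′ , hu′ , hw′ , d′) → _ , _ , mem-+ U hu hu′ , mem-+ W hw hw′ ,
        λ k → trans (cong₂ _⊕_ (d k) (d′ k)) (+-interchange _ _ _ _)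
    ; mem-* = λ a (u , w , hu , hw , d) → _ , _ , mem-* U a hu , mem-* W a hw ,
        λ k → trans (cong (a ⊗_) (d k)) (R.distribˡ a _ _)
    }

  abstract
    sumS-ˡ : ∀ (U W : Subspace F m) → U ≼ (sumS U W)
    sumS-ˡ U W = incl λ {x} h → x , zeroV F , h , mem-0 W , λ k → sym (R.+-identityʳ (x k))

  abstract
    sumS-ʳ : ∀ (U W : Subspace F m) → W ≼ (sumS U W)
    sumS-ʳ U W = incl λ {x} h → zeroV F , x , mem-0 U , h , λ k → sym (R.+-identityˡ (x k))

  abstract
    sumS-least : U ≼ X → W ≼ X → (sumS U W) ≼ X
    sumS-least {X = X} f g = incl λ (u , w , hu , hw , e) → mem-resp X (λ k → sym (e k)) (mem-+ X (app f hu) (app g hw))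

  sumS-dim : TrivInter F U W → Dim U i → Dim W j → Dim (sumS U W) (i ℕ.+ j)
  sumS-dim {U = U} {W} {i} {j} triv (dim (b , ind , h , span)) (dim (b′ , ind′ , h′ , span′)) = dim (basis , indep , member , spanning)
    where
    basis : Fin (i ℕ.+ j) → Vect F _
    basis = [ b , b′ ]′ ∘ splitAt i
    split : ∀ (c : Fin (i ℕ.+ j) → Carrier) k →
      lincomb F c basis k ≡ lincomb F (λ l → c (l ↑ˡ j)) b k ⊕ lincomb F (λ l → c (i ↑ʳ l)) b′ k
    split c k = trans (sumF-split i (λ l → c l ⊗ basis l k)) (cong₂ _⊕_
      (sumF-cong (λ l → cong (λ s → c (l ↑ˡ j) ⊗ [ b , b′ ]′ s k) (Fin.splitAt-↑ˡ i l j)))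
      (sumF-cong (λ l → cong (λ s → c (i ↑ʳ l) ⊗ [ b , b′ ]′ s k) (Fin.splitAt-↑ʳ i j l))))
    indep : LinIndep F basis
    indep c e l with splitAt i l | Fin.join-splitAt i j l
    ... | s | refl = coeff s
      where
      u w : Vect F _
      u = lincomb F (λ l → c (l ↑ˡ j)) b
      w = lincomb F (λ l → c (i ↑ʳ l)) b′
      hu : mem U u
      hu = mem-lincomb U _ h
      u⊕w : ∀ k → u k ⊕ w k ≡ 0#
      u⊕w k = trans (sym (split c k)) (e k)
      u≐0 : _≐_ F u (zeroV F)
      u≐0 = triv u hu (mem-resp W (λ k → sym (RP.+-inverseˡ-unique (u k) (w k) (u⊕w k))) (mem-neg W (mem-lincomb W _ h′)))
      w≐0 : _≐_ F w (zeroV F)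
      w≐0 k = trans (sym (R.+-identityˡ (w k))) (trans (cong (_⊕ w k) (sym (u≐0 k))) (u⊕w k))
      coeff : ∀ s → c (Fin.join i j s) ≡ 0#
      coeff (inj₁ l) = ind _ u≐0 l
      coeff (inj₂ l) = ind′ _ w≐0 l
    member : ∀ l → mem (sumS U W) (basis l)
    member l with splitAt i l
    ... | inj₁ l = app (sumS-ˡ U W) (h l)
    ... | inj₂ l = app (sumS-ʳ U W) (h′ l)
    spanning : ∀ x → mem (sumS U W) x → Σ (Fin (i ℕ.+ j) → Carrier) λ c → _≐_ F x (lincomb F c basis)
    spanning x (u , w , hu , hw , e) with c , d ← span u hu | c′ , d′ ← span′ w hw =
      [ c , c′ ]′ ∘ splitAt i , λ k → trans (e k) (trans (cong₂ _⊕_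
        (trans (d k) (sumF-cong (λ l → cong (λ s → [ c , c′ ]′ s ⊗ b l k) (sym (Fin.splitAt-↑ˡ i l j)))))
        (trans (d′ k) (sumF-cong (λ l → cong (λ s → [ c , c′ ]′ s ⊗ b′ l k) (sym (Fin.splitAt-↑ʳ i j l))))))
        (sym (split _ k)))

  line : Vect F m → Subspace F m
  line x = record
    { mem = λ y → Σ Carrier λ a → ∀ k → y k ≡ a ⊗ x k
    ; mem-resp = λ e (a , h) → a , λ k → trans (sym (e k)) (h k)
    ; mem-0 = 0# , λ k → sym (R.zeroˡ (x k))
    ; mem-+ = λ (a , h) (b , h′) → a ⊕ b , λ k → trans (cong₂ _⊕_ (h k) (h′ k)) (sym (R.distribʳ (x k) a b))
    ; mem-* = λ c (a , h) → c ⊗ a , λ k → trans (cong (c ⊗_) (h k)) (sym (R.*-assoc c a (x k)))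
    }

  line-self : ∀ (x : Vect F m) → mem (line x) x
  line-self x = 1# , λ k → sym (R.*-identityˡ (x k))

  abstract
    mem-div : ∀ (U : Subspace F m) {x a} → ¬ a ≡ 0# → mem U (λ k → a ⊗ x k) → mem U x
    mem-div U {x} {a} a≢0 h with a⁻¹ , e ← inverse a a≢0 = mem-resp U
      (λ k → trans (sym (R.*-assoc a⁻¹ a (x k))) (trans (cong (_⊗ x k) (trans (R.*-comm a⁻¹ a) e)) (R.*-identityˡ (x k))))
      (mem-* U a⁻¹ h)

  adjoin : Vect F m → Subspace F m → Subspace F m
  adjoin x U = sumS (line x) U

  abstract
    adjoin-self : ∀ (x : Vect F m) U → mem (adjoin x U) x
    adjoin-self x U = app (sumS-ˡ (line x) U) (line-self x)

  abstract
    adjoin-dim : ∀ {x : Vect F m} → ¬ mem U x → Dim U i → Dim (adjoin x U) (suc i)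
    adjoin-dim {U = U} {x = x} x∉U = sumS-dim {U = line x} {W = U} triv line-dim
      where
      coefficient-0 : ∀ a → mem U (λ k → a ⊗ x k) → a ≡ 0#
      coefficient-0 a h with a ≟F 0#
      ... | yes e = e
      ... | no a≢0 = contradiction (mem-div U a≢0 h) x∉U
      triv : TrivInter F (line x) U
      triv y (a , e) h k = trans (e k) (trans (cong (_⊗ x k) (coefficient-0 a (mem-resp U e h))) (R.zeroˡ (x k)))
      line-dim : Dim (line x) 1
      line-dim = dim ((λ _ → x) ,
        (λ { c e zero → coefficient-0 (c zero) (mem-resp U (λ k → trans (sym (e k)) (R.+-identityʳ _)) (mem-0 U)) }) ,
        (λ _ → line-self x) , λ y (a , e) → (λ _ → a) , λ k → trans (e k) (sym (R.+-identityʳ _)))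

  abstract
    adjoin-least : ∀ {x} → mem W x → U ≼ W → adjoin x U ≼ W
    adjoin-least {W = W} {x = x} hx = sumS-least {U = line x} (incl λ (a , e) → mem-resp W (λ k → sym (e k)) (mem-* W a hx))

  abstract
    -- A vector of W outside U would extend U to a subspace of W of dimension i + 1.
    ≼-dim-≡ : U ≼ W → Dim U i → Dim W i → W ≼ U
    ≼-dim-≡ {U = U} {W} U⊆W dU dW = incl contains
      where
      contains : ∀ {x} → mem W x → mem U x
      contains {x} x∈W with mem? dU x
      ... | yes x∈U = x∈U
      ... | no x∉U = contradiction (dim-≤ (adjoin-least x∈W U⊆W) (adjoin-dim x∉U dU) dW) ℕ.1+n≰n

  abstract
    codim-1 : ∀ {x} → U ≼ W → Dim U i → Dim W (suc i) → mem W x → ¬ mem U x → W ≼ (adjoin x U)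
    codim-1 U⊆W dU dW x∈W x∉U = ≼-dim-≡ (adjoin-least x∈W U⊆W) (adjoin-dim x∉U dU) dW

  abstract
    ∉-exists : Dim U i → Dim W j → ¬ W ≼ U → Σ (Vect F _) λ x → mem W x × ¬ mem U x
    ∉-exists {U = U} {W = W} dU (dim (b , _ , h , span)) W⊈U with Fin.any? (λ l → ¬? (mem? dU (b l)))
    ... | yes (l , n) = b l , h l , n
    ... | no none = contradiction (incl λ {x} hx → let c , e = span x hx in mem-resp U (λ k → sym (e k)) (mem-lincomb U c inU)) W⊈U
      where
      inU : ∀ l → mem U (b l)
      inU l with mem? dU (b l)
      ... | yes p = p
      ... | no n = contradiction (l , n) none

  abstract
    -- Vectors of U are adjoined to the zero space as long as one is missing. The fuel j + 1
    -- suffices, because more than j of them would contradict the dimension of W.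
    subspace-dim : (∀ x → Dec (mem U x)) → U ≼ W → Dim W j → Σ ℕ (Dim U)
    subspace-dim {U = U} {W} {j} U? U⊆W dW@(dim (b , _ , h , span)) = grow (suc j) (ℕ.+-identityʳ (suc j)) (incl λ e → mem-resp U (λ k → sym (e k)) (mem-0 U)) zeroS-dim
      where
      grow : ∀ {K i} fuel → fuel ℕ.+ i ≡ suc j → K ≼ U → Dim K i → Σ ℕ (Dim U)
      grow zero refl K⊆U dK = contradiction (dim-≤ (≼-trans K⊆U U⊆W) dK dW) ℕ.1+n≰n
      grow {K} {i} (suc fuel) e K⊆U dK with search (λ c → U? (lincomb F c b) ×-dec ¬? (mem? dK (lincomb F c b)))
             (λ d (p , n) → mem-resp U (lincomb-cong b d) p , n ∘ mem-resp K (λ k → sym (lincomb-cong b d k)))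
      ... | yes (c , x∈U , x∉K) = grow fuel (trans (ℕ.+-suc fuel i) e)
              (adjoin-least x∈U K⊆U) (adjoin-dim x∉K dK)
      ... | no none = i , Dim-≃ (K⊆U ⇄ incl U⊆K) dK
        where
        U⊆K : ∀ {x} → mem U x → mem K x
        U⊆K {x} x∈U with c , d ← span x (app U⊆W x∈U) | mem? dK x
        ... | yes p = p
        ... | no n = contradiction (c , mem-resp U d x∈U , n ∘ mem-resp K (λ k → sym (d k))) none

  abstract
    -- A vector x of U outside H spans V modulo H, so U is U ∩ H with x adjoined, and the dimension
    -- of U ∩ H is read off from `adjoin-dim`.
    cut-dim : ∀ {V H : Subspace F m} {d} → Dim V (suc d) → Dim H d → H ≼ V →
      Dim U (suc i) → U ≼ V → ¬ U ≼ H → Dim (interS U H) i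
    cut-dim {U = U} {i} {V} {H} dV dH H⊆V dU U⊆V U⊈H
      with x , x∈U , x∉H ← ∉-exists dH dU U⊈H
         | e , dI ← subspace-dim {U = interS U H} {W = U} (λ y → mem? dU y ×-dec mem? dH y) (incl proj₁) dU
      = subst (Dim (interS U H)) (ℕ.suc-injective (dim-unique (Dim-≃ (below ⇄ above) (adjoin-dim (x∉H ∘ proj₂) dI)) dU)) dI
      where
      below : (adjoin x (interS U H)) ≼ U
      below = adjoin-least {U = interS U H} x∈U (incl proj₁)
      above : U ≼ (adjoin x (interS U H))
      above = incl λ y∈U → let l , h , (a , e) , h∈H , d = app (codim-1 H⊆V dH dV (app U⊆V x∈U) x∉H) (app U⊆V y∈U) in
        l , h , (a , e) , (mem-sub U d y∈U (mem-resp U (λ k → sym (e k)) (mem-* U a x∈U)) , h∈H) , d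

-- Flags, residues and the relations of opposition.

module Flags (F : FiniteField) (m : ℕ) where
  open FiniteField F renaming (_+_ to infixl 6 _⊕_; _*_ to infixl 7 _⊗_; -_ to infix 8 ⊖_)
  open LinearAlgebra F public

  -- A chamber completed by the zero space at index 0 and the full space from index m on.
  record Flag : Set₁ where
    field
      S     : ℕ → Subspace F m
      S-dim : ∀ {i} → i ≤ m → Dim (S i) i
      S-suc : ∀ i → S i ≼ S (suc i)
  open Flag public

  S-mono : ∀ X {i j} → i ≤ j → S X i ≼ S X j
  S-mono X i≤j = go (ℕ.≤⇒≤′ i≤j)
    where
    go : ∀ {i j} → i ℕ.≤′ j → S X i ≼ S X j
    go (ℕ.≤′-reflexive refl) = ≼-refl
    go (ℕ.≤′-step p)         = ≼-trans (go p) (S-suc X _)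

  S-top : ∀ X {i} → m ≤ i → fullS ≼ S X i
  S-top X m≤i = ≼-trans (≼-dim-≡ (incl λ _ → tt) (S-dim X ℕ.≤-refl) fullS-dim) (S-mono X m≤i)

  S-bottom : ∀ X {U} → S X 0 ≼ U
  S-bottom X {U} = incl λ h → mem-resp U (λ k → sym (app (dim-0 (S-dim X z≤n)) h k)) (mem-0 U)

  choose : ∀ {a} {A : Set a} {P : Set} → Dec P → A → A → A
  choose (yes _) x y = x
  choose (no _)  x y = y

  choose-yes : ∀ {P : Set} (d : Dec P) {U W : Subspace F m} → P → choose d U W ≃ U
  choose-yes (yes _) p = ≃-refl
  choose-yes (no n)  p = contradiction p n

  choose-no : ∀ {P : Set} (d : Dec P) {U W : Subspace F m} → ¬ P → choose d U W ≃ W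
  choose-no (yes p) n = contradiction p n
  choose-no (no _)  n = ≃-refl

  module Modify (X : Flag) (l : ℕ) (U : Subspace F m) (U-dim : Dim U (suc l))
    (lower : S X l ≼ U) (upper : U ≼ S X (suc (suc l))) where

    space : ℕ → Subspace F m
    space i = choose (i ℕ.≟ suc l) U (S X i)

    modify : Flag
    modify .S = space
    modify .S-dim {i} i≤m with i ℕ.≟ suc l
    ... | yes refl = U-dim
    ... | no _     = S-dim X i≤m
    modify .S-suc i with i ℕ.≟ suc l | suc i ℕ.≟ suc l
    ... | yes refl | yes e   = contradiction e ℕ.1+n≢n
    ... | yes refl | no _    = upper
    ... | no _     | yes refl = lower
    ... | no _     | no _    = S-suc X i

    modify-at : S modify (suc l) ≃ U
    modify-at = choose-yes (suc l ℕ.≟ suc l) refl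

    modify-off : ∀ {i} → i ≢ suc l → S modify i ≃ S X i
    modify-off {i} = choose-no (i ℕ.≟ suc l)

  module Splice (X Y : Flag) (b : ℕ) (glue : S X b ≃ S Y b) where

    splice : Flag
    splice .S i = choose (i ℕ.≤? b) (S X i) (S Y i)
    splice .S-dim {i} i≤m with i ℕ.≤? b
    ... | yes _ = S-dim X i≤m
    ... | no _  = S-dim Y i≤m
    splice .S-suc i with i ℕ.≤? b | suc i ℕ.≤? b
    ... | yes _   | yes _  = S-suc X i
    ... | no i≰b  | yes i<b = contradiction (ℕ.<⇒≤ i<b) i≰b
    ... | no _    | no _   = S-suc Y i
    ... | yes i≤b | no i≮b rewrite ℕ.≤-antisym i≤b (ℕ.≮⇒≥ i≮b) = ≼-trans (fwd glue) (S-suc Y b)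

    splice-low : ∀ {i} → i ≤ b → S splice i ≃ S X i
    splice-low {i} = choose-yes (i ℕ.≤? b)

    splice-high : ∀ {i} → b ≤ i → S splice i ≃ S Y i
    splice-high {i} b≤i with i ℕ.≤? b
    ... | no _ = ≃-refl
    ... | yes i≤b rewrite ℕ.≤-antisym i≤b b≤i = glue

  -- The flag cut out by a hyperplane H of X_{b+1}: X_i while X_i ⊆ H, then X_{i+1} ∩ H up to index b.
  module Project (X : Flag) (b : ℕ) (b<m : b < m) (H : Subspace F m) (H-dim : Dim H b) (H≼ : H ≼ S X (suc b)) where

    -- Along increasing i this holds while X_i lies in H, may then fail up to b, and holds again
    -- above b. The case analysis for consecutive indices below follows these two transitions.
    Keep : ℕ → Set
    Keep i = b < i ⊎ S X i ≼ H

    keep? : ∀ i → Dec (Keep i)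
    keep? i with b ℕ.<? i
    ... | yes b<i = yes (inj₁ b<i)
    ... | no b≮i  = map′ inj₂ (λ { (inj₁ b<i) → contradiction b<i b≮i ; (inj₂ h) → h })
                      (≼? (S-dim X (ℕ.<⇒≤ (ℕ.≤-<-trans (ℕ.≮⇒≥ b≮i) b<m))) H-dim)

    bounded : ∀ {i} → ¬ Keep i → i ≤ b
    bounded n = ℕ.≮⇒≥ (n ∘ inj₁)

    project : Flag
    project .S i = choose (keep? i) (S X i) (interS (S X (suc i)) H)
    project .S-dim {i} i≤m with keep? i
    ... | yes _ = S-dim X i≤m
    ... | no n  = cut-dim (S-dim X b<m) H-dim H≼ (S-dim X (ℕ.≤-<-trans (bounded n) b<m))
                    (S-mono X (s≤s (bounded n))) (λ h → n (inj₂ (≼-trans (S-suc X i) h)))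
    project .S-suc i with keep? i | keep? (suc i)
    ... | yes _        | yes _ = S-suc X i
    ... | yes (inj₁ b<i) | no n = contradiction (inj₁ (ℕ.m<n⇒m<1+n b<i)) n
    ... | yes (inj₂ h) | no n  = incl λ x∈ → app (≼-trans (S-suc X i) (S-suc X (suc i))) x∈ , app h x∈
    ... | no n | yes (inj₂ h)  = contradiction (inj₂ (≼-trans (S-suc X i) h)) n
    ... | no n | yes (inj₁ _)  = incl proj₁
    ... | no n | no _          = incl λ (x∈ , x∈H) → app (S-suc X (suc i)) x∈ , x∈H

    project-keep : ∀ {i} → Keep i → S project i ≃ S X i
    project-keep {i} = choose-yes (keep? i)

    project-≼-suc : ∀ i → S project i ≼ S X (suc i)
    project-≼-suc i with keep? i
    ... | yes _ = S-suc X i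
    ... | no _  = incl proj₁

    project-≼-H : ∀ {i} → i ≤ b → S project i ≼ H
    project-≼-H {i} i≤b with keep? i
    ... | yes (inj₁ b<i) = contradiction i≤b (ℕ.<⇒≱ b<i)
    ... | yes (inj₂ h)   = h
    ... | no _           = incl proj₂

    project-at : S project b ≃ H
    project-at = project-≼-H ℕ.≤-refl ⇄ ≼-dim-≡ (project-≼-H ℕ.≤-refl) (S-dim project (ℕ.<⇒≤ b<m)) H-dim

  dim-≃ : ∀ {U W : Subspace F m} {i} → U ≼ W → Dim U i → Dim W i → U ≃ W
  dim-≃ f dU dW = f ⇄ ≼-dim-≡ f dU dW

  -- Both W and W′ are U with x adjoined.
  codim-meet : ∀ {U W W′ : Subspace F m} {i x} → Dim U i → Dim W (suc i) → Dim W′ (suc i) → U ≼ W → U ≼ W′ →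
    mem W x → mem W′ x → ¬ mem U x → W ≃ W′
  codim-meet dU dW dW′ U≼W U≼W′ x∈W x∈W′ x∉U =
    dim-≃ (≼-trans (codim-1 U≼W dU dW x∈W x∉U) (adjoin-least x∈W′ U≼W′)) dW dW′

  -- Flags count as equal when their spaces contain each other, which is weaker than propositional
  -- equality. Finiteness therefore enters as a list of representatives: `find` locates a flag in it
  -- and `distinct` excludes repetitions.
  module Geometry (N : ℕ) (fl : Fin N → Flag)
    (find : (X : Flag) → Σ (Fin N) λ j → ∀ i → S X i ≃ S (fl j) i)
    (distinct : ∀ {j k} → (∀ i → S (fl j) i ≃ S (fl k) i) → j ≡ k) where

    V : Fin N → ℕ → Subspace F m
    V j = S (fl j)

    V-dim : ∀ j {i} → i ≤ m → Dim (V j i) i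
    V-dim j = S-dim (fl j)

    V-mono : ∀ j {i i′} → i ≤ i′ → V j i ≼ V j i′
    V-mono j = S-mono (fl j)

    V-suc : ∀ j i → V j i ≼ V j (suc i)
    V-suc j = S-suc (fl j)

    V-≃-≥ : ∀ j k {i} → m ≤ i → V j i ≃ V k i
    V-≃-≥ j k m≤i = incl (λ _ → app (S-top (fl k) m≤i) tt) ⇄ incl (λ _ → app (S-top (fl j) m≤i) tt)

    abstract
      V-≃? : ∀ j k i → Dec (V j i ≃ V k i)
      V-≃? j k i with i ℕ.≤? m
      ... | yes i≤m = ≃? (V-dim j i≤m) (V-dim k i≤m)
      ... | no i≰m  = yes (V-≃-≥ j k (ℕ.<⇒≤ (ℕ.≰⇒> i≰m)))

    -- The flags lie in a common residue, whose free positions are a + 1, ..., b - 1.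
    record Agree (a b : ℕ) (j k : Fin N) : Set where
      constructor agree
      field
        low  : ∀ {i} → i ≤ a → V j i ≃ V k i
        high : ∀ {i} → b ≤ i → V j i ≃ V k i
    open Agree public

    agree-refl : ∀ {a b j} → Agree a b j j
    agree-refl = agree (λ _ → ≃-refl) (λ _ → ≃-refl)

    agree-sym : ∀ {a b j k} → Agree a b j k → Agree a b k j
    agree-sym (agree f g) = agree (≃-sym ∘ f) (≃-sym ∘ g)

    agree-trans : ∀ {a b j k l} → Agree a b j k → Agree a b k l → Agree a b j l
    agree-trans (agree f g) (agree f′ g′) = agree (λ p → ≃-trans (f p) (f′ p)) (λ p → ≃-trans (g p) (g′ p))

    agree-weaken : ∀ {a b a′ b′ j k} → a′ ≤ a → b ≤ b′ → Agree a b j k → Agree a′ b′ j k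
    agree-weaken p q (agree f g) = agree (λ h → f (ℕ.≤-trans h p)) (λ h → g (ℕ.≤-trans q h))

    abstract
      agree-≡ : ∀ {a b j k} → b ≤ suc a → Agree a b j k → j ≡ k
      agree-≡ {a} {b} {j} {k} b≤ (agree f g) = distinct at
        where
        at : ∀ i → V j i ≃ V k i
        at i with i ℕ.≤? a
        ... | yes i≤a = f i≤a
        ... | no i≰a  = g (ℕ.≤-trans b≤ (ℕ.≰⇒> i≰a))

    abstract
      agree? : ∀ a b j k → Dec (Agree a b j k)
      agree? a b j k = map′ build (λ (agree f g) _ → [ f , g ]′)
        (ℕ.allUpTo? (λ i → (i ℕ.≤? a ⊎-dec b ℕ.≤? i) →-dec V-≃? j k i) m)
        where
        build : (∀ {i} → i < m → i ≤ a ⊎ b ≤ i → V j i ≃ V k i) → Agree a b j k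
        build h = agree (λ p → at (inj₁ p)) (λ p → at (inj₂ p))
          where
          at : ∀ {i} → i ≤ a ⊎ b ≤ i → V j i ≃ V k i
          at {i} p with i ℕ.<? m
          ... | yes i<m = h i<m p
          ... | no i≮m  = V-≃-≥ j k (ℕ.≮⇒≥ i≮m)

    -- Adj l allows a change at index l + 1 only.
    record Adj (l : ℕ) (j k : Fin N) : Set where
      constructor adj
      field
        rest : Agree l (suc (suc l)) j k
        diff : ¬ V j (suc l) ≃ V k (suc l)
    open Adj public

    adj-sym : ∀ {l j k} → Adj l j k → Adj l k j
    adj-sym (adj r d) = adj (agree-sym r) (d ∘ ≃-sym)

    abstract
      adj? : ∀ l j k → Dec (Adj l j k)
      adj? l j k = map′ (λ (r , d) → adj r d) (λ (adj r d) → r , d)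
        (agree? l (suc (suc l)) j k ×-dec ¬? (V-≃? j k (suc l)))

    off : ∀ {l i} → i ≢ suc l → i ≤ l ⊎ suc (suc l) ≤ i
    off {l} {i} i≢ with i ℕ.≤? l
    ... | yes i≤l = inj₁ i≤l
    ... | no i≰l  = inj₂ (ℕ.≤∧≢⇒< (ℕ.≰⇒> i≰l) (i≢ ∘ sym))

    abstract
      replace : ∀ j l {U} → Dim U (suc l) → V j l ≼ U → U ≼ V j (suc (suc l)) →
        Σ (Fin N) λ k → Agree l (suc (suc l)) k j × V k (suc l) ≃ U
      replace j l {U} dU lower upper with k , e ← find (Modify.modify (fl j) l U dU lower upper) =
        k , agree (λ {i} i≤l → ≃-trans (≃-sym (e i)) (modify-off (λ { refl → ℕ.1+n≰n i≤l })))
                  (λ {i} i≥ → ≃-trans (≃-sym (e i)) (modify-off (λ { refl → ℕ.1+n≰n i≥ })))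
          , ≃-trans (≃-sym (e (suc l))) modify-at
        where open Modify (fl j) l U dU lower upper

    abstract
      replace-unique : ∀ {l k k′} → Agree l (suc (suc l)) k k′ → V k (suc l) ≃ V k′ (suc l) → k ≡ k′
      replace-unique {l} {k} {k′} (agree f g) e = agree-≡ {a = l} ℕ.≤-refl (agree f high′)
        where
        high′ : ∀ {i} → suc l ≤ i → V k i ≃ V k′ i
        high′ {i} p with i ℕ.≟ suc l
        ... | yes refl = e
        ... | no i≢    = g (ℕ.≤∧≢⇒< p (i≢ ∘ sym))

    Class : ℕ → ℕ → Mat N N
    Class a b = proj₁ (ind-mat (agree? a b))

    class-ind : ∀ a b → Ind (Class a b) (Agree a b)
    class-ind a b = proj₂ (ind-mat (agree? a b))

    T : ℕ → Mat N N
    T l = proj₁ (ind-mat (adj? l))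

    T-ind : ∀ l → Ind (T l) (Adj l)
    T-ind l = proj₂ (ind-mat (adj? l))

    q : ℚ
    q = fromℕ order

    proper : ∀ {U W : Subspace F m} {i} → Dim U i → Dim W (suc i) → ¬ W ≼ U
    proper dU dW h = ℕ.1+n≰n (dim-≤ h dW dU)

    -- Modulo V j l the space V j (l+2) is a plane with basis u, w. Its lines other than V j (l+1),
    -- the one spanned by u, are spanned by a u + w for the q scalars a.
    module Panel (j : Fin N) (l : ℕ) (l+2≤m : suc (suc l) ≤ m) (u w : Vect F m)
      (u∈ : mem (V j (suc l)) u) (u∉ : ¬ mem (V j l) u)
      (w∈ : mem (V j (suc (suc l))) w) (w∉ : ¬ mem (V j (suc l)) w) where
      open Inverse enumeration using (to; from; strictlyInverseˡ)

      dim₀ : Dim (V j l) l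
      dim₀ = V-dim j (ℕ.≤-trans (ℕ.n≤1+n l) (ℕ.<⇒≤ l+2≤m))
      dim₁ : Dim (V j (suc l)) (suc l)
      dim₁ = V-dim j (ℕ.<⇒≤ l+2≤m)
      dim₂ : Dim (V j (suc (suc l))) (suc (suc l))
      dim₂ = V-dim j l+2≤m

      v : Carrier → Vect F m
      v a k = a ⊗ u k ⊕ w k

      v∉ : ∀ a → ¬ mem (V j (suc l)) (v a)
      v∉ a h = w∉ (mem-sub (V j (suc l)) (λ _ → refl) h (mem-* (V j (suc l)) a u∈))

      v∈ : ∀ a → mem (V j (suc (suc l))) (v a)
      v∈ a = mem-+ (V j (suc (suc l))) (mem-* (V j (suc (suc l))) a (app (V-suc j (suc l)) u∈)) w∈

      Y : Carrier → Subspace F m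
      Y a = adjoin (v a) (V j l)

      abstract
        Y-dim : ∀ a → Dim (Y a) (suc l)
        Y-dim a = adjoin-dim (v∉ a ∘ app (V-suc j l)) dim₀

      lower : ∀ a → V j l ≼ Y a
      lower a = sumS-ʳ (line (v a)) (V j l)

      abstract
        neighbour : ∀ a → Σ (Fin N) λ k → Agree l (suc (suc l)) k j × V k (suc l) ≃ Y a
        neighbour a = replace j l (Y-dim a) (lower a)
          (adjoin-least (v∈ a) (V-mono j (ℕ.≤-trans (ℕ.n≤1+n l) (ℕ.n≤1+n (suc l)))))

      abstract
        Y-injective : ∀ a b → Y a ≃ Y b → a ≡ b
        Y-injective a b Ya≃Yb with (a ⊕ ⊖ b) ≟F 0#
        ... | yes e = RP.x∙y⁻¹≈ε⇒x≈y a b e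
        ... | no a-b≢0 = contradiction (app (≼-dim-≡ (adjoin-least u∈Yb (lower b)) (adjoin-dim u∉ dim₀) (Y-dim b)) (adjoin-self (v b) (V j l)))
                (v∉ b ∘ app (adjoin-least u∈ (V-suc j l)))
          where
          difference : ∀ k → v a k ⊕ ⊖ v b k ≡ (a ⊕ ⊖ b) ⊗ u k
          difference k = begin
            (a ⊗ u k ⊕ w k) ⊕ ⊖ (b ⊗ u k ⊕ w k) ≡⟨ cong (v a k ⊕_) (sym (RP.-‿+-comm (b ⊗ u k) (w k))) ⟩
            (a ⊗ u k ⊕ w k) ⊕ (⊖ (b ⊗ u k) ⊕ ⊖ w k) ≡⟨ +-interchange (a ⊗ u k) (w k) (⊖ (b ⊗ u k)) (⊖ w k) ⟩
            (a ⊗ u k ⊕ ⊖ (b ⊗ u k)) ⊕ (w k ⊕ ⊖ w k) ≡⟨ cong₂ _⊕_ (cong (a ⊗ u k ⊕_) (RP.-‿distribˡ-* b (u k))) (R.-‿inverseʳ (w k)) ⟩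
            (a ⊗ u k ⊕ ⊖ b ⊗ u k) ⊕ 0# ≡⟨ R.+-identityʳ _ ⟩
            a ⊗ u k ⊕ ⊖ b ⊗ u k ≡⟨ sym (R.distribʳ (u k) a (⊖ b)) ⟩
            (a ⊕ ⊖ b) ⊗ u k ∎
            where open ≡-Reasoning
          u∈Yb : mem (Y b) u
          u∈Yb = mem-div (Y b) a-b≢0 (mem-resp (Y b) difference
            (mem-+ (Y b) (app (fwd Ya≃Yb) (adjoin-self (v a) (V j l))) (mem-neg (Y b) (adjoin-self (v b) (V j l)))))

      abstract
        Y-onto : ∀ {U} → Dim U (suc l) → V j l ≼ U → U ≼ V j (suc (suc l)) → ¬ U ≃ V j (suc l) → Σ Carrier λ a → Y a ≃ U
        Y-onto {U} dU low up ne with y , y∈U , y∉ ← ∉-exists dim₁ dU (λ h → ne (dim-≃ h dU dim₁))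
          with cw , x , (c , cw-eq) , x∈ , y-eq ← app (codim-1 (V-suc j (suc l)) dim₁ dim₂ w∈ w∉) (app up y∈U)
          with du , x₀ , (d , du-eq) , x₀∈ , x-eq ← app (codim-1 (V-suc j l) dim₀ dim₁ u∈ u∉) x∈
          with c ≟F 0#
        ... | yes refl = contradiction (mem-resp (V j (suc l)) (λ k → sym (trans (y-eq k)
                (trans (cong (_⊕ x k) (trans (cw-eq k) (R.zeroˡ (w k)))) (R.+-identityˡ (x k))))) x∈) y∉
        ... | no c≢0 with c⁻¹ , cc⁻¹ ← inverse c c≢0 = a , dim-≃ (adjoin-least va∈U low) (Y-dim a) dU
          where
          a : Carrier
          a = c⁻¹ ⊗ d
          y-form : ∀ k → y k ≡ x₀ k ⊕ c ⊗ v a k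
          y-form k = begin
            y k ≡⟨ y-eq k ⟩
            cw k ⊕ x k ≡⟨ cong₂ _⊕_ (cw-eq k) (trans (x-eq k) (trans (cong (_⊕ x₀ k) (du-eq k)) (R.+-comm (d ⊗ u k) (x₀ k)))) ⟩
            c ⊗ w k ⊕ (x₀ k ⊕ d ⊗ u k) ≡⟨ R.+-comm (c ⊗ w k) (x₀ k ⊕ d ⊗ u k) ⟩
            (x₀ k ⊕ d ⊗ u k) ⊕ c ⊗ w k ≡⟨ R.+-assoc (x₀ k) (d ⊗ u k) (c ⊗ w k) ⟩
            x₀ k ⊕ (d ⊗ u k ⊕ c ⊗ w k) ≡⟨ cong (λ e → x₀ k ⊕ (e ⊗ u k ⊕ c ⊗ w k)) (sym (trans (sym (R.*-assoc c c⁻¹ d)) (trans (cong (_⊗ d) cc⁻¹) (R.*-identityˡ d)))) ⟩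
            x₀ k ⊕ (c ⊗ a ⊗ u k ⊕ c ⊗ w k) ≡⟨ cong (λ e → x₀ k ⊕ (e ⊕ c ⊗ w k)) (R.*-assoc c a (u k)) ⟩
            x₀ k ⊕ (c ⊗ (a ⊗ u k) ⊕ c ⊗ w k) ≡⟨ cong (x₀ k ⊕_) (sym (R.distribˡ c (a ⊗ u k) (w k))) ⟩
            x₀ k ⊕ c ⊗ v a k ∎
            where open ≡-Reasoning
          va∈U : mem U (v a)
          va∈U = mem-div U c≢0 (mem-sub U y-form y∈U (app low x₀∈))

      row-sum : sumℚ (T l j) ≡ q
      row-sum = row-count (T-ind l) j f inj into onto
        where
        f : Fin order → Fin N
        f t = proj₁ (neighbour (to t))
        inj : ∀ s t → f s ≡ f t → s ≡ t
        inj s t e = to-injective (Y-injective (to s) (to t) (≃-trans (≃-sym (proj₂ (proj₂ (neighbour (to s)))))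
          (subst (λ k → V k (suc l) ≃ Y (to t)) (sym e) (proj₂ (proj₂ (neighbour (to t)))))))
        into : ∀ t → Adj l j (f t)
        into t = adj (agree-sym (proj₁ (proj₂ (neighbour (to t)))))
          (λ d → v∉ (to t) (app (bwd (≃-trans d (proj₂ (proj₂ (neighbour (to t)))))) (adjoin-self (v (to t)) (V j l))))
        onto : ∀ k → Adj l j k → Σ (Fin order) λ t → f t ≡ k
        onto k (adj ag d) with a , e ← Y-onto (V-dim k (ℕ.<⇒≤ l+2≤m))
            (≼-trans (fwd (low ag ℕ.≤-refl)) (V-suc k l)) (≼-trans (V-suc k (suc l)) (bwd (high ag ℕ.≤-refl))) (d ∘ ≃-sym) =
          from a , replace-unique (agree-trans (proj₁ (proj₂ (neighbour (to (from a))))) ag)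
            (≃-trans (proj₂ (proj₂ (neighbour (to (from a))))) (subst (λ b → Y b ≃ V k (suc l)) (sym (strictlyInverseˡ a)) e))

    abstract
      panel-size : ∀ {l} → suc (suc l) ≤ m → ∀ j → sumℚ (T l j) ≡ q
      panel-size {l} l+2≤m j
        with u , u∈ , u∉ ← ∉-exists (V-dim j (ℕ.≤-trans (ℕ.n≤1+n l) (ℕ.<⇒≤ l+2≤m))) (V-dim j (ℕ.<⇒≤ l+2≤m))
               (proper (V-dim j (ℕ.≤-trans (ℕ.n≤1+n l) (ℕ.<⇒≤ l+2≤m))) (V-dim j (ℕ.<⇒≤ l+2≤m)))
           | w , w∈ , w∉ ← ∉-exists (V-dim j (ℕ.<⇒≤ l+2≤m)) (V-dim j l+2≤m) (proper (V-dim j (ℕ.<⇒≤ l+2≤m)) (V-dim j l+2≤m))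
        = Panel.row-sum j l l+2≤m u w u∈ u∉ w∈ w∉

    -- The trace of a step in position l + 1 followed by free changes in positions a + 1, ..., l.
    -- Outside the indices a + 1, ..., l + 1 the flags agree, and inside only j_l and k_{l+1} stay
    -- linked.
    record Incident (a l : ℕ) (j k : Fin N) : Set where
      constructor incident
      field
        outer : Agree a (suc (suc l)) j k
        below : V j l ≼ V k (suc l)
        apart : ¬ V j (suc l) ≃ V k (suc l)

    -- The intermediate flag is forced: it is j with the space at index l + 1 replaced by that of k.
    T-class : ∀ {a l} → a ≤ l → suc (suc l) ≤ m → Ind (T l ⊡ Class a (suc l)) (Incident a l)
    T-class {a} {l} a≤l l+2≤m = ind-⊡ (T-ind l) (class-ind a (suc l)) to from
      where
      to : ∀ {j w k} → Adj l j w → Agree a (suc l) w k → Incident a l j k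
      to {j} {w} {k} (adj r d) e = incident
        (agree-trans (agree-weaken a≤l ℕ.≤-refl r) (agree-weaken ℕ.≤-refl (ℕ.n≤1+n (suc l)) e))
        (≼-trans (fwd (low r ℕ.≤-refl)) (≼-trans (V-suc w l) (fwd (high e ℕ.≤-refl))))
        (λ h → d (≃-trans h (≃-sym (high e ℕ.≤-refl))))
      from : ∀ {j k} → Incident a l j k → Σ (Fin N) λ w → Adj l j w × Agree a (suc l) w k ×
        (∀ w′ → Adj l j w′ → Agree a (suc l) w′ k → w′ ≡ w)
      from {j} {k} (incident o b d) with w , r , e ← replace j l (V-dim k (ℕ.<⇒≤ l+2≤m)) b
          (≼-trans (V-suc k (suc l)) (bwd (high o ℕ.≤-refl))) =
        w , adj (agree-sym r) (λ h → d (≃-trans h e)) ,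
        agree (λ p → ≃-trans (low r (ℕ.≤-trans p a≤l)) (low o p)) high′ ,
        λ w′ (adj r′ _) e′ → sym (replace-unique (agree-trans r r′) (≃-trans e (≃-sym (high e′ ℕ.≤-refl))))
        where
        high′ : ∀ {i} → suc l ≤ i → V w i ≃ V k i
        high′ {i} p with i ℕ.≟ suc l
        ... | yes refl = e
        ... | no i≢    = ≃-trans (high r (ℕ.≤∧≢⇒< p (i≢ ∘ sym))) (high o (ℕ.≤∧≢⇒< p (i≢ ∘ sym)))

    -- Weyl distance s_{a+1} s_{a+2} ⋯ s_{a+d}: the flag k is j shifted by one and intersected with the
    -- hyperplane k_{a+d} of j_{a+d+1}, which must not contain j_{a+1}.
    record Gallery (a d : ℕ) (j k : Fin N) : Set where
      constructor gallery
      field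
        outer : Agree a (suc (d ℕ.+ a)) j k
        shift : ∀ i → V k i ≼ V j (suc i)
        avoid : ¬ V j (suc a) ≼ V k (d ℕ.+ a)

    c : ℕ → ℕ → Mat N N
    c a zero    = identity
    c a (suc d) = c a d ⊡ T (d ℕ.+ a)

    -- The last flag but one is forced: it is z with the space at index d + a + 1 reset to that of
    -- x. The condition `avoid` ensures that each step really changes the space.
    c-ind : ∀ a d → suc (d ℕ.+ a) ≤ m → Ind (c a d) (Gallery a d)
    c-ind a zero a<m = ind-⇔ ind-identity
      (λ { {j} refl → gallery agree-refl (V-suc j) (proper (V-dim j (ℕ.<⇒≤ a<m)) (V-dim j a<m)) })
      (λ (gallery o _ _) → agree-≡ ℕ.≤-refl o)
    c-ind a (suc d) l+2≤m = ind-⊡ (c-ind a d (ℕ.<⇒≤ l+2≤m)) (T-ind l) to from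
      where
      l = d ℕ.+ a
      a≤l : a ≤ l
      a≤l = ℕ.m≤n+m a d
      l+1≤m = ℕ.<⇒≤ l+2≤m
      l≤m = ℕ.<⇒≤ l+1≤m
      to : ∀ {x w z} → Gallery a d x w → Adj l w z → Gallery a (suc d) x z
      to {x} {w} {z} (gallery o s v) (adj r n) = gallery
        (agree-trans (agree-weaken ℕ.≤-refl (ℕ.n≤1+n (suc l)) o) (agree-weaken a≤l ℕ.≤-refl r)) shift′ avoid′
        where
        shift′ : ∀ i → V z i ≼ V x (suc i)
        shift′ i with i ℕ.≟ suc l
        ... | yes refl = ≼-trans (V-suc z (suc l)) (≼-trans (bwd (high r ℕ.≤-refl)) (bwd (high o (ℕ.n≤1+n (suc l)))))
        ... | no i≢ with off i≢
        ...   | inj₁ p = ≼-trans (bwd (low r p)) (s i)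
        ...   | inj₂ p = ≼-trans (bwd (high r p)) (s i)
        avoid′ : ¬ V x (suc a) ≼ V z (suc l)
        -- A vector y of x_{a+1} outside w_l would lie in both w_{l+1} and z_{l+1}. These contain
        -- w_l as a hyperplane, so they would coincide.
        avoid′ h with y , y∈ , y∉ ← ∉-exists (V-dim w l≤m) (V-dim x (ℕ.≤-trans (s≤s a≤l) l+1≤m)) v =
          n (codim-meet (V-dim w l≤m) (V-dim w l+1≤m) (V-dim z l+1≤m) (V-suc w l)
               (≼-trans (fwd (low r ℕ.≤-refl)) (V-suc z l))
               (app (≼-trans (V-mono x (s≤s a≤l)) (fwd (high o ℕ.≤-refl))) y∈) (app h y∈) y∉)
      from : ∀ {x z} → Gallery a (suc d) x z → Σ (Fin N) λ w → Gallery a d x w × Adj l w z ×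
        (∀ w′ → Gallery a d x w′ → Adj l w′ z → w′ ≡ w)
      from {x} {z} (gallery o s v) with w , r , e ← replace z l (V-dim x l+1≤m) (s l)
          (≼-trans (V-suc x (suc l)) (fwd (high o ℕ.≤-refl))) =
        w , gallery (agree (λ p → ≃-trans (low o p) (≃-sym (low r (ℕ.≤-trans p a≤l)))) high′) shift′
              (λ h → v (≼-trans h (≼-trans (fwd (low r ℕ.≤-refl)) (V-suc z l)))) ,
        adj r (λ h → v (≼-trans (V-mono x (s≤s a≤l)) (≼-trans (bwd e) (fwd h)))) ,
        λ w′ (gallery o′ _ _) (adj r′ _) → sym (replace-unique (agree-trans r (agree-sym r′)) (≃-trans e (high o′ ℕ.≤-refl)))
        where
        high′ : ∀ {i} → suc l ≤ i → V x i ≃ V w i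
        high′ {i} p with i ℕ.≟ suc l
        ... | yes refl = ≃-sym e
        ... | no i≢    = ≃-trans (high o (ℕ.≤∧≢⇒< p (i≢ ∘ sym))) (≃-sym (high r (ℕ.≤∧≢⇒< p (i≢ ∘ sym))))
        shift′ : ∀ i → V w i ≼ V x (suc i)
        shift′ i with i ℕ.≟ suc l
        ... | yes refl = ≼-trans (fwd e) (V-suc x (suc l))
        ... | no i≢ with off i≢
        ...   | inj₁ p = ≼-trans (fwd (low r p)) (s i)
        ...   | inj₂ p = ≼-trans (fwd (high r p)) (s i)

    -- Opposition in the residue fixing all indices outside a + 1, …, a + d.
    record Opp (a d : ℕ) (j k : Fin N) : Set where
      constructor opp
      field
        outer : Agree a (suc (d ℕ.+ a)) j k
        meet  : ∀ i i′ → i ℕ.+ i′ ≡ suc (d ℕ.+ a) ℕ.+ a → ∀ {x} → mem (V j i) x → mem (V k i′) x → mem (V j a) x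

    opp-sym : ∀ {a d j k} → Opp a d j k → Opp a d k j
    opp-sym {a} (opp o h) = opp (agree-sym o) λ i i′ e x∈ x∈′ → app (fwd (low o ℕ.≤-refl)) (h i′ i (trans (ℕ.+-comm i′ i) e) x∈′ x∈)

    A : ℕ → ℕ → Mat N N
    A a zero    = identity
    A a (suc d) = c a (suc d) ⊡ A a d

    -- The longest word in d + 1 positions is a gallery of length d + 1 followed by the longest word
    -- in the first d of them. The intermediate flag is x cut by the hyperplane y_b (`Project`), and
    -- `meet-suc` shows that it is forced.
    A-ind : ∀ a d → suc (d ℕ.+ a) ≤ m → Ind (A a d) (Opp a d)
    A-ind a zero a<m = ind-⇔ ind-identity
      (λ { {j} refl → opp agree-refl (self j) }) (λ (opp o _) → agree-≡ ℕ.≤-refl o)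
      where
      self : ∀ j i i′ → i ℕ.+ i′ ≡ suc a ℕ.+ a → ∀ {x} → mem (V j i) x → mem (V j i′) x → mem (V j a) x
      self j i i′ e x∈ x∈′ with i ℕ.≤? a
      ... | yes i≤a = app (V-mono j i≤a) x∈
      ... | no i≰a  = app (V-mono j (ℕ.+-cancelˡ-≤ (suc a) i′ a (ℕ.≤-trans (ℕ.+-monoˡ-≤ i′ (ℕ.≰⇒> i≰a)) (ℕ.≤-reflexive e)))) x∈′
    A-ind a (suc d) b+1≤m = ind-⊡ (c-ind a (suc d) b+1≤m) (A-ind a d (ℕ.<⇒≤ b+1≤m)) to from
      where
      b = suc (d ℕ.+ a)
      b≤m = ℕ.<⇒≤ b+1≤m
      a≤b : a ≤ b
      a≤b = ℕ.m≤n+m a (suc d)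
      -- Otherwise x_{i+1} would be z_i with y adjoined and hence lie in z_b, although z_b does not
      -- even contain x_{a+1}. So x_{i+1} ∩ z_b is z_i.
      meet-suc : ∀ {x z i y} → Gallery a (suc d) x z → a ≤ i → i ≤ b → mem (V x (suc i)) y → mem (V z b) y → mem (V z i) y
      meet-suc {x} {z} {i} {y} (gallery _ s v) a≤i i≤b y∈ y∈′ with mem? (V-dim z (ℕ.≤-trans i≤b b≤m)) y
      ... | yes p = p
      ... | no y∉ = contradiction (≼-trans (V-mono x (s≤s a≤i)) (≼-trans
              (codim-1 (s i) (V-dim z (ℕ.≤-trans i≤b b≤m)) (V-dim x (ℕ.≤-trans (s≤s i≤b) b+1≤m)) y∈ y∉)
              (adjoin-least y∈′ (V-mono z i≤b)))) v
      to : ∀ {x z y} → Gallery a (suc d) x z → Opp a d z y → Opp a (suc d) x y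
      to {x} {z} {y} g@(gallery o s v) (opp o′ h) = opp (agree-trans o (agree-weaken ℕ.≤-refl (ℕ.n≤1+n b) o′)) meet′
        where
        meet′ : ∀ i i′ → i ℕ.+ i′ ≡ suc b ℕ.+ a → ∀ {u} → mem (V x i) u → mem (V y i′) u → mem (V x a) u
        meet′ i i′ e u∈ u∈′ with i ℕ.≤? a | i′ ℕ.≤? a
        ... | yes i≤a | _ = app (V-mono x i≤a) u∈
        ... | no _ | yes i′≤a = app (bwd (low (agree-trans o (agree-weaken ℕ.≤-refl (ℕ.n≤1+n b) o′)) ℕ.≤-refl)) (app (V-mono y i′≤a) u∈′)
        meet′ zero i′ e u∈ u∈′ | no i≰a | no _ = contradiction z≤n i≰a
        meet′ (suc i) i′ e u∈ u∈′ | no i≰a | no i′≰a = app (bwd (low o ℕ.≤-refl))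
          (h i i′ (ℕ.suc-injective e) (meet-suc g (ℕ.≤-pred (ℕ.≰⇒> i≰a)) i≤b u∈ u∈b) u∈′)
          where
          i≤b : i ≤ b
          i≤b = ℕ.+-cancelʳ-≤ a i b (ℕ.≤-trans (ℕ.+-monoʳ-≤ i (ℕ.<⇒≤ (ℕ.≰⇒> i′≰a))) (ℕ.≤-reflexive (ℕ.suc-injective e)))
          i′≤b : i′ ≤ b
          i′≤b = ℕ.+-cancelˡ-≤ a i′ b (ℕ.≤-trans (ℕ.+-monoˡ-≤ i′ (ℕ.≤-pred (ℕ.≰⇒> i≰a))) (ℕ.≤-reflexive (trans (ℕ.suc-injective e) (ℕ.+-comm b a))))
          u∈b : mem (V z b) _
          u∈b = app (bwd (high o′ ℕ.≤-refl)) (app (V-mono y i′≤b) u∈′)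
      from : ∀ {x y} → Opp a (suc d) x y → Σ (Fin N) λ z → Gallery a (suc d) x z × Opp a d z y ×
        (∀ z′ → Gallery a (suc d) x z′ → Opp a d z′ y → z′ ≡ z)
      from {x} {y} (opp o h) = w , gz , oz , unique
        where
        open Project (fl x) b b+1≤m (V y b) (V-dim y b≤m) (≼-trans (V-suc y b) (bwd (high o ℕ.≤-refl)))
        w : Fin N
        w = proj₁ (find project)
        spec : ∀ i → S project i ≃ V w i
        spec = proj₂ (find project)
        lowz : ∀ {i} → i ≤ a → V x i ≃ V w i
        lowz p = ≃-trans (≃-sym (project-keep (inj₂ (≼-trans (fwd (low o p)) (V-mono y (ℕ.≤-trans p a≤b)))))) (spec _)
        highz : ∀ {i} → suc b ≤ i → V x i ≃ V w i
        highz p = ≃-trans (≃-sym (project-keep (inj₁ p))) (spec _)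
        atz : V w b ≃ V y b
        atz = ≃-trans (≃-sym (spec b)) project-at
        shiftz : ∀ i → V w i ≼ V x (suc i)
        shiftz i = ≼-trans (bwd (spec i)) (project-≼-suc i)
        avoidz : ¬ V x (suc a) ≼ V w b
        avoidz k with u , u∈ , u∉ ← ∉-exists (V-dim x (ℕ.≤-trans a≤b b≤m)) (V-dim x (ℕ.≤-trans (s≤s a≤b) b+1≤m))
              (proper (V-dim x (ℕ.≤-trans a≤b b≤m)) (V-dim x (ℕ.≤-trans (s≤s a≤b) b+1≤m))) =
          u∉ (h (suc a) b (cong suc (ℕ.+-comm a b)) u∈ (app (≼-trans k (fwd atz)) u∈))
        gz : Gallery a (suc d) x w
        gz = gallery (agree lowz highz) shiftz avoidz
        highzy : ∀ {i} → b ≤ i → V w i ≃ V y i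
        highzy {i} p with b ℕ.≟ i
        ... | yes refl = atz
        ... | no b≢i   = ≃-trans (≃-sym (highz (ℕ.≤∧≢⇒< p b≢i))) (high o (ℕ.≤∧≢⇒< p b≢i))
        oz : Opp a d w y
        oz = opp (agree (λ p → ≃-trans (≃-sym (lowz p)) (low o p)) highzy)
               (λ i i′ e u∈ u∈′ → app (fwd (lowz ℕ.≤-refl)) (h (suc i) i′ (cong suc e) (app (shiftz i) u∈) u∈′))
        unique : ∀ z′ → Gallery a (suc d) x z′ → Opp a d z′ y → z′ ≡ w
        unique z′ g′@(gallery o₁ s₁ _) (opp o₂ _) = distinct at
          where
          at : ∀ i → V z′ i ≃ V w i
          at i with i ℕ.≤? a | b ℕ.≤? i
          ... | yes p | _     = ≃-trans (≃-sym (low o₁ p)) (lowz p)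
          ... | no _  | yes p = ≃-trans (high o₂ p) (≃-sym (highzy p))
          ... | no i≰a | no b≰i = dim-≃ (incl λ u∈ → meet-suc gz a≤i i≤b (app (s₁ i) u∈)
                  (app (≼-trans (V-mono z′ i≤b) (≼-trans (fwd (high o₂ ℕ.≤-refl)) (bwd atz))) u∈))
                  (V-dim z′ (ℕ.≤-trans i≤b b≤m)) (V-dim w (ℕ.≤-trans i≤b b≤m))
            where
            a≤i = ℕ.<⇒≤ (ℕ.≰⇒> i≰a)
            i≤b = ℕ.<⇒≤ (ℕ.≰⇒> b≰i)

-- Row sums and the Hecke algebra relations.

module Counting (F : FiniteField) (m : ℕ) (N : ℕ) (fl : Fin N → Flags.Flag F m)
  (find : (X : Flags.Flag F m) → Σ (Fin N) λ j → ∀ i → Flags._≃_ F m (Flags.S X i) (Flags.S (fl j) i))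
  (distinct : ∀ {j k} → (∀ i → Flags._≃_ F m (Flags.S (fl j) i) (Flags.S (fl k) i)) → j ≡ k) where
  open import Data.Rational using (_+_; _*_; _-_; -_)
  open Flags F m
  open Geometry N fl find distinct
  open FiniteField F using (order)

  0<order : 0 < order
  0<order = ℕ.<-trans (s≤s z≤n) 2≤order

  1≤q : 1ℚ ℚ.≤ q
  1≤q = fromℕ-mono 0<order

  br zq : ℕ → ℚ
  br l = fromℕ (qint (suc l) order)
  zq d = fromℕ (z d order)

  br-suc : ∀ l → br (suc l) ≡ q * br l + 1ℚ
  br-suc l = trans (cong fromℕ (nat l)) (trans (fromℕ-+ (order ℕ.* qint (suc l) order) 1) (cong (_+ 1ℚ) (fromℕ-* order (qint (suc l) order))))
    where
    nat : ∀ l → qint (suc (suc l)) order ≡ order ℕ.* qint (suc l) order ℕ.+ 1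
    nat zero    = trans (cong (λ e → e ℕ.+ 1) (ℕ.*-identityʳ order)) (cong (ℕ._+ 1) (sym (ℕ.*-identityʳ order)))
    nat (suc l) = begin
      order ℕ.* order ℕ.^ suc l ℕ.+ qint (suc (suc l)) order ≡⟨ cong (order ℕ.* order ℕ.^ suc l ℕ.+_) (nat l) ⟩
      order ℕ.* order ℕ.^ suc l ℕ.+ (order ℕ.* qint (suc l) order ℕ.+ 1) ≡⟨ sym (ℕ.+-assoc (order ℕ.* order ℕ.^ suc l) _ 1) ⟩
      order ℕ.* order ℕ.^ suc l ℕ.+ order ℕ.* qint (suc l) order ℕ.+ 1 ≡⟨ cong (ℕ._+ 1) (sym (ℕ.*-distribˡ-+ order (order ℕ.^ suc l) (qint (suc l) order))) ⟩
      order ℕ.* qint (suc (suc l)) order ℕ.+ 1 ∎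
      where open ≡-Reasoning

  zq-suc : ∀ d → zq (suc d) ≡ br d * zq d
  zq-suc d = fromℕ-* (qint (suc d) order) (z d order)

  0<q : 0ℚ ℚ.< q
  0<q = ℚ.<-≤-trans 0<1 1≤q

  0<br : ∀ l → 0ℚ ℚ.< br l
  0<br zero    = 0<1
  0<br (suc l) = subst (0ℚ ℚ.<_) (sym (br-suc l)) (ℚ.+-mono-< (0<-* 0<q (0<br l)) 0<1)

  0<zq : ∀ d → 0ℚ ℚ.< zq d
  0<zq zero    = 0<1
  0<zq (suc d) = subst (0ℚ ℚ.<_) (sym (zq-suc d)) (0<-* (0<br d) (0<zq d))

  module FlagCount (a l : ℕ) (a≤l : a ≤ l) (l+2≤m : suc (suc l) ≤ m) {r : ℚ} (row : ∀ w → sumℚ (Class a l w) ≡ r) where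

    private
      E⁺ E : Mat N N
      E⁺ = Class a (suc (suc l))
      E  = Class a (suc l)
      TE : Mat N N
      TE = T l ⊡ E
      indTE : Ind TE (Incident a l)
      indTE = T-class a≤l l+2≤m

    vanish : ∀ j k → (∀ w → Agree a (suc l) j w → ¬ Incident a l w k) → (E ⊡ TE) j k ≡ 0ℚ
    vanish j k none = sum-0 term
      where
      term : ∀ w → E j w * TE w k ≡ 0ℚ
      term w with ind-× (class-ind a (suc l) j w) (indTE w k)
      ... | inj₁ ((p , i) , _) = contradiction i (none w p)
      ... | inj₂ (_ , e)       = e

    -- The flags w to be counted are those sharing index l with the projection w₀ of k to V j (l + 1).
    populated : ∀ {j k} → Agree a (suc (suc l)) j k → ¬ V j (suc l) ≃ V k (suc l) → (E ⊡ TE) j k ≡ r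
    populated {j} {k} o d = trans (sum-cong term) (row w₀)
      where
      l+1≤m = ℕ.<⇒≤ l+2≤m
      l≤m = ℕ.<⇒≤ l+1≤m
      open Project (fl k) (suc l) l+2≤m (V j (suc l)) (V-dim j l+1≤m) (≼-trans (V-suc j (suc l)) (fwd (high o ℕ.≤-refl)))
      w₀ : Fin N
      w₀ = proj₁ (find project)
      spec : ∀ i → S project i ≃ V w₀ i
      spec = proj₂ (find project)
      w₀-low : ∀ {i} → i ≤ a → V w₀ i ≃ V j i
      w₀-low p = ≃-trans (≃-trans (≃-sym (spec _)) (project-keep
        (inj₂ (≼-trans (bwd (low o p)) (V-mono j (ℕ.≤-trans p (ℕ.≤-trans a≤l (ℕ.n≤1+n l)))))))) (≃-sym (low o p))
      w₀-high : ∀ {i} → suc l ≤ i → V w₀ i ≃ V j i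
      w₀-high {i} p with suc l ℕ.≟ i
      ... | yes refl = ≃-trans (≃-sym (spec _)) project-at
      ... | no ne    = ≃-trans (≃-trans (≃-sym (spec _)) (project-keep (inj₁ (ℕ.≤∧≢⇒< p ne)))) (≃-sym (high o (ℕ.≤∧≢⇒< p ne)))
      w₀-l : V w₀ l ≼ V k (suc l)
      w₀-l = ≼-trans (bwd (spec l)) (project-≼-suc l)
      to : ∀ {w} → Agree a (suc l) j w × Incident a l w k → Agree a l w₀ w
      to {w} (p , incident _ b _) = agree (λ q → ≃-trans (w₀-low q) (low p q)) high′
        where
        at-l : ∀ {x} → mem (V w l) x → mem (V w₀ l) x
        at-l {x} x∈ with mem? (V-dim w₀ l≤m) x
        ... | yes x∈w₀ = x∈w₀
        ... | no x∉ = contradiction (codim-meet (V-dim w₀ l≤m) (V-dim j l+1≤m) (V-dim k l+1≤m)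
                (≼-trans (V-suc w₀ l) (fwd (w₀-high ℕ.≤-refl))) w₀-l
                (app (≼-trans (V-suc w l) (bwd (high p ℕ.≤-refl))) x∈) (app b x∈) x∉) d
        high′ : ∀ {i} → l ≤ i → V w₀ i ≃ V w i
        high′ {i} q with l ℕ.≟ i
        ... | yes refl = ≃-sym (dim-≃ (incl at-l) (V-dim w l≤m) (V-dim w₀ l≤m))
        ... | no ne    = ≃-trans (w₀-high (ℕ.≤∧≢⇒< q ne)) (high p (ℕ.≤∧≢⇒< q ne))
      from : ∀ {w} → Agree a l w₀ w → Agree a (suc l) j w × Incident a l w k
      from {w} p = jw , incident (agree-trans (agree-sym (agree-weaken ℕ.≤-refl (ℕ.n≤1+n (suc l)) jw)) o)
          (≼-trans (bwd (high p ℕ.≤-refl)) w₀-l) (λ h → d (≃-trans (high jw ℕ.≤-refl) h))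
        where
        jw : Agree a (suc l) j w
        jw = agree (λ q → ≃-trans (≃-sym (w₀-low q)) (low p q)) (λ q → ≃-trans (≃-sym (w₀-high q)) (high p (ℕ.≤-trans (ℕ.n≤1+n l) q)))
      term : ∀ w → E j w * TE w k ≡ Class a l w₀ w
      term w = ind-unique {M = 1} {A = λ _ w → E j w * TE w k} {R = λ _ w → Agree a (suc l) j w × Incident a l w k}
        (λ _ w → ind-× (class-ind a (suc l) j w) (indTE w k)) {B = λ _ w → Class a l w₀ w} {S = λ _ w → Agree a l w₀ w}
        (λ _ w → class-ind a l w₀ w) to from zero w

    private
      zero-diff : ∀ {x y} (r : ℚ) → x ≡ 0ℚ → y ≡ 0ℚ → 0ℚ ≡ r * (x - y)
      zero-diff r refl refl = sym (*-zeroʳ r)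
      one-diff : ∀ {x y} (r : ℚ) → x ≡ 1ℚ → y ≡ 1ℚ → 0ℚ ≡ r * (x - y)
      one-diff r refl refl = sym (*-zeroʳ r)
      full-diff : ∀ {x y} (r : ℚ) → x ≡ 1ℚ → y ≡ 0ℚ → r ≡ r * (x - y)
      full-diff r refl refl = sym (*-identityʳ r)

    -- A flag w sharing index l + 1 with j can be incident with k only if j and k differ at that
    -- index inside one class of E⁺, and then there are r such w. Summed over k this counts flags;
    -- normalised it is the relation for P T P.
    flag-count : ∀ j k → (E ⊡ TE) j k ≡ r * (E⁺ j k - E j k)
    flag-count j k with class-ind a (suc (suc l)) j k | V-≃? j k (suc l)
    ... | inj₂ (n , e) | _ = trans (vanish j k (λ w p i → n (agree-trans (agree-weaken ℕ.≤-refl (ℕ.n≤1+n (suc l)) p) (Incident.outer i))))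
            (zero-diff r e (ind-0 (class-ind a (suc l)) (n ∘ agree-weaken ℕ.≤-refl (ℕ.n≤1+n (suc l)))))
    ... | inj₁ (o , e) | yes h = trans (vanish j k (λ w p i → Incident.apart i (≃-trans (≃-sym (high p ℕ.≤-refl)) h)))
            (one-diff r e (ind-1 (class-ind a (suc l)) (agree (low o) high′)))
      where
      high′ : ∀ {i} → suc l ≤ i → V j i ≃ V k i
      high′ {i} p with suc l ℕ.≟ i
      ... | yes refl = h
      ... | no ne    = high o (ℕ.≤∧≢⇒< p ne)
    ... | inj₁ (o , e) | no d = trans (populated o d)
            (full-diff r e (ind-0 (class-ind a (suc l)) (λ p → d (high p ℕ.≤-refl))))

  class-trivial : ∀ {a b} → b ≤ suc a → ∀ j → sumℚ (Class a b j) ≡ 1ℚ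
  class-trivial {a} {b} b≤ j = trans (sum-cong (λ k → ind-unique (class-ind a b) ind-identity (agree-≡ b≤) (λ { refl → agree-refl }) j k)) (row-identity j)

  -- Taking row sums in E T E = z₀ (E⁺ - E) gives z₁ q z₁ = z₀ (R⁺ - z₁). As z₁ = [d+1] z₀, this
  -- yields R⁺ = (q [d+1] + 1) z₁ = [d+2] z₁. Both preceding sizes occur, hence the two-step
  -- recursion.
  class-size-step : ∀ a d → suc (suc (d ℕ.+ a)) ≤ m → (∀ j → sumℚ (Class a (d ℕ.+ a) j) ≡ zq d) →
    (∀ j → sumℚ (Class a (suc (d ℕ.+ a)) j) ≡ zq (suc d)) → ∀ j → sumℚ (Class a (suc (suc (d ℕ.+ a))) j) ≡ zq (suc (suc d))
  class-size-step a d l+2≤m row₀ row₁ j = *-cancelˡ (0<zq d) (begin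
      z₀ * R⁺ ≡⟨ eq₁ z₀ R⁺ z₁ ⟩
      z₀ * (R⁺ + - z₁) + z₀ * z₁ ≡⟨ cong (_+ z₀ * z₁) (trans (sym total) product) ⟩
      z₁ * (q * z₁) + z₀ * z₁ ≡⟨ cong (λ y → z₁ * (q * y) + z₀ * z₁) (zq-suc d) ⟩
      z₁ * (q * (br d * z₀)) + z₀ * z₁ ≡⟨ eq₂ z₀ z₁ q (br d) ⟩
      z₀ * ((q * br d + 1ℚ) * z₁) ≡⟨ cong (λ b → z₀ * (b * z₁)) (sym (br-suc d)) ⟩
      z₀ * (br (suc d) * z₁) ≡⟨ cong (z₀ *_) (sym (zq-suc (suc d))) ⟩
      z₀ * zq (suc (suc d)) ∎)
    where
    open ≡-Reasoning
    l = d ℕ.+ a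
    z₀ z₁ R⁺ : ℚ
    z₀ = zq d
    z₁ = zq (suc d)
    E E⁺ : Mat N N
    E  = Class a (suc l)
    E⁺ = Class a (suc (suc l))
    R⁺ = sumℚ (E⁺ j)
    product : sumℚ ((E ⊡ (T l ⊡ E)) j) ≡ z₁ * (q * z₁)
    product = trans (row-⊡ E (T l ⊡ E) {q * z₁} (λ k → trans (row-⊡ (T l) E row₁ k) (cong (_* z₁) (panel-size l+2≤m k))) j) (cong (_* (q * z₁)) (row₁ j))
    total : sumℚ ((E ⊡ (T l ⊡ E)) j) ≡ z₀ * (R⁺ + - z₁)
    total = begin
      sumℚ ((E ⊡ (T l ⊡ E)) j) ≡⟨ sum-cong (FlagCount.flag-count a l (ℕ.m≤n+m a d) l+2≤m row₀ j) ⟩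
      sumℚ (λ k → z₀ * (E⁺ j k - E j k)) ≡⟨ sum-*ˡ z₀ (λ k → E⁺ j k - E j k) ⟩
      z₀ * sumℚ (λ k → E⁺ j k - E j k) ≡⟨ cong (z₀ *_) (trans (sum-cong (λ k → cong (E⁺ j k +_) (eq₃ (E j k)))) (sum-+ (E⁺ j) (λ k → - 1ℚ * E j k))) ⟩
      z₀ * (R⁺ + sumℚ (λ k → - 1ℚ * E j k)) ≡⟨ cong (λ y → z₀ * (R⁺ + y)) (trans (sum-*ˡ (- 1ℚ) (E j)) (trans (cong (- 1ℚ *_) (row₁ j)) (sym (eq₃ z₁)))) ⟩
      z₀ * (R⁺ + - z₁) ∎
      where
      eq₃ : ∀ (x : ℚ) → - x ≡ - 1ℚ * x
      eq₃ = solve-∀ ℚ-ring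
    eq₁ : ∀ (z₀ R z₁ : ℚ) → z₀ * R ≡ z₀ * (R + - z₁) + z₀ * z₁
    eq₁ = solve-∀ ℚ-ring
    eq₂ : ∀ (z₀ z₁ q b : ℚ) → z₁ * (q * (b * z₀)) + z₀ * z₁ ≡ z₀ * ((q * b + 1ℚ) * z₁)
    eq₂ = solve-∀ ℚ-ring

  class-size : ∀ a d → d ℕ.+ a ≤ m → ∀ j → sumℚ (Class a (d ℕ.+ a) j) ≡ zq d
  class-size a zero          _     = class-trivial (ℕ.n≤1+n a)
  class-size a (suc zero)    _     = class-trivial ℕ.≤-refl
  class-size a (suc (suc d)) l+2≤m = class-size-step a d l+2≤m (class-size a d (ℕ.<⇒≤ (ℕ.<⇒≤ l+2≤m))) (class-size a (suc d) (ℕ.<⇒≤ l+2≤m))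

  c-row : ∀ a d → suc (d ℕ.+ a) ≤ m → ∀ j → sumℚ (c a d j) ≡ q ^ℚ d
  c-row a zero    _     j = row-identity j
  c-row a (suc d) l+2≤m j = trans (row-⊡ (c a d) (T (d ℕ.+ a)) (panel-size l+2≤m) j)
    (trans (cong (_* q) (c-row a d (ℕ.<⇒≤ l+2≤m) j)) (*-comm (q ^ℚ d) q))

  A-row : ∀ a d → suc (d ℕ.+ a) ≤ m → ∀ j → sumℚ (A a d j) ≡ oppCount q d
  A-row a zero    _    j = row-identity j
  A-row a (suc d) b<m j = trans (row-⊡ (c a (suc d)) (A a d) (A-row a d (ℕ.<⇒≤ b<m)) j) (cong (_* oppCount q d) (c-row a (suc d) b<m j))

  T-sym : ∀ l → Sym (T l)
  T-sym l = ind-sym (T-ind l) adj-sym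

  class-sym : ∀ a b → Sym (Class a b)
  class-sym a b = ind-sym (class-ind a b) agree-sym

  A-sym : ∀ a d → suc (d ℕ.+ a) ≤ m → Sym (A a d)
  A-sym a d b<m = ind-sym (A-ind a d b<m) opp-sym

  class-size₀ : ∀ {d} → d ≤ m → ∀ j → sumℚ (Class 0 d j) ≡ zq d
  class-size₀ {d} d≤m j = subst (λ e → sumℚ (Class 0 e j) ≡ zq d) (ℕ.+-identityʳ d)
    (class-size 0 d (subst (_≤ m) (sym (ℕ.+-identityʳ d)) d≤m) j)

  -- The matrix p = 1 + T of the panel relation has blocks of ones of size q + 1, so p² = (q + 1) p;
  -- the relation follows on substituting T = p - 1.
  T-quad : ∀ {l} → suc (suc l) ≤ m → ∀ x j → matVec (T l) (matVec (T l) x) j ≡ (q - 1ℚ) * matVec (T l) x j + q * x j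
  T-quad {l} l+2≤m x j = begin
    matVec (T l) Tx j ≡⟨ solveT Tx j ⟩
    matVec p Tx j + - 1ℚ * Tx j ≡⟨ cong (_+ - 1ℚ * Tx j) pTx ⟩
    1ℚ * ((q + 1ℚ) * px j) + - 1ℚ * px j + - 1ℚ * Tx j ≡⟨ cong (λ y → 1ℚ * ((q + 1ℚ) * y) + - 1ℚ * y + - 1ℚ * Tx j) (p-T x j) ⟩
    1ℚ * ((q + 1ℚ) * (x j + Tx j)) + - 1ℚ * (x j + Tx j) + - 1ℚ * Tx j ≡⟨ eq q (x j) (Tx j) ⟩
    (q - 1ℚ) * Tx j + q * x j ∎
    where
    open ≡-Reasoning
    p : Mat N N
    p = Class l (suc (suc l))
    Tx px : Fin N → ℚ
    Tx = matVec (T l) x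
    px = matVec p x
    entry : ∀ j k → p j k ≡ identity j k + T l j k
    entry j k with class-ind l (suc (suc l)) j k | ind-identity j k | T-ind l j k
    ... | inj₁ (_ , e) | inj₁ (_ , e′) | inj₂ (_ , e″) = trans e (sym (cong₂ _+_ e′ e″))
    ... | inj₁ (_ , e) | inj₂ (_ , e′) | inj₁ (_ , e″) = trans e (sym (cong₂ _+_ e′ e″))
    ... | inj₂ (_ , e) | inj₂ (_ , e′) | inj₂ (_ , e″) = trans e (sym (cong₂ _+_ e′ e″))
    ... | _ | inj₁ (refl , _) | inj₁ (t , _) = contradiction ≃-refl (diff t)
    ... | inj₂ (n , _) | inj₁ (refl , _) | _ = contradiction agree-refl n
    ... | inj₂ (n , _) | _ | inj₁ (t , _) = contradiction (rest t) n
    ... | inj₁ (r , _) | inj₂ (ne , _) | inj₂ (n , _) = contradiction (adj r (λ h → ne (replace-unique r h))) n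
    p-T : ∀ x j → matVec p x j ≡ x j + matVec (T l) x j
    p-T x j = trans (sum-cong (λ k → trans (cong (_* x k) (entry j k)) (*-distribʳ-+ (x k) (identity j k) (T l j k))))
      (trans (sum-+ (λ k → identity j k * x k) (λ k → T l j k * x k)) (cong (_+ matVec (T l) x j) (matVec-identity x j)))
    p-row : ∀ j → sumℚ (p j) ≡ q + 1ℚ
    p-row j = trans (sum-cong (entry j)) (trans (sum-+ (identity j) (T l j)) (trans (cong₂ _+_ (row-identity j) (panel-size l+2≤m j)) (+-comm 1ℚ q)))
    p-p : ∀ j → matVec p px j ≡ (q + 1ℚ) * px j
    p-p = matVec-absorb {A = p} {B = p} {r = q + 1ℚ} (ind-absorb (class-ind l (suc (suc l))) (class-ind l (suc (suc l)))
      (λ r s → agree-trans (agree-sym r) s) agree-trans p-row) x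
    eq-T : ∀ (t x : ℚ) → t ≡ (x + t) + - 1ℚ * x
    eq-T = solve-∀ ℚ-ring
    solveT : ∀ x j → matVec (T l) x j ≡ matVec p x j + - 1ℚ * x j
    solveT x j = trans (eq-T (matVec (T l) x j) (x j)) (cong (_+ - 1ℚ * x j) (sym (p-T x j)))
    one-mul : ∀ (u x : ℚ) → u + x ≡ 1ℚ * u + x
    one-mul = solve-∀ ℚ-ring
    pTx : matVec p Tx j ≡ 1ℚ * ((q + 1ℚ) * px j) + - 1ℚ * px j
    pTx = trans (matVec-lin p 1ℚ px (- 1ℚ) x (λ k → trans (solveT x k) (one-mul (px k) (- 1ℚ * x k))) j)
      (cong (λ y → 1ℚ * y + - 1ℚ * px j) (p-p j))
    eq : ∀ (q x t : ℚ) → 1ℚ * ((q + 1ℚ) * (x + t)) + - 1ℚ * (x + t) + - 1ℚ * t ≡ (q - 1ℚ) * t + q * x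
    eq = solve-∀ ℚ-ring

  zinv : ℕ → ℚ
  zinv d = proj₁ (inverseOf (0<zq d))

  zinv-zq : ∀ d → zinv d * zq d ≡ 1ℚ
  zinv-zq d = proj₂ (inverseOf (0<zq d))

  P : ℕ → Mat N N
  P l j k = zinv (suc l) * Class 0 (suc l) j k

  matVec-P : ∀ l x j → matVec (P l) x j ≡ zinv (suc l) * matVec (Class 0 (suc l)) x j
  matVec-P l x j = trans (sum-cong (λ k → *-assoc (zinv (suc l)) (Class 0 (suc l) j k) (x k))) (sum-*ˡ (zinv (suc l)) (λ k → Class 0 (suc l) j k * x k))

  private
    absorb-zinv : ∀ (i z y : ℚ) → i * z ≡ 1ℚ → i * (z * y) ≡ y
    absorb-zinv i z y e = trans (sym (*-assoc i z y)) (trans (cong (_* y) e) (*-identityˡ y))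

  P-fix : ∀ {l y} → (∀ j → matVec (Class 0 (suc l)) y j ≡ zq (suc l) * y j) → ∀ j → matVec (P l) y j ≡ y j
  P-fix {l} {y} h j = trans (matVec-P l y j) (trans (cong (zinv (suc l) *_) (h j)) (absorb-zinv (zinv (suc l)) (zq (suc l)) (y j) (zinv-zq (suc l))))

  matVec-P-absorb : ∀ {B : Mat N N} {r l} → (∀ j k → (B ⊡ Class 0 (suc l)) j k ≡ r * Class 0 (suc l) j k) →
    ∀ x j → matVec B (matVec (P l) x) j ≡ r * matVec (P l) x j
  matVec-P-absorb {B} {r} {l} h x j = begin
    matVec B (matVec (P l) x) j ≡⟨ matVec-scale B (zinv (suc l)) (matVec (Class 0 (suc l)) x) (matVec-P l x) j ⟩
    zinv (suc l) * matVec B (matVec (Class 0 (suc l)) x) j ≡⟨ cong (zinv (suc l) *_) (matVec-absorb {A = B} {B = Class 0 (suc l)} {r} h x j) ⟩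
    zinv (suc l) * (r * matVec (Class 0 (suc l)) x j) ≡⟨ eq (zinv (suc l)) r (matVec (Class 0 (suc l)) x j) ⟩
    r * (zinv (suc l) * matVec (Class 0 (suc l)) x j) ≡⟨ cong (r *_) (sym (matVec-P l x j)) ⟩
    r * matVec (P l) x j ∎
    where
    open ≡-Reasoning
    eq : ∀ (i r y : ℚ) → i * (r * y) ≡ r * (i * y)
    eq = solve-∀ ℚ-ring

  P-sym : ∀ l → Sym (P l)
  P-sym l j k = cong (zinv (suc l) *_) (class-sym 0 (suc l) j k)

  class-class : ∀ {a b b′} → b ≤ b′ → ∀ {r} → (∀ j → sumℚ (Class a b j) ≡ r) → ∀ j k → (Class a b ⊡ Class a b′) j k ≡ r * Class a b′ j k
  class-class {a} {b} {b′} b≤b′ = ind-absorb (class-ind a b) (class-ind a b′)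
    (λ r s → agree-trans (agree-weaken ℕ.≤-refl b≤b′ (agree-sym r)) s) (λ r s → agree-trans (agree-weaken ℕ.≤-refl b≤b′ r) s)

  P-P-≤ : ∀ {l l′} → l ≤ l′ → suc l ≤ m → ∀ x j → matVec (P l) (matVec (P l′) x) j ≡ matVec (P l′) x j
  P-P-≤ {l} {l′} l≤l′ l<m x = P-fix {l} (matVec-P-absorb {B = Class 0 (suc l)} {r = zq (suc l)} {l = l′} (class-class (s≤s l≤l′) (class-size₀ l<m)) x)

  P-0 : ∀ x j → matVec (P 0) x j ≡ x j
  P-0 x = P-fix {0} (λ j → trans (trans (matVec-congˡ (λ j k → ind-unique (class-ind 0 1) ind-identity (agree-≡ ℕ.≤-refl) (λ { refl → agree-refl }) j k) x j)
    (matVec-identity x j)) (sym (trans (cong (_* x j) (zq-suc 0)) (*-identityˡ (x j)))))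

  T-P : ∀ {i l} → i < l → suc l ≤ m → ∀ x j → matVec (T i) (matVec (P l) x) j ≡ q * matVec (P l) x j
  T-P {i} {l} i<l l<m = matVec-P-absorb {B = T i} {r = q} {l = l} (ind-absorb (T-ind i) (class-ind 0 (suc l))
    (λ r s → agree-trans (agree-sym (weaken r)) s) (λ r s → agree-trans (weaken r) s) (panel-size (ℕ.≤-trans (s≤s i<l) l<m)))
    where
    weaken : ∀ {j k} → Adj i j k → Agree 0 (suc l) j k
    weaken r = agree-weaken z≤n (s≤s i<l) (rest r)

  -- This is `flag-count` with r = z_l, divided by the class sizes. The q-integers arise as the
  -- quotients z_{l+1} / z_l = [l+1] and z_{l+2} / z_{l+1} = [l+2].
  P-T-P : ∀ {l} → suc (suc l) ≤ m → ∀ x j →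
    br l * matVec (P l) (matVec (T l) (matVec (P l) x)) j ≡ br (suc l) * matVec (P (suc l)) x j - matVec (P l) x j
  P-T-P {l} l+2≤m x j = begin
    br l * matVec (P l) (matVec (T l) (matVec (P l) x)) j ≡⟨ cong (br l *_) (trans (matVec-P l _ j) (cong (i₁ *_)
        (matVec-cong E (matVec-scale (T l) i₁ (matVec E x) (matVec-P l x)) j))) ⟩
    br l * (i₁ * matVec E (λ k → i₁ * matVec (T l) (matVec E x) k) j) ≡⟨ cong (λ y → br l * (i₁ * y)) (trans (matVec-* E i₁ (matVec (T l) (matVec E x)) j) (cong (i₁ *_) ETE)) ⟩
    br l * (i₁ * (i₁ * (zq l * (E⁺x - Ex)))) ≡⟨ eq₁ (br l) i₁ (zq l) (E⁺x - Ex) ⟩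
    i₁ * (br l * zq l) * (i₁ * (E⁺x - Ex)) ≡⟨ cong (λ y → i₁ * y * (i₁ * (E⁺x - Ex))) (sym (zq-suc l)) ⟩
    i₁ * zq (suc l) * (i₁ * (E⁺x - Ex)) ≡⟨ cong (_* (i₁ * (E⁺x - Ex))) (zinv-zq (suc l)) ⟩
    1ℚ * (i₁ * (E⁺x - Ex)) ≡⟨ eq₂ i₁ E⁺x Ex ⟩
    i₁ * E⁺x - i₁ * Ex ≡⟨ cong (_- i₁ * Ex) i₁-i₂ ⟩
    br (suc l) * (i₂ * E⁺x) - i₁ * Ex ≡⟨ sym (cong₂ (λ u v → br (suc l) * u - v) (matVec-P (suc l) x j) (matVec-P l x j)) ⟩
    br (suc l) * matVec (P (suc l)) x j - matVec (P l) x j ∎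
    where
    open ≡-Reasoning
    E E⁺ : Mat N N
    E  = Class 0 (suc l)
    E⁺ = Class 0 (suc (suc l))
    i₁ i₂ Ex E⁺x : ℚ
    i₁ = zinv (suc l)
    i₂ = zinv (suc (suc l))
    Ex = matVec E x j
    E⁺x = matVec E⁺ x j
    eq₁ : ∀ (b i z y : ℚ) → b * (i * (i * (z * y))) ≡ i * (b * z) * (i * y)
    eq₁ = solve-∀ ℚ-ring
    eq₂ : ∀ (i x y : ℚ) → 1ℚ * (i * (x - y)) ≡ i * x - i * y
    eq₂ = solve-∀ ℚ-ring
    eq₃ : ∀ (z e e′ x : ℚ) → z * (e - e′) * x ≡ z * (e * x + - 1ℚ * (e′ * x))
    eq₃ = solve-∀ ℚ-ring
    eq₄ : ∀ (z u v : ℚ) → z * (u + - 1ℚ * v) ≡ z * (u - v)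
    eq₄ = solve-∀ ℚ-ring
    ETE : matVec E (matVec (T l) (matVec E x)) j ≡ zq l * (E⁺x - Ex)
    ETE = begin
      matVec E (matVec (T l) (matVec E x)) j ≡⟨ matVec-cong E (λ k → sym (matVec-⊡ (T l) E x k)) j ⟩
      matVec E (matVec (T l ⊡ E) x) j ≡⟨ sym (matVec-⊡ E (T l ⊡ E) x j) ⟩
      matVec (E ⊡ (T l ⊡ E)) x j ≡⟨ sum-cong (λ k → trans (cong (_* x k) (FlagCount.flag-count 0 l z≤n l+2≤m
          (class-size₀ (ℕ.<⇒≤ (ℕ.<⇒≤ l+2≤m))) j k)) (eq₃ (zq l) (E⁺ j k) (E j k) (x k))) ⟩
      sumℚ (λ k → zq l * (E⁺ j k * x k + - 1ℚ * (E j k * x k))) ≡⟨ sum-*ˡ (zq l) (λ k → E⁺ j k * x k + - 1ℚ * (E j k * x k)) ⟩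
      zq l * sumℚ (λ k → E⁺ j k * x k + - 1ℚ * (E j k * x k)) ≡⟨ cong (zq l *_) (trans (sum-+ (λ k → E⁺ j k * x k) (λ k → - 1ℚ * (E j k * x k)))
          (cong (E⁺x +_) (sum-*ˡ (- 1ℚ) (λ k → E j k * x k)))) ⟩
      zq l * (E⁺x + - 1ℚ * Ex) ≡⟨ eq₄ (zq l) E⁺x Ex ⟩
      zq l * (E⁺x - Ex) ∎
    eq₆ : ∀ (i z b i₁ e : ℚ) → i * (b * z) * (i₁ * e) ≡ (i₁ * z) * (b * (i * e))
    eq₆ = solve-∀ ℚ-ring
    i₁-i₂ : i₁ * E⁺x ≡ br (suc l) * (i₂ * E⁺x)
    i₁-i₂ = begin
      i₁ * E⁺x ≡⟨ sym (*-identityˡ (i₁ * E⁺x)) ⟩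
      1ℚ * (i₁ * E⁺x) ≡⟨ cong (_* (i₁ * E⁺x)) (sym (trans (cong (i₂ *_) (sym (zq-suc (suc l)))) (zinv-zq (suc (suc l))))) ⟩
      i₂ * (br (suc l) * zq (suc l)) * (i₁ * E⁺x) ≡⟨ eq₆ i₂ (zq (suc l)) (br (suc l)) i₁ E⁺x ⟩
      i₁ * zq (suc l) * (br (suc l) * (i₂ * E⁺x)) ≡⟨ cong (_* (br (suc l) * (i₂ * E⁺x))) (zinv-zq (suc l)) ⟩
      1ℚ * (br (suc l) * (i₂ * E⁺x)) ≡⟨ *-identityˡ _ ⟩
      br (suc l) * (i₂ * E⁺x) ∎

  -- The relation of T (l+1) times the class matrix involves its first flag only through index 0 and
  -- the indices from l + 1 on, so changing the spaces at 1, ..., l does not affect it.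
  P-T-P-suc : ∀ {l} → suc (suc (suc l)) ≤ m → ∀ x j →
    matVec (P l) (matVec (T (suc l)) (matVec (P (suc l)) x)) j ≡ matVec (T (suc l)) (matVec (P (suc l)) x) j
  P-T-P-suc {l} l+3≤m x = P-fix {l} λ j → begin
      matVec (Class 0 (suc l)) (matVec T′ (matVec (P (suc l)) x)) j ≡⟨ matVec-cong (Class 0 (suc l)) (matVec-scale T′ i₂ (matVec E x) (matVec-P (suc l) x)) j ⟩
      matVec (Class 0 (suc l)) (λ k → i₂ * matVec T′ (matVec E x) k) j ≡⟨ matVec-* (Class 0 (suc l)) i₂ (matVec T′ (matVec E x)) j ⟩
      i₂ * matVec (Class 0 (suc l)) (matVec T′ (matVec E x)) j ≡⟨ cong (i₂ *_) (matVec-cong (Class 0 (suc l)) (λ k → sym (matVec-⊡ T′ E x k)) j) ⟩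
      i₂ * matVec (Class 0 (suc l)) (matVec (T′ ⊡ E) x) j ≡⟨ cong (i₂ *_) (matVec-absorb {A = Class 0 (suc l)} {B = T′ ⊡ E} {zq (suc l)} absorbed x j) ⟩
      i₂ * (zq (suc l) * matVec (T′ ⊡ E) x j) ≡⟨ eq i₂ (zq (suc l)) (matVec (T′ ⊡ E) x j) ⟩
      zq (suc l) * (i₂ * matVec (T′ ⊡ E) x j) ≡⟨ cong (λ y → zq (suc l) * (i₂ * y)) (matVec-⊡ T′ E x j) ⟩
      zq (suc l) * (i₂ * matVec T′ (matVec E x) j) ≡⟨ cong (zq (suc l) *_) (sym (matVec-scale T′ i₂ (matVec E x) (matVec-P (suc l) x) j)) ⟩
      zq (suc l) * matVec T′ (matVec (P (suc l)) x) j ∎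
    where
    open ≡-Reasoning
    T′ E : Mat N N
    T′ = T (suc l)
    E  = Class 0 (suc (suc l))
    i₂ : ℚ
    i₂ = zinv (suc (suc l))
    eq : ∀ (i z y : ℚ) → i * (z * y) ≡ z * (i * y)
    eq = solve-∀ ℚ-ring
    moved : ∀ {j j′ k} → Agree 0 (suc l) j j′ → Incident 0 (suc l) j k → Incident 0 (suc l) j′ k
    moved p (incident o b d) = incident (agree-trans (agree-weaken z≤n (ℕ.≤-trans (ℕ.n≤1+n (suc l)) (ℕ.n≤1+n (suc (suc l)))) (agree-sym p)) o)
      (≼-trans (bwd (high p ℕ.≤-refl)) b) (λ h → d (≃-trans (high p (ℕ.n≤1+n (suc l))) h))
    absorbed : ∀ j k → (Class 0 (suc l) ⊡ (T′ ⊡ E)) j k ≡ zq (suc l) * (T′ ⊡ E) j k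
    absorbed = ind-absorb (class-ind 0 (suc l)) (T-class z≤n l+3≤m) moved (moved ∘ agree-sym) (class-size₀ (ℕ.<⇒≤ (ℕ.<⇒≤ l+3≤m)))

  module Operators (M : ℕ) (M<m : suc M ≤ m) where

    private
      below : ∀ {l} → l ≤ M → suc l ≤ m
      below l≤M = ℕ.≤-trans (s≤s l≤M) M<m

    T-symₘ : ∀ {l} → l < M → Sym (T l)
    T-symₘ {l} _ = T-sym l

    T-quadₘ : ∀ {l} → l < M → ∀ x j → matVec (T l) (matVec (T l) x) j ≡ (q - 1ℚ) * matVec (T l) x j + q * x j
    T-quadₘ l<M = T-quad (below l<M)

    P-symₘ : ∀ {l} → l ≤ M → Sym (P l)
    P-symₘ {l} _ = P-sym l

    P-idemₘ : ∀ {l} → l ≤ M → ∀ x j → matVec (P l) (matVec (P l) x) j ≡ matVec (P l) x j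
    P-idemₘ {l} l≤M = P-P-≤ {l} {l} ℕ.≤-refl (below l≤M)

    T-Pₘ : ∀ {i l} → i < l → l ≤ M → ∀ x j → matVec (T i) (matVec (P l) x) j ≡ q * matVec (P l) x j
    T-Pₘ i<l l≤M = T-P i<l (below l≤M)

    P-Pₘ : ∀ {l} → l < M → ∀ x j → matVec (P l) (matVec (P (suc l)) x) j ≡ matVec (P (suc l)) x j
    P-Pₘ {l} l<M = P-P-≤ (ℕ.n≤1+n l) (ℕ.<⇒≤ (below l<M))

    P-T-Pₘ : ∀ {l} → l < M → ∀ x j →
      br l * matVec (P l) (matVec (T l) (matVec (P l) x)) j ≡ br (suc l) * matVec (P (suc l)) x j - matVec (P l) x j
    P-T-Pₘ l<M = P-T-P (below l<M)

    P-T-P-sucₘ : ∀ {l} → suc l < M → ∀ x j →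
      matVec (P l) (matVec (T (suc l)) (matVec (P (suc l)) x)) j ≡ matVec (T (suc l)) (matVec (P (suc l)) x) j
    P-T-P-sucₘ l<M = P-T-P-suc (below l<M)

    c-sucₘ : ∀ {l} → l < M → ∀ j k → c 0 (suc l) j k ≡ (c 0 l ⊡ T l) j k
    -- `c 0` places its last step at l + 0, which does not reduce to l.
    c-sucₘ {l} _ j k = cong (λ e → (c 0 l ⊡ T e) j k) (ℕ.+-identityʳ l)

    ≡-refl₂ : ∀ (B : Mat N N) j k → B j k ≡ B j k
    ≡-refl₂ B j k = refl

    A-sucₘ : ∀ {l} → l < M → ∀ j k → A 0 (suc l) j k ≡ (c 0 (suc l) ⊡ A 0 l) j k
    A-sucₘ _ _ _ = refl

    A-symₘ : ∀ {l} → l ≤ M → Sym (A 0 l)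
    A-symₘ {l} l≤M = A-sym 0 l (subst (λ e → suc e ≤ m) (sym (ℕ.+-identityʳ l)) (below l≤M))

    open Spectral q 1≤q M T P (A 0) (c 0) br refl br-suc T-symₘ T-quadₘ P-symₘ P-0 P-idemₘ T-Pₘ P-Pₘ P-T-Pₘ P-T-P-sucₘ
      (≡-refl₂ identity) c-sucₘ (≡-refl₂ identity) A-sucₘ A-symₘ public
      using (A²-eig; A-form-bound; 0<q^)

-- Flags through a given subspace and projection to its residue.

module FlagsThrough (F : FiniteField) (m : ℕ) where
  open Flags F m

  module Join (s : ℕ) (L U : ℕ → Subspace F m)
    (L-dim : ∀ {i} → i ≤ s → Dim (L i) i) (L-suc : ∀ i → suc i ≤ s → L i ≼ L (suc i))
    (U-dim : ∀ {i} → i ℕ.+ s ≤ m → Dim (U i) (i ℕ.+ s)) (U-suc : ∀ i → U i ≼ U (suc i))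
    (glue : L s ≼ U 0) where

    join : Flag
    join .S i = choose (i ℕ.≤? s) (L i) (U (i ℕ.∸ s))
    join .S-dim {i} i≤m with i ℕ.≤? s
    ... | yes i≤s = L-dim i≤s
    ... | no i≰s  = subst (Dim (U (i ℕ.∸ s))) e (U-dim (ℕ.≤-trans (ℕ.≤-reflexive e) i≤m))
      where
      e : i ℕ.∸ s ℕ.+ s ≡ i
      e = ℕ.m∸n+n≡m (ℕ.<⇒≤ (ℕ.≰⇒> i≰s))
    join .S-suc i with i ℕ.≤? s | suc i ℕ.≤? s
    ... | yes _   | yes i<s = L-suc i i<s
    ... | no i≰s  | yes i<s = contradiction (ℕ.<⇒≤ i<s) i≰s
    ... | no i≰s  | no _    = subst (λ e → U (i ℕ.∸ s) ≼ U e) (sym (ℕ.+-∸-assoc 1 (ℕ.<⇒≤ (ℕ.≰⇒> i≰s)))) (U-suc (i ℕ.∸ s))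
    ... | yes i≤s | no i≮s rewrite ℕ.≤-antisym i≤s (ℕ.≮⇒≥ i≮s) =
      subst (λ e → L s ≼ U e) (sym (ℕ.m+n∸n≡m 1 s)) (≼-trans glue (U-suc 0))

    join-low : ∀ {i} → i ≤ s → S join i ≃ L i
    join-low {i} = choose-yes (i ℕ.≤? s)

    join-high : ∀ i → S join (suc i ℕ.+ s) ≃ U (suc i)
    join-high i = subst (λ e → S join (suc i ℕ.+ s) ≃ U e) (ℕ.m+n∸n≡m (suc i) s)
      (choose-no (suc i ℕ.+ s ℕ.≤? s) (ℕ.m+1+n≰m s ∘ subst (_≤ s) (trans (ℕ.+-comm (suc i) s) refl)))

  tower : ∀ k {U W : Subspace F m} {i} → U ≼ W → Dim U i → Dim W (k ℕ.+ i) →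
    Σ (ℕ → Subspace F m) λ G → G 0 ≃ U × (∀ {j} → j ≤ k → Dim (G j) (j ℕ.+ i)) × (∀ j → G j ≼ G (suc j)) × (∀ j → G j ≼ W)
  tower zero {U} U≼W dU dW = (λ _ → U) , ≃-refl , (λ { z≤n → dU }) , (λ _ → ≼-refl) , λ _ → U≼W
  tower (suc k) {U} {W} {i} U≼W dU dW with x , x∈W , x∉U ← ∉-exists dU dW (λ h → ℕ.m+1+n≰m i
          (subst (_≤ i) (sym (trans (ℕ.+-suc i k) (cong suc (ℕ.+-comm i k)))) (dim-≤ h dW dU)))
      with G , G₀ , G-dim , G-suc , G≼ ← tower k (adjoin-least x∈W U≼W) (adjoin-dim x∉U dU) (subst (Dim W) (sym (ℕ.+-suc k i)) dW) =
    H , ≃-refl , H-dim , H-suc , H≼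
    where
    H : ℕ → Subspace F m
    H zero    = U
    H (suc j) = G j
    H-dim : ∀ {j} → j ≤ suc k → Dim (H j) (j ℕ.+ i)
    H-dim z≤n             = dU
    H-dim {suc j} (s≤s p) = subst (Dim (G j)) (ℕ.+-suc j i) (G-dim p)
    H-suc : ∀ j → H j ≼ H (suc j)
    H-suc zero    = ≼-trans (sumS-ʳ (line x) U) (bwd G₀)
    H-suc (suc j) = G-suc j
    H≼ : ∀ j → H j ≼ W
    H≼ zero    = U≼W
    H≼ (suc j) = G≼ j

  flag-through : ∀ {S₀ s t} → t ℕ.+ s ≡ m → Dim S₀ s → Σ Flag λ X → S X s ≃ S₀
  flag-through {S₀} {s} {t} refl dS
    with L , _ , L-dim , L-suc , L≼ ← tower s {zeroS} {S₀} (incl λ h → mem-resp S₀ (λ k → sym (h k)) (mem-0 S₀)) zeroS-dim (subst (Dim S₀) (sym (ℕ.+-identityʳ s)) dS)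
    with U , U₀ , U-dim , U-suc , _ ← tower t {S₀} {fullS} (incl λ _ → tt) dS fullS-dim =
    join , ≃-trans (join-low ℕ.≤-refl) (dim-≃ (L≼ s) (L-dim′ ℕ.≤-refl) dS)
    where
    L-dim′ : ∀ {i} → i ≤ s → Dim (L i) i
    L-dim′ {i} p = subst (Dim (L i)) (ℕ.+-identityʳ i) (L-dim p)
    open Join s L U L-dim′ (λ i _ → L-suc i) (λ {i} p → U-dim (ℕ.+-cancelʳ-≤ s i t p)) U-suc (≼-trans (L≼ s) (bwd U₀))

  -- For a complement S₀ of X_t, the projection of X to the residue of S₀: the spaces S₀ ∩ X_{i+t} below
  -- S₀ and S₀ + X_i above it.
  module Transversal (X : Flag) {S₀ : Subspace F m} {s t : ℕ} (t+s : t ℕ.+ s ≡ m) (dS : Dim S₀ s)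
    (triv : TrivInter F S₀ (S X t)) where

    private
      t≤m : t ≤ m
      t≤m = subst (t ≤_) t+s (ℕ.m≤m+n t s)

    L U : ℕ → Subspace F m
    L i = interS S₀ (S X (i ℕ.+ t))
    U i = sumS S₀ (S X i)

    decompose : fullS ≼ sumS S₀ (S X t)
    decompose = ≼-dim-≡ (incl λ _ → tt) (subst (Dim (sumS S₀ (S X t))) (trans (ℕ.+-comm s t) t+s)
      (sumS-dim triv dS (S-dim X t≤m))) fullS-dim

    +t≤m : ∀ {i} → i ≤ s → i ℕ.+ t ≤ m
    +t≤m i≤s = ℕ.≤-trans (ℕ.+-monoˡ-≤ t i≤s) (ℕ.≤-reflexive (trans (ℕ.+-comm s t) t+s))

    -- S₀ is a complement of X_t, so by the modular law X_{i+t} is the direct sum of S₀ ∩ X_{i+t}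
    -- and X_t; the dimension is found by cancelling t.
    L-dim : ∀ {i} → i ≤ s → Dim (L i) i
    L-dim {i} i≤s with d , dL ← subspace-dim {U = L i} {W = S₀} (λ x → mem? dS x ×-dec mem? (S-dim X (+t≤m i≤s)) x) (incl proj₁) dS =
      subst (Dim (L i)) (ℕ.+-cancelʳ-≡ t d i (dim-unique (Dim-≃ (sumS-least {U = L i} (incl proj₂) (S-mono X (ℕ.m≤n+m t i)) ⇄ incl above)
        (sumS-dim {U = L i} {W = S X t} (λ x h h′ → triv x (proj₁ h) h′) dL (S-dim X t≤m))) (S-dim X (+t≤m i≤s)))) dL
      where
      above : ∀ {x} → mem (S X (i ℕ.+ t)) x → mem (sumS (L i) (S X t)) x
      above {x} x∈ with u , w , u∈ , w∈ , e ← app decompose {x} tt =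
        u , w , (u∈ , mem-sub (S X (i ℕ.+ t)) (λ k → trans (e k) (R.+-comm (u k) (w k))) x∈ (app (S-mono X (ℕ.m≤n+m t i)) w∈)) , w∈ , e

    U-dim : ∀ {i} → i ℕ.+ s ≤ m → Dim (U i) (i ℕ.+ s)
    U-dim {i} p = subst (Dim (U i)) (ℕ.+-comm s i) (sumS-dim {U = S₀} {W = S X i} (λ x h h′ → triv x h (app (S-mono X i≤t) h′)) dS
      (S-dim X (ℕ.≤-trans i≤t t≤m)))
      where
      i≤t : i ≤ t
      i≤t = ℕ.+-cancelʳ-≤ s i t (ℕ.≤-trans p (ℕ.≤-reflexive (sym t+s)))

    open Join s L U L-dim (λ i _ → incl λ (h , h′) → h , app (S-suc X (i ℕ.+ t)) h′) U-dim
      (λ i → sumS-least (sumS-ˡ S₀ (S X (suc i))) (≼-trans (S-suc X i) (sumS-ʳ S₀ (S X (suc i)))))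
      (≼-trans (incl proj₁) (sumS-ˡ S₀ (S X 0))) public

    join-s : S join s ≃ S₀
    join-s = ≃-trans (join-low ℕ.≤-refl) (incl proj₁ ⇄ incl λ h → h , app (S-top X (ℕ.≤-reflexive (sym (trans (ℕ.+-comm s t) t+s)))) tt)

-- Opposite chambers through a fixed subspace.

module Opposites (F : FiniteField) (m : ℕ) (N : ℕ) (fl : Fin N → Flags.Flag F m)
  (find : (X : Flags.Flag F m) → Σ (Fin N) λ j → ∀ i → Flags._≃_ F m (Flags.S X i) (Flags.S (fl j) i))
  (distinct : ∀ {j k} → (∀ i → Flags._≃_ F m (Flags.S (fl j) i) (Flags.S (fl k) i)) → j ≡ k) where
  open import Data.Rational using (_+_; _*_; _-_; -_)
  open Flags F m
  open FlagsThrough F m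
  open Geometry N fl find distinct
  open Counting F m N fl find distinct

  V-0 : ∀ j {x} → mem (V j 0) x → _≐_ F x (zeroV F)
  V-0 j = app (dim-0 (V-dim j z≤n))

  V-0-≃ : ∀ j k → V j 0 ≃ V k 0
  V-0-≃ j k = S-bottom (fl j) ⇄ S-bottom (fl k)

  Opposed : Fin N → Fin N → Set
  Opposed j k = ∀ i i′ → i ℕ.+ i′ ≡ m → ∀ {x} → mem (V j i) x → mem (V k i′) x → _≐_ F x (zeroV F)

  opposed-ind : ∀ {M} → suc M ≡ m → Ind (A 0 M) Opposed
  opposed-ind {M} M+1 = ind-⇔ (A-ind 0 M (ℕ.≤-reflexive (trans e₁ M+1)))
    (λ { {j} (opp _ h) i i′ e x∈ x∈′ → V-0 j (h i i′ (trans e (sym e₂)) x∈ x∈′) })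
    (λ {j} {k} h → opp (agree (λ { z≤n → V-0-≃ j k }) (λ p → V-≃-≥ j k (ℕ.≤-trans (ℕ.≤-reflexive (sym (trans e₁ M+1))) p)))
      (λ i i′ e {x} x∈ x∈′ → mem-resp (V j 0) (λ k → sym (h i i′ (trans e e₂) x∈ x∈′ k)) (mem-0 (V j 0))))
    where
    e₁ : suc (M ℕ.+ 0) ≡ suc M
    e₁ = cong suc (ℕ.+-identityʳ M)
    e₂ : suc (M ℕ.+ 0) ℕ.+ 0 ≡ m
    e₂ = trans (ℕ.+-identityʳ _) (trans e₁ M+1)

  module AtSubspace {s′ d′ : ℕ} (s+t : suc d′ ℕ.+ suc s′ ≡ m) {S₀ : Subspace F m} (dS : Dim S₀ (suc s′)) where

    private
      s t : ℕ
      s = suc s′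
      t = suc d′
      s≤m : s ≤ m
      s≤m = subst (s ≤_) s+t (ℕ.m≤n+m s t)
      e₀ : suc (s′ ℕ.+ 0) ≡ s
      e₀ = cong suc (ℕ.+-identityʳ s′)
      e₁ : suc (s′ ℕ.+ 0) ℕ.+ 0 ≡ s
      e₁ = trans (ℕ.+-identityʳ _) e₀

    -- k passes through the same s-space as w and is opposite to w both below and above it.
    record Complementary (w k : Fin N) : Set where
      constructor complementary
      field
        at    : V w s ≃ V k s
        below : ∀ i i′ → i ℕ.+ i′ ≡ s → ∀ {x} → mem (V w i) x → mem (V k i′) x → mem (V w 0) x
        above : ∀ i i′ → i ℕ.+ i′ ≡ m ℕ.+ s → ∀ {x} → mem (V w i) x → mem (V k i′) x → mem (V w s) x

    module _ {w k : Fin N} (at : V w s ≃ V k s) where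

      spliced : Σ (Fin N) λ v → (∀ {i} → i ≤ s → V v i ≃ V k i) × (∀ {i} → s ≤ i → V v i ≃ V w i)
      spliced with v , e ← find (Splice.splice (fl k) (fl w) s (≃-sym at)) =
        v , (λ p → ≃-trans (≃-sym (e _)) (Splice.splice-low (fl k) (fl w) s (≃-sym at) p)) ,
            (λ p → ≃-trans (≃-sym (e _)) (Splice.splice-high (fl k) (fl w) s (≃-sym at) p))

    splice-unique : ∀ {v v′} → (∀ {i} → i ≤ s → V v i ≃ V v′ i) → (∀ {i} → s ≤ i → V v i ≃ V v′ i) → v ≡ v′
    splice-unique f g = agree-≡ (ℕ.n≤1+n s) (agree f g)

    -- The intermediate flag is forced: up to index s it is k, from index s on it is w. Opposition
    -- below and opposition above thus multiply to one zero-one matrix, whose row sum is Q.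
    complementary-ind : Ind (A 0 s′ ⊡ A s d′) Complementary
    complementary-ind = ind-⊡ (A-ind 0 s′ (ℕ.≤-trans (ℕ.≤-reflexive e₀) s≤m)) (A-ind s d′ (ℕ.≤-reflexive s+t)) to from
      where
      to : ∀ {w v k} → Opp 0 s′ w v → Opp s d′ v k → Complementary w k
      to {w} {v} {k} (opp o h) (opp o′ h′) = complementary (≃-trans (at-high ℕ.≤-refl) (low o′ ℕ.≤-refl)) below above
        where
        at-high : ∀ {i} → s ≤ i → V w i ≃ V v i
        at-high p = high o (ℕ.≤-trans (ℕ.≤-reflexive e₀) p)
        below : ∀ i i′ → i ℕ.+ i′ ≡ s → ∀ {x} → mem (V w i) x → mem (V k i′) x → mem (V w 0) x
        below i i′ e x∈ x∈′ = h i i′ (trans e (sym e₁)) x∈ (app (bwd (low o′ (ℕ.≤-trans (ℕ.m≤n+m i′ i) (ℕ.≤-reflexive e)))) x∈′)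
        above : ∀ i i′ → i ℕ.+ i′ ≡ m ℕ.+ s → ∀ {x} → mem (V w i) x → mem (V k i′) x → mem (V w s) x
        above i i′ e x∈ x∈′ with i ℕ.≤? s
        ... | yes i≤s = app (V-mono w i≤s) x∈
        ... | no i≰s  = app (bwd (at-high ℕ.≤-refl)) (h′ i i′ (trans e (cong (ℕ._+ s) (sym s+t)))
                          (app (fwd (at-high (ℕ.<⇒≤ (ℕ.≰⇒> i≰s)))) x∈) x∈′)
      from : ∀ {w k} → Complementary w k → Σ (Fin N) λ v → Opp 0 s′ w v × Opp s d′ v k ×
        (∀ v′ → Opp 0 s′ w v′ → Opp s d′ v′ k → v′ ≡ v)
      from {w} {k} (complementary at below above) with v , lo , hi ← spliced at =
        v , opp (agree (λ { z≤n → V-0-≃ w v }) (λ p → ≃-sym (hi (ℕ.≤-trans (ℕ.≤-reflexive (sym e₀)) p))))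
              (λ i i′ e x∈ x∈′ → below i i′ (trans e e₁) x∈ (app (fwd (lo (ℕ.≤-trans (ℕ.m≤n+m i′ i) (ℕ.≤-reflexive (trans e e₁))))) x∈′)) ,
        opp (agree lo (λ p → V-≃-≥ v k (ℕ.≤-trans (ℕ.≤-reflexive (sym s+t)) p))) meet ,
        λ v′ (opp o _) (opp o′ _) → splice-unique (λ p → ≃-trans (low o′ p) (≃-sym (lo p)))
          (λ p → ≃-trans (≃-sym (high o (ℕ.≤-trans (ℕ.≤-reflexive e₀) p))) (≃-sym (hi p)))
        where
        meet : ∀ i i′ → i ℕ.+ i′ ≡ suc (d′ ℕ.+ s) ℕ.+ s → ∀ {x} → mem (V v i) x → mem (V k i′) x → mem (V v s) x
        meet i i′ e x∈ x∈′ with i ℕ.≤? s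
        ... | yes i≤s = app (V-mono v i≤s) x∈
        ... | no i≰s  = app (bwd (hi ℕ.≤-refl)) (above i i′ (trans e (cong (ℕ._+ s) s+t))
                          (app (fwd (hi (ℕ.<⇒≤ (ℕ.≰⇒> i≰s)))) x∈) x∈′)

    abstract
      projected : ∀ j → TrivInter F S₀ (V j t) → Σ (Fin N) λ w → V w s ≃ S₀ ×
        (∀ {i} → i ≤ s → V w i ≃ interS S₀ (V j (i ℕ.+ t))) × (∀ i → V w (suc i ℕ.+ s) ≃ sumS S₀ (V j (suc i)))
      projected j triv = proj₁ (find join) , ≃-trans (≃-sym (spec s)) join-s ,
          (λ {i} p → ≃-trans (≃-sym (spec i)) (join-low p)) , λ i → ≃-trans (≃-sym (spec (suc i ℕ.+ s))) (join-high i)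
        where
        open Transversal (fl j) s+t dS triv
        spec : ∀ i → S join i ≃ V (proj₁ (find join)) i
        spec = proj₂ (find join)

      through : Σ (Fin N) λ w → V w s ≃ S₀
      through = proj₁ (find (proj₁ (flag-through {t = t} s+t dS))) ,
        ≃-trans (≃-sym (proj₂ (find (proj₁ (flag-through {t = t} s+t dS))) s)) (proj₂ (flag-through {t = t} s+t dS))

    -- w is the projection of the flag j to the residue of S₀.
    module Projected (j w : Fin N) (triv : TrivInter F S₀ (V j t)) (w-s : V w s ≃ S₀)
      (w-low : ∀ {i} → i ≤ s → V w i ≃ interS S₀ (V j (i ℕ.+ t)))
      (w-high : ∀ i → V w (suc i ℕ.+ s) ≃ sumS S₀ (V j (suc i))) where

      to : ∀ {k} → Opposed j k × V k s ≃ S₀ → Complementary w k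
      to {k} (o , h) = complementary (≃-trans w-s (≃-sym h)) below above
        where
        below : ∀ i i′ → i ℕ.+ i′ ≡ s → ∀ {x} → mem (V w i) x → mem (V k i′) x → mem (V w 0) x
        below i i′ e {x} x∈ x∈′ = mem-resp (V w 0) (λ k → sym (o (i ℕ.+ t) i′ e′
            (proj₂ (app (fwd (w-low i≤s)) x∈)) x∈′ k)) (mem-0 (V w 0))
          where
          i≤s : i ≤ s
          i≤s = ℕ.≤-trans (ℕ.m≤m+n i i′) (ℕ.≤-reflexive e)
          e′ : i ℕ.+ t ℕ.+ i′ ≡ m
          e′ = trans (cong (ℕ._+ i′) (ℕ.+-comm i t)) (trans (ℕ.+-assoc t i i′) (trans (cong (t ℕ.+_) e) s+t))
        above : ∀ i i′ → i ℕ.+ i′ ≡ m ℕ.+ s → ∀ {x} → mem (V w i) x → mem (V k i′) x → mem (V w s) x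
        above i i′ e {x} x∈ x∈′ with i ℕ.≤? s | i′ ℕ.≤? s
        ... | yes i≤s | _        = app (V-mono w i≤s) x∈
        ... | no _    | yes i′≤s = app (≼-trans (V-mono k i′≤s) (bwd (≃-trans w-s (≃-sym h)))) x∈′
        ... | no i≰s  | no i′≰s  = go (i ℕ.∸ suc s) (ℕ.m∸n+n≡m (ℕ.≰⇒> i≰s))
          where
          go : ∀ i₀ → i₀ ℕ.+ suc s ≡ i → mem (V w s) x
          -- x = u + y with u in S₀ and y in j_{i₀+1}. As S₀ lies in k_{i′}, so does y, and the two
          -- indices add up to m; opposition gives y = 0.
          go i₀ e₂ with u , y , u∈ , y∈ , d ← app (fwd (w-high i₀)) (
                (subst (λ i → mem (V w i) x) (sym (trans (sym (ℕ.+-suc i₀ s)) e₂)) x∈)) =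
            app (bwd w-s) (mem-resp S₀ (λ k → sym (trans (d k) (trans (cong (u k ⊕_) (y≐0 k)) (R.+-identityʳ (u k))))) u∈)
            where
            open FiniteField F using () renaming (_+_ to infixl 6 _⊕_)
            sum-eq : suc i₀ ℕ.+ i′ ≡ m
            sum-eq = ℕ.+-cancelʳ-≡ s (suc i₀ ℕ.+ i′) m (trans (ℕ.+-assoc (suc i₀) i′ s) (trans (cong (suc i₀ ℕ.+_) (ℕ.+-comm i′ s))
              (trans (sym (ℕ.+-assoc (suc i₀) s i′)) (trans (cong (ℕ._+ i′) (trans (sym (ℕ.+-suc i₀ s)) e₂)) e))))
            y≐0 : _≐_ F y (zeroV F)
            y≐0 = o (suc i₀) i′ sum-eq y∈ (mem-sub (V k i′) d x∈′ (app (≼-trans (bwd h) (V-mono k (ℕ.<⇒≤ (ℕ.≰⇒> i′≰s)))) u∈))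
      from : ∀ {k} → Complementary w k → Opposed j k × V k s ≃ S₀
      from {k} (complementary at below above) = o , ≃-trans (≃-sym at) w-s
        where
        o : Opposed j k
        o i i′ e {x} x∈ x∈′ with i′ ℕ.≤? s
        ... | yes i′≤s = V-0 w (below i₀ i′ (ℕ.m∸n+n≡m i′≤s) (app (≃-fwd-low) (x∈S , subst (λ i → mem (V j i) x) (sym i₀+t) x∈)) x∈′)
          where
          i₀ = s ℕ.∸ i′
          i₀+t : i₀ ℕ.+ t ≡ i
          i₀+t = ℕ.+-cancelʳ-≡ i′ (i₀ ℕ.+ t) i (trans (cong (ℕ._+ i′) (ℕ.+-comm i₀ t)) (trans (ℕ.+-assoc t i₀ i′)
            (trans (cong (t ℕ.+_) (ℕ.m∸n+n≡m i′≤s)) (trans s+t (sym e)))))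
          x∈S : mem S₀ x
          x∈S = app (≼-trans (V-mono k i′≤s) (≼-trans (bwd at) (fwd w-s))) x∈′
          ≃-fwd-low : interS S₀ (V j (i₀ ℕ.+ t)) ≼ V w i₀
          ≃-fwd-low = bwd (w-low (ℕ.m∸n≤m s i′))
        -- Here i < t. Complementarity above S₀ puts x into S₀, which meets V j t trivially.
        ... | no i′≰s = triv x (app (fwd w-s) x∈w) (app (V-mono j (ℕ.<⇒≤ i<t)) x∈)
          where
          i<t : i < t
          i<t = ℕ.+-cancelʳ-< i′ i t (subst (λ e → e < t ℕ.+ i′) (trans s+t (sym e)) (ℕ.+-monoʳ-< t (ℕ.≰⇒> i′≰s)))
          x∈U : ∀ i → mem (V j i) x → mem (V w (i ℕ.+ s)) x
          x∈U zero    h = app (S-bottom (fl j) {V w s}) h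
          x∈U (suc i) h = app (bwd (w-high i)) (app (sumS-ʳ S₀ (V j (suc i))) h)
          x∈w : mem (V w s) x
          x∈w = above (i ℕ.+ s) i′ (trans (ℕ.+-assoc i s i′) (trans (cong (i ℕ.+_) (ℕ.+-comm s i′))
            (trans (sym (ℕ.+-assoc i i′ s)) (cong (ℕ._+ s) e)))) (x∈U i x∈) x∈′

    δ : Fin N → ℚ
    δ k = proj₁ (ind-mat {1} (λ _ k → ≃? (V-dim k s≤m) dS)) zero k

    δ-ind : Ind {1} (λ _ → δ) (λ _ k → V k s ≃ S₀)
    δ-ind _ k = proj₂ (ind-mat {1} (λ _ k → ≃? (V-dim k s≤m) dS)) zero k

    Q : ℚ
    Q = oppCount q s′ * oppCount q d′

    module _ {M} (M+1 : suc M ≡ m) (j : Fin N) where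

      private
        term : ∀ k → ((Opposed j k × V k s ≃ S₀) × A 0 M j k * δ k ≡ 1ℚ) ⊎ (¬ (Opposed j k × V k s ≃ S₀) × A 0 M j k * δ k ≡ 0ℚ)
        term k = ind-× (opposed-ind M+1 j k) (δ-ind zero k)

      A-δ-0 : ¬ TrivInter F S₀ (V j t) → matVec (A 0 M) δ j ≡ 0ℚ
      A-δ-0 n = sum-0 zeroTerm
        where
        zeroTerm : ∀ k → A 0 M j k * δ k ≡ 0ℚ
        zeroTerm k with term k
        ... | inj₂ (_ , e) = e
        ... | inj₁ ((o , h) , _) = contradiction (λ x x∈S x∈ → o t s s+t x∈ (app (bwd h) x∈S)) n

      A-δ-Q : TrivInter F S₀ (V j t) → matVec (A 0 M) δ j ≡ Q
      A-δ-Q triv with w , w-s , w-low , w-high ← projected j triv = trans (sum-cong equal)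
        (trans (row-⊡ (A 0 s′) (A s d′) (A-row s d′ (ℕ.≤-reflexive s+t)) w)
          (cong (_* oppCount q d′) (A-row 0 s′ (ℕ.≤-trans (ℕ.≤-reflexive e₀) s≤m) w)))
        where
        equal : ∀ k → A 0 M j k * δ k ≡ (A 0 s′ ⊡ A s d′) w k
        equal k = ind-unique {M = 1} {A = λ _ k → A 0 M j k * δ k} {R = λ _ k → Opposed j k × V k s ≃ S₀} (λ _ → term)
          {B = λ _ → (A 0 s′ ⊡ A s d′) w} {S = λ _ → Complementary w} (λ _ → complementary-ind w)
          (Projected.to j w triv w-s w-low w-high) (Projected.from j w triv w-s w-low w-high) zero k

    module _ where
      private
        w : Fin N
        w = proj₁ through
        w-s : V w s ≃ S₀
        w-s = proj₂ through

      -- A chamber through S₀ is a flag of S₀ spliced with a flag of the quotient. From one such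
      -- chamber w, all of them are reached by a free change below index s followed by one above, in
      -- a unique way.
      δ-sum : sumℚ δ ≡ zq s * zq t
      δ-sum = trans (sum-cong equal) (trans (row-⊡ (Class 0 s) (Class s (t ℕ.+ s)) (class-size s t (ℕ.≤-reflexive s+t)) w)
        (cong (_* zq t) (class-size₀ s≤m w)))
        where
        through-ind : Ind (Class 0 s ⊡ Class s (t ℕ.+ s)) (λ w k → V w s ≃ V k s)
        through-ind = ind-⊡ (class-ind 0 s) (class-ind s (t ℕ.+ s))
          (λ r r′ → ≃-trans (high r ℕ.≤-refl) (low r′ ℕ.≤-refl))
          λ {j} {k} at → let v , lo , hi = spliced at in
            v , agree (λ { z≤n → V-0-≃ j v }) (λ p → ≃-sym (hi p)) ,
            agree lo (λ p → V-≃-≥ v k (ℕ.≤-trans (ℕ.≤-reflexive (sym s+t)) p)) ,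
            λ v′ r r′ → splice-unique (λ p → ≃-trans (low r′ p) (≃-sym (lo p))) (λ p → ≃-trans (≃-sym (high r p)) (≃-sym (hi p)))
        equal : ∀ k → δ k ≡ (Class 0 s ⊡ Class s (t ℕ.+ s)) w k
        equal k = ind-unique {M = 1} δ-ind {B = λ _ → (Class 0 s ⊡ Class s (t ℕ.+ s)) w} {S = λ _ k → V w s ≃ V k s}
          (λ _ → through-ind w) (λ h → ≃-trans w-s (≃-sym h)) (λ h → ≃-trans (≃-sym h) w-s) zero k

-- The eigenvalue -ρ and the antidesign.

module Eigenspace (F : FiniteField) (m : ℕ) (N : ℕ) (fl : Fin N → Flags.Flag F m)
  (find : (X : Flags.Flag F m) → Σ (Fin N) λ j → ∀ i → Flags._≃_ F m (Flags.S X i) (Flags.S (fl j) i))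
  (distinct : ∀ {j k} → (∀ i → Flags._≃_ F m (Flags.S (fl j) i) (Flags.S (fl k) i)) → j ≡ k)
  (l : ℕ) (l+2 : suc (suc l) ≡ m) where
  open import Data.Rational using (_+_; _*_; -_)
  open Flags F m
  open Geometry N fl find distinct
  open Counting F m N fl find distinct
  open Opposites F m N fl find distinct
  open Operators (suc l) (ℕ.≤-reflexive l+2)

  A′ : Mat N N
  A′ = A 0 (suc l)

  A′-ind : Ind A′ Opposed
  A′-ind = opposed-ind l+2

  A′-sym : Sym A′
  A′-sym = A-symₘ ℕ.≤-refl

  -- A row of T without entries would sum to 0 instead of q. The neighbour supplies a second
  -- hyperplane for the eigenvector below.
  adjacent : ∀ j → Σ (Fin N) (Adj l j)
  adjacent j with Fin.any? (adj? l j)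
  ... | yes p = p
  ... | no n  = contradiction (trans (sym (sum-0 (λ k → ind-0 (T-ind l) (λ a → n (k , a))))) (panel-size (ℕ.≤-reflexive l+2) j))
                  (ℚ.<⇒≢ 0<q)

  -- The difference of the indicators of the chambers through two hyperplanes lies in the reflection
  -- representation, where A² = ρ²; hence ρ f - A f is an eigenvector for -ρ.
  module Witness (ρ : ℚ) (0<ρ : 0ℚ ℚ.< ρ) (ρ² : ρ * ρ ≡ q ^ℚ l * (oppCount q l * oppCount q l))
    (j₀ k₀ : Fin N) (adj₀ : Adj l j₀ k₀) where

    H : Mat N N
    H = Class 0 (suc l)

    l+1≤m : suc l ≤ m
    l+1≤m = ℕ.<⇒≤ (ℕ.≤-reflexive l+2)

    f Af u : Fin N → ℚ
    f k = 1ℚ * H j₀ k + - 1ℚ * H k₀ k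
    Af = matVec A′ f
    u k = ρ * f k + - 1ℚ * Af k

    H-row : ∀ i j → matVec H (H i) j ≡ zq (suc l) * H i j
    H-row i j = trans (sum-cong (λ k → cong (H j k *_) (class-sym 0 (suc l) i k)))
      (trans (class-class ℕ.≤-refl (class-size₀ l+1≤m) j i) (cong (zq (suc l) *_) (class-sym 0 (suc l) j i)))

    P-f : ∀ k → matVec (P l) f k ≡ f k
    P-f = P-fix {l} (λ j → trans (matVec-lin H 1ℚ (H j₀) (- 1ℚ) (H k₀) (λ _ → refl) j)
      (trans (cong₂ (λ s t → 1ℚ * s + - 1ℚ * t) (H-row j₀ j) (H-row k₀ j)) (eq (zq (suc l)) (H j₀ j) (H k₀ j))))
      where
      eq : ∀ (z x y : ℚ) → 1ℚ * (z * x) + - 1ℚ * (z * y) ≡ z * (1ℚ * x + - 1ℚ * y)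
      eq = solve-∀ ℚ-ring

    sum-f : sumℚ f ≡ 0ℚ
    sum-f = trans (sum-+ (λ k → 1ℚ * H j₀ k) (λ k → - 1ℚ * H k₀ k))
      (trans (cong₂ _+_ (trans (sum-*ˡ 1ℚ (H j₀)) (cong (1ℚ *_) (class-size₀ l+1≤m j₀)))
                        (trans (sum-*ˡ (- 1ℚ) (H k₀)) (cong (- 1ℚ *_) (class-size₀ l+1≤m k₀)))) (eq (zq (suc l))))
      where
      eq : ∀ (z : ℚ) → 1ℚ * z + - 1ℚ * z ≡ 0ℚ
      eq = solve-∀ ℚ-ring

    P⁺-f : ∀ k → matVec (P (suc l)) f k ≡ 0ℚ
    -- As l + 2 = m, every index strictly between 0 and m is free: the class matrix consists of
    -- ones, and P⁺ f is a multiple of the sum of f.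
    P⁺-f j = trans (matVec-P (suc l) f j) (trans (cong (zinv (suc (suc l)) *_) (trans (sum-cong (λ k →
        trans (cong (_* f k) (ind-1 (class-ind 0 (suc (suc l))) (agree (λ { z≤n → V-0-≃ j k }) (λ p → V-≃-≥ j k (ℕ.≤-trans (ℕ.≤-reflexive (sym l+2)) p)))))
              (*-identityˡ (f k)))) sum-f)) (*-zeroʳ (zinv (suc (suc l)))))

    u-eig : IsEigenvector A′ (- ρ) u
    u-eig j = begin
      matVec A′ u j ≡⟨ matVec-lin A′ ρ f (- 1ℚ) Af (λ _ → refl) j ⟩
      ρ * Af j + - 1ℚ * matVec A′ Af j ≡⟨ cong (λ y → ρ * Af j + - 1ℚ * y) (A²-eig (ℕ.n<1+n l) P-f P⁺-f j) ⟩
      ρ * Af j + - 1ℚ * (q ^ℚ l * (oppCount q l * oppCount q l) * f j) ≡⟨ cong (λ y → ρ * Af j + - 1ℚ * (y * f j)) (sym ρ²) ⟩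
      ρ * Af j + - 1ℚ * (ρ * ρ * f j) ≡⟨ eq ρ (Af j) (f j) ⟩
      - ρ * u j ∎
      where
      open ≡-Reasoning
      eq : ∀ (ρ a f : ℚ) → ρ * a + - 1ℚ * (ρ * ρ * f) ≡ - ρ * (ρ * f + - 1ℚ * a)
      eq = solve-∀ ℚ-ring

    f-j₀ : f j₀ ≡ 1ℚ
    f-j₀ = cong₂ (λ x y → 1ℚ * x + - 1ℚ * y) (ind-1 (class-ind 0 (suc l)) {j₀} {j₀} agree-refl)
      (ind-0 (class-ind 0 (suc l)) {k₀} {j₀} (λ p → diff adj₀ (≃-sym (high p ℕ.≤-refl))))

    -- A chamber with the same hyperplane as j₀ contains in it the point of j₀, so it is not
    -- opposite to j₀.
    away : matVec A′ (H j₀) j₀ ≡ 0ℚ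
    away = sum-0 term
      where
      clash : ∀ {k} → ¬ (Opposed j₀ k × Agree 0 (suc l) j₀ k)
      clash (o , p) = contradiction (dim-≤ {U = V j₀ 1} {W = zeroS} (incl λ x∈ → o 1 (suc l) l+2 x∈
          (app (≼-trans (V-mono j₀ (s≤s z≤n)) (fwd (high p ℕ.≤-refl))) x∈))
        (V-dim j₀ (ℕ.≤-trans (s≤s z≤n) l+1≤m)) zeroS-dim) λ ()
      term : ∀ k → A′ j₀ k * H j₀ k ≡ 0ℚ
      term k with ind-× (A′-ind j₀ k) (class-ind 0 (suc l) j₀ k)
      ... | inj₁ (h , _) = contradiction h clash
      ... | inj₂ (_ , e) = e

    -- By `away`, u takes at j₀ the value ρ plus the number of chambers through the hyperplane of k₀
    -- opposite to j₀, which is positive.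
    u-j₀ : ¬ u j₀ ≡ 0ℚ
    u-j₀ u≡0 = ℚ.<⇒≢ (ℚ.+-mono-<-≤ 0<ρ (sum-nonneg (λ k → 0≤-* (ind-nonneg A′-ind j₀ k) (ind-nonneg (class-ind 0 (suc l)) k₀ k))))
      (trans (sym u≡0) (trans (cong₂ (λ x y → ρ * x + - 1ℚ * y) f-j₀ (trans (matVec-lin A′ 1ℚ (H j₀) (- 1ℚ) (H k₀) (λ _ → refl) j₀)
        (cong (λ x → 1ℚ * x + - 1ℚ * matVec A′ (H k₀) j₀) away))) (eq ρ (matVec A′ (H k₀) j₀))))
      where
      eq : ∀ (ρ w : ℚ) → ρ * 1ℚ + - 1ℚ * (1ℚ * 0ℚ + - 1ℚ * w) ≡ ρ + w
      eq = solve-∀ ℚ-ring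

  module Main {s′ d′ n : ℕ} (s+t : suc d′ ℕ.+ suc s′ ≡ m) (s≤t : s′ ≤ d′) (n+n : n ℕ.+ n ≡ m) (n≤st : n ≤ suc s′ ℕ.* suc d′)
    {S₀ : Subspace F m} (dS : Dim S₀ (suc s′)) where
    open AtSubspace s+t dS

    s t : ℕ
    s = suc s′
    t = suc d′

    -- The exponent of ρ is (N - s t) + (s t - n) = N - n with N = n (2n - 1), so it does not depend
    -- on s. The bound `n≤st` makes the truncated subtraction exact.
    κ ρ : ℚ
    κ = q ^ℚ (s ℕ.* t ℕ.∸ n)
    ρ = Q * κ

    0<oppCount : ∀ d → 0ℚ ℚ.< oppCount q d
    0<oppCount zero    = 0<1
    0<oppCount (suc d) = 0<-* (0<q^ (suc d)) (0<oppCount d)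

    0<Q : 0ℚ ℚ.< Q
    0<Q = 0<-* (0<oppCount s′) (0<oppCount d′)

    0<ρ : 0ℚ ℚ.< ρ
    0<ρ = 0<-* 0<Q (0<q^ (s ℕ.* t ℕ.∸ n))

    degree : oppCount q (suc l) ≡ ρ * q ^ℚ n
    degree = begin
      oppCount q (suc l) ≡⟨ cong (oppCount q) (ℕ.suc-injective (trans l+2 (trans (sym s+t) (trans (ℕ.+-comm t s) (ℕ.+-suc s d′))))) ⟩
      oppCount q (suc s′ ℕ.+ d′) ≡⟨ oppCount-split q s′ d′ ⟩
      Q * q ^ℚ (s ℕ.* t) ≡⟨ cong (λ e → Q * q ^ℚ e) (sym (ℕ.m∸n+n≡m n≤st)) ⟩
      Q * q ^ℚ (s ℕ.* t ℕ.∸ n ℕ.+ n) ≡⟨ cong (Q *_) (^-+ q (s ℕ.* t ℕ.∸ n) n) ⟩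
      Q * (κ * q ^ℚ n) ≡⟨ sym (*-assoc Q κ (q ^ℚ n)) ⟩
      ρ * q ^ℚ n ∎
      where open ≡-Reasoning

    -- Square `degree` and cancel q^(2n). The other side releases the factor q^(l+2), which equals
    -- q^(2n) because the dimension is 2n.
    ρ² : ρ * ρ ≡ q ^ℚ l * (oppCount q l * oppCount q l)
    ρ² = *-cancelˡ (0<-* (0<q^ n) (0<q^ n)) (begin
      q ^ℚ n * q ^ℚ n * (ρ * ρ) ≡⟨ eq₁ (q ^ℚ n) ρ ⟩
      ρ * q ^ℚ n * (ρ * q ^ℚ n) ≡⟨ cong₂ _*_ (sym degree) (sym degree) ⟩
      q ^ℚ suc l * a * (q ^ℚ suc l * a) ≡⟨ eq₂ q (q ^ℚ l) a ⟩
      q ^ℚ suc (suc l) * (q ^ℚ l * (a * a)) ≡⟨ cong (_* (q ^ℚ l * (a * a))) (trans (cong (q ^ℚ_) (trans l+2 (sym n+n))) (^-+ q n n)) ⟩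
      q ^ℚ n * q ^ℚ n * (q ^ℚ l * (a * a)) ∎)
      where
      open ≡-Reasoning
      a = oppCount q l
      eq₁ : ∀ (p ρ : ℚ) → p * p * (ρ * ρ) ≡ ρ * p * (ρ * p)
      eq₁ = solve-∀ ℚ-ring
      eq₂ : ∀ (q p a : ℚ) → q * p * a * (q * p * a) ≡ q * (q * p) * (p * (a * a))
      eq₂ = solve-∀ ℚ-ring

    smallest : IsSmallestEigenvalue A′ (- ρ)
    smallest with j₀ , _ ← through with k₀ , adj₀ ← adjacent j₀ =
      (W.u , (j₀ , W.u-j₀) , W.u-eig) , A-form-bound (ℕ.n<1+n l) 0<ρ ρ²
      where module W = Witness ρ 0<ρ ρ² j₀ k₀ adj₀

    module Weighted (v : Fin N → ℚ) (v-κ : ∀ {j} → V j s ≃ S₀ → v j ≡ κ) (v-1 : ∀ {j} → TrivInter F S₀ (V j t) → v j ≡ 1ℚ)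
      (v-0 : ∀ {j} → ¬ V j s ≃ S₀ → ¬ TrivInter F S₀ (V j t) → v j ≡ 0ℚ) where

      s≤m : s ≤ m
      s≤m = ℕ.≤-trans (ℕ.m≤n+m s t) (ℕ.≤-reflexive s+t)

      t≤m : t ≤ m
      t≤m = ℕ.≤-trans (ℕ.m≤m+n t s) (ℕ.≤-reflexive s+t)

      -- As s ≤ t, the space S₀ = V j s lies in V j t, and it is nonzero. So the first two cases in
      -- the definition of v_S exclude each other.
      not-both : ∀ {j} → V j s ≃ S₀ → ¬ TrivInter F S₀ (V j t)
      not-both {j} h triv = contradiction (dim-≤ {U = S₀} {W = zeroS} (incl λ {x} x∈ → triv x x∈ (app (≼-trans (bwd h) (V-mono j (s≤s s≤t))) x∈)) dS zeroS-dim) λ ()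

      -- Up to the scalar Q, v = (A + ρ) δ: so v is orthogonal to the kernel of A + ρ.
      v-form : ∀ j → Q * v j ≡ 1ℚ * matVec A′ δ j + ρ * δ j
      v-form j with ≃? (V-dim j s≤m) dS | TrivInter? dS (V-dim j t≤m)
      ... | yes h | _ = trans (cong (Q *_) (v-κ h)) (trans (eq ρ) (sym (cong₂ (λ x y → 1ℚ * x + ρ * y) (A-δ-0 l+2 j (not-both h)) (ind-1 δ-ind {zero} h))))
        where
        eq : ∀ (ρ : ℚ) → ρ ≡ 1ℚ * 0ℚ + ρ * 1ℚ
        eq = solve-∀ ℚ-ring
      ... | no n | yes triv = trans (cong (Q *_) (v-1 triv)) (trans (eq Q ρ) (sym (cong₂ (λ x y → 1ℚ * x + ρ * y) (A-δ-Q l+2 j triv) (ind-0 δ-ind {zero} n))))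
        where
        eq : ∀ (Q ρ : ℚ) → Q * 1ℚ ≡ 1ℚ * Q + ρ * 0ℚ
        eq = solve-∀ ℚ-ring
      ... | no n | no n′ = trans (cong (Q *_) (v-0 n n′)) (trans (eq Q ρ) (sym (cong₂ (λ x y → 1ℚ * x + ρ * y) (A-δ-0 l+2 j n′) (ind-0 δ-ind {zero} n))))
        where
        eq : ∀ (Q ρ : ℚ) → Q * 0ℚ ≡ 1ℚ * 0ℚ + ρ * 0ℚ
        eq = solve-∀ ℚ-ring

      orthogonal : ∀ e → IsEigenvector A′ (- ρ) e → dot e v ≡ 0ℚ
      orthogonal e eig = *-cancelˡ 0<Q (begin
        Q * dot e v ≡⟨ sym (dot-*ʳ Q e v) ⟩
        dot e (λ k → Q * v k) ≡⟨ dot-linʳ e 1ℚ (matVec A′ δ) ρ δ v-form ⟩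
        1ℚ * dot e (matVec A′ δ) + ρ * dot e δ ≡⟨ cong (λ x → 1ℚ * x + ρ * dot e δ) (trans (sym (dot-sym A′-sym e δ))
            (trans (dot-cong {y = δ} eig (λ _ → refl)) (dot-*ˡ (- ρ) e δ))) ⟩
        1ℚ * (- ρ * dot e δ) + ρ * dot e δ ≡⟨ eq Q ρ (dot e δ) ⟩
        Q * 0ℚ ∎)
        where
        open ≡-Reasoning
        eq : ∀ (Q ρ d : ℚ) → 1ℚ * (- ρ * d) + ρ * d ≡ Q * 0ℚ
        eq = solve-∀ ℚ-ring

      -- Opposition is symmetric with row sums ρ q^n, so summing `v-form` gives Q times the sum of v
      -- as ρ (q^n + 1) times the number of chambers through S₀.
      total : sumℚ v ≡ κ * (q ^ℚ n + 1ℚ) * zq s * zq t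
      total = *-cancelˡ 0<Q (begin
        Q * sumℚ v ≡⟨ sym (sum-*ˡ Q v) ⟩
        sumℚ (λ k → Q * v k) ≡⟨ sum-cong v-form ⟩
        sumℚ (λ j → 1ℚ * matVec A′ δ j + ρ * δ j) ≡⟨ trans (sum-+ (λ j → 1ℚ * matVec A′ δ j) (λ j → ρ * δ j))
            (cong₂ _+_ (sum-*ˡ 1ℚ (matVec A′ δ)) (sum-*ˡ ρ δ)) ⟩
        1ℚ * sumℚ (matVec A′ δ) + ρ * sumℚ δ ≡⟨ cong (λ x → 1ℚ * x + ρ * sumℚ δ) column-sum ⟩
        1ℚ * (oppCount q (suc l) * sumℚ δ) + ρ * sumℚ δ ≡⟨ cong₂ (λ x y → 1ℚ * (x * y) + ρ * y) degree δ-sum ⟩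
        1ℚ * (ρ * q ^ℚ n * (zq s * zq t)) + ρ * (zq s * zq t) ≡⟨ eq Q κ (q ^ℚ n) (zq s) (zq t) ⟩
        Q * (κ * (q ^ℚ n + 1ℚ) * zq s * zq t) ∎)
        where
        open ≡-Reasoning
        eq : ∀ (Q κ p x y : ℚ) → 1ℚ * (Q * κ * p * (x * y)) + Q * κ * (x * y) ≡ Q * (κ * (p + 1ℚ) * x * y)
        eq = solve-∀ ℚ-ring
        column-sum : sumℚ (matVec A′ δ) ≡ oppCount q (suc l) * sumℚ δ
        column-sum = begin
          sumℚ (λ j → sumℚ (λ k → A′ j k * δ k)) ≡⟨ sum-swap (λ j k → A′ j k * δ k) ⟩
          sumℚ (λ k → sumℚ (λ j → A′ j k * δ k)) ≡⟨ sum-cong (λ k → trans (sum-*ʳ (δ k) (λ j → A′ j k)) (cong (_* δ k) (trans (sum-cong (λ j → A′-sym j k))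
              (A-row 0 (suc l) (subst (λ e → suc e ≤ m) (sym (ℕ.+-identityʳ (suc l))) (ℕ.≤-reflexive l+2)) k)))) ⟩
          sumℚ (λ k → oppCount q (suc l) * δ k) ≡⟨ sum-*ˡ (oppCount q (suc l)) δ ⟩
          oppCount q (suc l) * sumℚ δ ∎

open import Data.Nat using (_*_; _+_; _∸_; _^_)
open import Data.Rational using (-_) renaming (_+_ to infixl 6 _+ℚ_; _*_ to infixl 7 _*ℚ_)
open FiniteField using (order)

-- Passing between chambers and flags.

module Chambers (F : FiniteField) (m : ℕ) (E : ChamberEnum F m) where
  open Flags F m

  -- A chamber leaves its values at index 0 and from m on arbitrary, so they are overwritten by the
  -- zero space and the full space.
  chamberSpace : Chamber F m → ℕ → Subspace F m
  chamberSpace X zero    = zeroS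
  chamberSpace X (suc i) = choose (suc i ℕ.<? m) (C X (suc i)) fullS

  toFlag : Chamber F m → Flag
  toFlag X .S = chamberSpace X
  toFlag X .S-dim {zero}  _ = zeroS-dim
  toFlag X .S-dim {suc i} i<m with suc i ℕ.<? m
  ... | yes p = dim (C-dim X (suc i) (s≤s z≤n) p)
  ... | no n  = subst (Dim fullS) (ℕ.≤-antisym (ℕ.≮⇒≥ n) i<m) fullS-dim
  toFlag X .S-suc zero    = incl λ h → mem-resp (chamberSpace X 1) (λ k → sym (h k)) (mem-0 (chamberSpace X 1))
  toFlag X .S-suc (suc i) with suc i ℕ.<? m | suc (suc i) ℕ.<? m
  ... | yes _ | yes p  = incl (λ {x} → C-incl X (suc i) (s≤s z≤n) p x)
  ... | no n  | yes p  = contradiction (ℕ.<⇒≤ p) n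
  ... | _     | no _   = incl λ _ → tt

  toChamber : Flag → Chamber F m
  toChamber X .C             = S X
  toChamber X .C-dim i _ i<m = hasDim (S-dim X (ℕ.<⇒≤ i<m))
  toChamber X .C-incl i _ _ _ = app (S-suc X i)

  fl : Fin (N E) → Flag
  fl j = toFlag (ch E j)

  toFlag-C : ∀ X {i} → 1 ≤ i → i < m → S (toFlag X) i ≃ C X i
  toFlag-C X {suc i} _ i<m = choose-yes (suc i ℕ.<? m) i<m

  abstract
    find : (X : Flag) → Σ (Fin (N E)) λ j → ∀ i → S X i ≃ S (fl j) i
    find X with j , same ← complete E (toChamber X) = j , at
      where
      at : ∀ i → S X i ≃ S (fl j) i
      at zero = S-bottom X ⇄ S-bottom (fl j)
      at (suc i) with suc i ℕ.<? m
      ... | yes p = incl (λ {x} → proj₁ (same (suc i) (s≤s z≤n) p) x) ⇄ incl (λ {x} → proj₂ (same (suc i) (s≤s z≤n) p) x)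
      ... | no n  = incl (λ _ → tt) ⇄ S-top X (ℕ.≮⇒≥ n)

    distinct′ : ∀ {j k} → (∀ i → S (fl j) i ≃ S (fl k) i) → j ≡ k
    distinct′ {j} {k} h = distinct E j k λ i 1≤i i<m →
      let e = ≃-trans (≃-sym (toFlag-C (ch E j) 1≤i i<m)) (≃-trans (h i) (toFlag-C (ch E k) 1≤i i<m)) in
      (λ _ → app (fwd e)) , (λ _ → app (bwd e))

  open Opposites F m (N E) fl find distinct′ using (Opposed)

  toOpposed : ∀ {j k} → Opposite F (ch E j) (ch E k) → Opposed j k
  -- Membership in the space at index 0 is by definition the vanishing of x.
  toOpposed h zero    i′ e x∈ x∈′ = x∈
  toOpposed {j} {k} h (suc i) zero e x∈ x∈′ = x∈′
  toOpposed {j} {k} h (suc i) (suc i′) e {x} x∈ x∈′ = h (suc i) (s≤s z≤n) i<m x (app (fwd (toFlag-C (ch E j) (s≤s z≤n) i<m)) x∈)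
      (subst (λ i → mem (C (ch E k) i) x) (sym (trans (cong (_∸ suc i) (sym e)) (ℕ.m+n∸m≡n (suc i) (suc i′)))) (app (fwd (toFlag-C (ch E k) (s≤s z≤n) i′<m)) x∈′))
    where
    i<m : suc i < m
    i<m = ℕ.≤-trans (ℕ.m<m+n (suc i) (s≤s z≤n)) (ℕ.≤-reflexive e)
    i′<m : suc i′ < m
    i′<m = ℕ.≤-trans (ℕ.m<n+m (suc i′) (s≤s z≤n)) (ℕ.≤-reflexive e)

  fromOpposed : ∀ {j k} → Opposed j k → Opposite F (ch E j) (ch E k)
  fromOpposed {j} {k} o i 1≤i i<m x x∈ x∈′ = o i (m ∸ i) (ℕ.m+[n∸m]≡n (ℕ.<⇒≤ i<m)) (app (bwd (toFlag-C (ch E j) 1≤i i<m)) x∈)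
    (app (bwd (toFlag-C (ch E k) (ℕ.m<n⇒0<n∸m i<m) (ℕ.∸-monoʳ-< 1≤i (ℕ.<⇒≤ i<m)))) x∈′)

  -- `IsAdjacency` consists of two implications only; the case distinction comes from the decision
  -- stored in `indB`.
  adjacency-ind : ∀ {A} → IsAdjacency F E A → ∀ {B} → Ind B Opposed → ∀ j k → A j k ≡ B j k
  adjacency-ind isA indB j k with indB j k
  ... | inj₁ (o , e) = trans (proj₁ (isA j k) (fromOpposed o)) (sym e)
  ... | inj₂ (n , e) = trans (proj₂ (isA j k) (n ∘ toOpposed)) (sym e)

theorem3p20 : (F : FiniteField) (n : ℕ) → 1 ≤ n →
    (s : ℕ) → 1 ≤ s → s ≤ n →
    (S : Subspace F (2 * n)) → HasDim F S s →
    (E : ChamberEnum F (2 * n)) →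
    (A : Fin (N E) → Fin (N E) → ℚ) → IsAdjacency F E A →
    (v : Fin (N E) → ℚ) → IsVS F n s S E v →
    Antidesign A v ×
    (sumℚ v ≡ fromℕ (order F ^ (s * (2 * n ∸ s) ∸ n) * (order F ^ n + 1)
    * z s (order F) * z (2 * n ∸ s) (order F)))
theorem3p20 F (suc n′) 1≤n (suc s′) 1≤s s≤n S₀ dS E A isA v isV =
  (- ρ , ((u , nz , λ j → trans (A≡ u j) (eig j)) , λ x → ℚ.≤-trans (proj₂ smallest x) (ℚ.≤-reflexive (dot-cong {x = x} (λ _ → refl) (λ j → sym (A≡ x j))))) ,
     λ e h → orthogonal e (λ j → trans (sym (A≡ e j)) (h j))) ,
  trans total count
  where
  n m s t l d′ : ℕ
  n = suc n′
  m = 2 * n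
  s = suc s′
  t = m ∸ s
  -- m - 2, in the shape to which `2 * suc n′` unfolds up to one `+-suc`.
  l = n′ + (n′ + 0)
  -- t - 1, the number of positions in the residue above S.
  d′ = m ∸ suc s
  l+2 : suc (suc l) ≡ m
  l+2 = cong suc (sym (ℕ.+-suc n′ (n′ + 0)))
  n+n : n + n ≡ m
  n+n = cong (n +_) (sym (ℕ.+-identityʳ n))
  s<m : s < m
  s<m = ℕ.≤-trans (s≤s s≤n) (ℕ.≤-trans (ℕ.≤-reflexive (ℕ.+-comm 1 n)) (ℕ.≤-trans (ℕ.+-monoʳ-≤ n 1≤n) (ℕ.≤-reflexive n+n)))
  t≡ : t ≡ suc d′
  t≡ = ℕ.+-∸-assoc 1 s<m
  s+t : suc d′ + s ≡ m
  s+t = trans (cong (_+ s) (sym t≡)) (ℕ.m∸n+n≡m (ℕ.<⇒≤ s<m))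
  n≤t : n ≤ suc d′
  n≤t = ℕ.+-cancelʳ-≤ s n (suc d′) (ℕ.≤-trans (ℕ.+-monoʳ-≤ n s≤n) (ℕ.≤-reflexive (trans n+n (sym s+t))))
  open Chambers F m E
  open LinearAlgebra F using (dim; _≃_; _⇄_; incl; app; fwd; bwd; ≃-trans; ≃-sym; TrivInter?)
  module Eig = Eigenspace F m (N E) fl find distinct′ l l+2
  open Eig.Main {s′} {d′} {n} s+t (ℕ.≤-pred (ℕ.≤-trans s≤n n≤t)) n+n (ℕ.≤-trans n≤t (ℕ.m≤n*m (suc d′) s)) {S₀} (dim dS)
    using (ρ; κ; smallest; module Weighted)
  V : Fin (N E) → ℕ → Subspace F m
  V j = Flags.S (fl j)
  C-s : ∀ j → V j s ≃ C (ch E j) s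
  C-s j = toFlag-C (ch E j) (s≤s z≤n) s<m
  C-t : ∀ j → V j (suc d′) ≃ C (ch E j) t
  C-t j = subst (λ e → V j (suc d′) ≃ C (ch E j) e) (sym t≡) (toFlag-C (ch E j) (s≤s z≤n)
    (ℕ.≤-trans (ℕ.m<m+n (suc d′) (s≤s z≤n)) (ℕ.≤-reflexive s+t)))
  toTriv : ∀ {j} → TrivInter F S₀ (V j (suc d′)) → TrivInter F S₀ (C (ch E j) t)
  toTriv {j} h x x∈ x∈′ = h x x∈ (app (bwd (C-t j)) x∈′)
  fromTriv : ∀ {j} → TrivInter F S₀ (C (ch E j) t) → TrivInter F S₀ (V j (suc d′))
  fromTriv {j} h x x∈ x∈′ = h x x∈ (app (fwd (C-t j)) x∈′)
  to≋ : ∀ {j} → V j s ≃ S₀ → _≋_ F (C (ch E j) s) S₀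
  to≋ {j} h = (λ _ → app (fwd (≃-trans (≃-sym (C-s j)) h))) , (λ _ → app (bwd (≃-trans (≃-sym (C-s j)) h)))
  from≋ : ∀ {j} → _≋_ F (C (ch E j) s) S₀ → V j s ≃ S₀
  from≋ {j} (f , g) = ≃-trans (C-s j) (incl (λ {x} → f x) ⇄ incl (λ {x} → g x))
  q : ℚ
  q = fromℕ (order F)
  κ-eq : fromℕ (order F ^ (s * t ∸ n)) ≡ κ
  κ-eq = trans (fromℕ-^ (order F) (s * t ∸ n)) (cong (λ e → q ^ℚ (s * e ∸ n)) t≡)
  open Weighted v (λ {j} h → trans (proj₁ (isV j) (to≋ h)) κ-eq) (λ {j} h → proj₁ (proj₂ (isV j)) (toTriv h))
    (λ {j} h h′ → proj₂ (proj₂ (isV j)) (h ∘ from≋) (h′ ∘ fromTriv))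
  A≡ : ∀ x j → matVec A x j ≡ matVec Eig.A′ x j
  A≡ = matVec-congˡ (adjacency-ind isA Eig.A′-ind)
  u : Fin (N E) → ℚ
  u = proj₁ (proj₁ smallest)
  nz : Σ (Fin (N E)) λ j → ¬ u j ≡ 0ℚ
  nz = proj₁ (proj₂ (proj₁ smallest))
  eig : IsEigenvector Eig.A′ (- ρ) u
  eig = proj₂ (proj₂ (proj₁ smallest))
  count : κ *ℚ (q ^ℚ n +ℚ 1ℚ) *ℚ fromℕ (z s (order F)) *ℚ fromℕ (z (suc d′) (order F)) ≡
    fromℕ (order F ^ (s * t ∸ n) * (order F ^ n + 1) * z s (order F) * z t (order F))
  count = sym (begin
    fromℕ (order F ^ (s * t ∸ n) * (order F ^ n + 1) * z s (order F) * z t (order F))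
      ≡⟨ fromℕ-* (order F ^ (s * t ∸ n) * (order F ^ n + 1) * z s (order F)) (z t (order F)) ⟩
    fromℕ (order F ^ (s * t ∸ n) * (order F ^ n + 1) * z s (order F)) *ℚ fromℕ (z t (order F))
      ≡⟨ cong₂ _*ℚ_ (fromℕ-* (order F ^ (s * t ∸ n) * (order F ^ n + 1)) (z s (order F))) (cong (λ e → fromℕ (z e (order F))) t≡) ⟩
    fromℕ (order F ^ (s * t ∸ n) * (order F ^ n + 1)) *ℚ fromℕ (z s (order F)) *ℚ fromℕ (z (suc d′) (order F))
      ≡⟨ cong (λ e → e *ℚ fromℕ (z s (order F)) *ℚ fromℕ (z (suc d′) (order F))) (trans (fromℕ-* (order F ^ (s * t ∸ n)) (order F ^ n + 1))
           (cong₂ _*ℚ_ κ-eq (trans (fromℕ-+ (order F ^ n) 1) (cong (_+ℚ 1ℚ) (fromℕ-^ (order F) n))))) ⟩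
    κ *ℚ (q ^ℚ n +ℚ 1ℚ) *ℚ fromℕ (z s (order F)) *ℚ fromℕ (z (suc d′) (order F)) ∎)
    where open ≡-Reasoning
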